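{- Let $q\ge 6$ be a prime power, let $\Sigma_\infty$ be a hyperplane of $\mathrm{PG}(6,q)$ and $\mathcal S$ a regular $2$-spread of $\Sigma_\infty$. Let $\mathcal V$ be a ruled quintic surface positioned relative to $\mathcal S$ as in the context, with conic directrix $\mathcal C$ in the plane $\alpha\in\mathcal S$ and splash $\mathbb S\subset\mathcal S$. Let $\ell$ be a line of $\alpha$ with $|\ell\cap\mathcal C|=i$ and let $\pi\in\mathcal S$ with $\pi\neq\alpha$. Consider the $q$ $5$-spaces containing $\pi$ and $\ell$ and distinct from $\Sigma_\infty$. (1) If $\pi\in\mathbb S\setminus\{\alpha\}$, then $q-1$ of them meet $\mathcal V$ in a $5$-dim nrc, and $1$ meets $\mathcal V$ in a twisted cubic together with $i$ generators. (2) If $\pi\in\mathcal S\setminus\mathbb S$, then $q-i$ of them meet $\mathcal V$ in a $5$-dim nrc, and $i$ meet $\mathcal V$ in a $4$-dim nrc together with $1$ generator.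
   Context: Ruled quintic surface: in $\mathrm{PG}(6,q)$, take a non-degenerate conic $\mathcal C$ in a plane and a twisted cubic $\mathcal N_3$ in a $3$-space disjoint from that plane, parametrised as $\{(1,\theta,\theta^2)\}$ and $\{(1,\epsilon,\epsilon^2,\epsilon^3)\}$, and a projectivity $\phi\in\mathrm{PGL}(2,q)$ on parameters; $\mathcal V$ is the union of the $q+1$ lines (generators) joining each point of $\mathcal C$ to its image; $\mathcal C$ is the conic directrix. Bruck–Bose: a regular $2$-spread $\mathcal S$ of the $5$-space $\Sigma_\infty$ is a regular partition of its points into $q^3+1$ planes. The incidence structure whose points are the points of $\mathrm{PG}(6,q)\setminus\Sigma_\infty$ together with the planes of $\mathcal S$, and whose lines are the $3$-spaces meeting $\Sigma_\infty$ exactly in a plane of $\mathcal S$ together with a line $\ell_\infty$ whose points are the planes of $\mathcal S$, is isomorphic to $\mathrm{PG}(2,q^3)$. Positioning: $\mathcal V\cap\Sigma_\infty=\mathcal C$, $\mathcal C$ lies in a plane $\alpha\in\mathcal S$, and the affine points of $\mathcal V$ together with the point $\alpha\in\ell_\infty$ form an $\mathbb F_q$-subplane $\mathcal B$ of this $\mathrm{PG}(2,q^3)$ meeting $\ell_\infty$ only in $\alpha$. The splash $\mathbb S$ is the set of $q^2+1$ planes of $\mathcal S$ corresponding to points of $\ell_\infty$ lying on a line of $\mathrm{PG}(2,q^3)$ that meets $\mathcal B$ in an $\mathbb F_q$-subline ($q+1$ points). An $r$-dim nrc is a normal rational curve spanning an $r$-space; a twisted cubic is a $3$-dim nrc. "Meets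 $\mathcal V$ in $X$" means the intersection with $\mathcal V$ is exactly $X$. -}

module Defs where

open import Data.Nat using (ℕ; zero; suc; _∸_)
open import Data.Fin using (Fin; zero; suc; toℕ)
open import Data.Product using (Σ; ∃; ∃₂; _×_; _,_)
open import Data.Sum using (_⊎_; inj₁; inj₂)
open import Data.Unit using (⊤; tt)
open import Data.Empty using (⊥)
open import Relation.Nullary using (¬_)
open import Relation.Binary.PropositionalEquality using (_≡_; _≢_)
open import Algebra.Structures using (IsCommutativeRing)
open import Function.Bundles using (_↔_)
open import Data.Vec.Functional using (Vector; _∷_; []; _++_)

-- A finite field GF(q): a commutative ring (with propositional equality)
-- in which 0 ≠ 1 and every nonzero element is invertible, together with
-- a bijection Fin q ↔ K.  (q is then automatically a prime power.)

record FiniteField : Set₁ where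
  infixl 6 _+_
  infixl 7 _*_
  field
    K           : Set
    _+_ _*_     : K → K → K
    -_          : K → K
    0# 1#       : K
    isCommRing  : IsCommutativeRing _≡_ _+_ _*_ -_ 0# 1#
    0≢1         : 0# ≢ 1#
    inverse     : ∀ a → a ≢ 0# → ∃ λ b → a * b ≡ 1#
    q           : ℕ
    enumeration : Fin q ↔ K

HasExactly : {A : Set} → (A → A → Set) → (A → Set) → ℕ → Set
HasExactly {A} _~_ P n =
  Σ (Fin n → A) λ xs →
    (∀ k → P (xs k)) ×
    (∀ j k → xs j ~ xs k → j ≡ k) ×
    (∀ a → P a → ∃ λ k → a ~ xs k)

_≐_ : {A : Set} → (A → Set) → (A → Set) → Set
P ≐ Q = ∀ v → (P v → Q v) × (Q v → P v)

module Geometry (F : FiniteField) where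
  open FiniteField F public

  -- vectors of F_q^7 (homogeneous coordinates of PG(6,q))
  V7 : Set
  V7 = Fin 7 → K

  sumF : ∀ {m} → (Fin m → K) → K
  sumF {zero}  f = 0#
  sumF {suc m} f = f zero + sumF (λ j → f (suc j))

  _^_ : K → ℕ → K
  a ^ zero  = 1#
  a ^ suc n = a * (a ^ n)

  lc : ∀ {m} → (Fin m → K) → (Fin m → V7) → V7
  lc c u i = sumF (λ j → c j * u j i)

  IsZero : ∀ {n} → (Fin n → K) → Set
  IsZero v = ∀ i → v i ≡ 0#

  IsPoint : V7 → Set
  IsPoint v = ¬ IsZero v

  -- proportionality (same projective point / same hyperplane)
  _∼_ : ∀ {n} → (Fin n → K) → (Fin n → K) → Set
  v ∼ w = ∃ λ c → c ≢ 0# × (∀ i → w i ≡ c * v i)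

  InSpan : ∀ {m} → (Fin m → V7) → V7 → Set
  InSpan u v = ∃ λ c → ∀ i → v i ≡ lc c u i

  Independent : ∀ {m} → (Fin m → V7) → Set
  Independent u = ∀ c → IsZero (lc c u) → ∀ j → c j ≡ 0#

  SubspacePts : ∀ {m} → (Fin m → V7) → V7 → Set
  SubspacePts u v = IsPoint v × InSpan u v

  ParamOK : K → K → Set
  ParamOK s t = ¬ (s ≡ 0# × t ≡ 0#)

  _∼₂_ : K × K → K × K → Set
  (s , t) ∼₂ (s' , t') = ∃ λ c → c ≢ 0# × s' ≡ c * s × t' ≡ c * t

  nrcPt : (r : ℕ) → (Fin (suc r) → V7) → K → K → V7
  nrcPt r u s t = lc (λ j → (s ^ (r ∸ toℕ j)) * (t ^ toℕ j)) u

  OnNRC : (r : ℕ) → (Fin (suc r) → V7) → V7 → Set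
  OnNRC r u v = IsPoint v × ∃₂ λ s t → ParamOK s t × nrcPt r u s t ∼ v

  -- hyperplanes (5-spaces) given by a nonzero linear functional h
  dot : V7 → V7 → K
  dot h v = sumF (λ i → h i * v i)

  InHyp : V7 → V7 → Set
  InHyp h v = dot h v ≡ 0#

  -- Regular 2-spread of Σ∞ = ⟨b₀,…,b₅⟩, defined by field reduction:
  -- F_{q^3} = F_q[x]/(x³ - c₂x² - c₁x - c₀) with the cubic irreducible,
  -- and w ∈ F_{q^3}² ≅ F_q⁶ (coordinates w₀..w₂ | w₃..w₅ w.r.t. 1,x,x²).
  -- The spread element of w ≠ 0 is the F_q-span of w, x·w, x²·w, mapped
  -- into Σ∞ via the basis b.

  IrreducibleCubic : (Fin 3 → K) → Set
  IrreducibleCubic c =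
    ∀ a → a ^ 3 ≢ c zero + c (suc zero) * a + c (suc (suc zero)) * (a ^ 2)

  module Spread (c : Fin 3 → K) (b : Fin 6 → V7) where

    c₀ c₁ c₂ : K
    c₀ = c zero
    c₁ = c (suc zero)
    c₂ = c (suc (suc zero))

    -- multiplication by x on F_{q^3}², coordinatewise
    mulx : (Fin 6 → K) → (Fin 6 → K)
    mulx w zero                                   = c₀ * w (suc (suc zero))
    mulx w (suc zero)                             = w zero + c₁ * w (suc (suc zero))
    mulx w (suc (suc zero))                       = w (suc zero) + c₂ * w (suc (suc zero))
    mulx w (suc (suc (suc zero)))                 = c₀ * w (suc (suc (suc (suc (suc zero)))))
    mulx w (suc (suc (suc (suc zero))))           =
      w (suc (suc (suc zero))) + c₁ * w (suc (suc (suc (suc (suc zero)))))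
    mulx w (suc (suc (suc (suc (suc zero)))))     =
      w (suc (suc (suc (suc zero)))) + c₂ * w (suc (suc (suc (suc (suc zero)))))

    embed : (Fin 6 → K) → V7
    embed w = lc w b

    spreadBasis : (Fin 6 → K) → Fin 3 → V7
    spreadBasis w zero             = embed w
    spreadBasis w (suc zero)       = embed (mulx w)
    spreadBasis w (suc (suc zero)) = embed (mulx (mulx w))

    ValidIdx : (Fin 6 → K) → Set
    ValidIdx w = ¬ IsZero w

    SpreadPlane : (Fin 6 → K) → V7 → Set
    SpreadPlane w = SubspacePts (spreadBasis w)

    SamePlane : (Fin 6 → K) → (Fin 6 → K) → Set
    SamePlane w w' = SpreadPlane w ≐ SpreadPlane w'

    InSigma : V7 → Set
    InSigma = InSpan b

    -- The Bruck–Bose plane PG(2,q³).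
    -- Points: affine points (inj₁ v, v ∉ Σ∞) and spread planes (inj₂ w).
    BBPt : Set
    BBPt = V7 ⊎ (Fin 6 → K)

    ValidPt : BBPt → Set
    ValidPt (inj₁ v) = IsPoint v × ¬ InSigma v
    ValidPt (inj₂ w) = ValidIdx w

    _≈P_ : BBPt → BBPt → Set
    inj₁ v ≈P inj₁ v' = v ∼ v'
    inj₂ w ≈P inj₂ w' = SamePlane w w'
    inj₁ _ ≈P inj₂ _  = ⊥
    inj₂ _ ≈P inj₁ _  = ⊥

    -- Lines: 3-spaces ⟨U₀..U₃⟩ meeting Σ∞ exactly in a spread plane
    -- (inj₁ U), and the line at infinity ℓ∞ (inj₂ tt).
    BBLine : Set
    BBLine = (Fin 4 → V7) ⊎ ⊤

    ℓ∞ : BBLine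
    ℓ∞ = inj₂ tt

    ValidLine : BBLine → Set
    ValidLine (inj₁ U) =
      Independent U ×
      ∃ λ w → ValidIdx w × ((λ v → SubspacePts U v × InSigma v) ≐ SpreadPlane w)
    ValidLine (inj₂ _) = ⊤

    Inc : BBPt → BBLine → Set
    Inc (inj₁ v) (inj₁ U) = InSpan U v
    Inc (inj₂ w) (inj₁ U) = ∀ v → SpreadPlane w v → InSpan U v
    Inc (inj₁ _) (inj₂ _) = ⊥
    Inc (inj₂ _) (inj₂ _) = ⊤

    -- B is (the point set of) a subplane of order n of the Bruck–Bose plane:
    -- with the lines meeting B in ≥ 2 points it is a projective plane
    -- whose lines have n+1 points.
    module _ (B : BBPt → Set) where
      BP : BBPt → Set
      BP p = ValidPt p × B p

      TwoOn : BBLine → Set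
      TwoOn L = ∃₂ λ p p' → BP p × BP p' × ¬ (p ≈P p') × Inc p L × Inc p' L

      PtsOn : BBLine → BBPt → Set
      PtsOn L p = BP p × Inc p L

      IsSubplaneOfOrder : ℕ → Set
      IsSubplaneOfOrder n =
        (∀ L → ValidLine L → TwoOn L → HasExactly _≈P_ (PtsOn L) (suc n)) ×
        (∀ L M → ValidLine L → ValidLine M → TwoOn L → TwoOn M →
           (∃ λ p → ValidPt p × Inc p L × ¬ Inc p M) →
           ∃ λ p → BP p × Inc p L × Inc p M) ×
        (∃ λ (quad : Fin 4 → BBPt) →
           (∀ k → BP (quad k)) ×
           (∀ j k → quad j ≈P quad k → j ≡ k) ×
           (∀ L → ValidLine L → ∀ j k l → j ≢ k → k ≢ l → j ≢ l →
              Inc (quad j) L → Inc (quad k) L → ¬ Inc (quad l) L))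

      InSplash : (Fin 6 → K) → Set
      InSplash w = ∃ λ L → ValidLine L × Inc (inj₂ w) L × HasExactly _≈P_ (PtsOn L) (suc q)

  -- Ruled quintic surface: conic C(s,t) = s²p₀ + st p₁ + t²p₂, twisted cubic
  -- N(s,t) = s³r₀ + s²t r₁ + st² r₂ + t³ r₃, the seven vectors p, r
  -- independent (plane and 3-space disjoint, spanning PG(6,q)), and the
  -- projectivity φ(s,t) = (a s + b t, c s + d t) with ad - bc ≠ 0.

  record Projectivity : Set where
    field
      a b c d : K
      det≢0   : a * d + - (b * c) ≢ 0#

  module Quintic (p : Fin 3 → V7) (r : Fin 4 → V7) (φ : Projectivity) where
    open Projectivity φ

    φs φt : K → K → K
    φs s t = a * s + b * t
    φt s t = c * s + d * t

    InConic : V7 → Set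
    InConic = OnNRC 2 p

    genBasis : K → K → Fin 2 → V7
    genBasis s t = nrcPt 2 p s t ∷ nrcPt 3 r (φs s t) (φt s t) ∷ []

    OnGen : K × K → V7 → Set
    OnGen (s , t) = SubspacePts (genBasis s t)

    InV : V7 → Set
    InV v = ∃₂ λ s t → ParamOK s t × OnGen (s , t) v

    VH : V7 → V7 → Set
    VH h v = IsPoint v × InV v × InHyp h v

    MeetsInNRC : ℕ → V7 → Set
    MeetsInNRC k h =
      ∃ λ (u : Fin (suc k) → V7) → Independent u × (VH h ≐ OnNRC k u)

    MeetsInNRCAndGens : ℕ → ℕ → V7 → Set
    MeetsInNRCAndGens k n h =
      ∃ λ (u : Fin (suc k) → V7) → Independent u ×
      ∃ λ (g : Fin n → K × K) →
        (∀ j → ParamOK (Data.Product.proj₁ (g j)) (Data.Product.proj₂ (g j))) ×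
        (∀ j j' → g j ∼₂ g j' → j ≡ j') ×
        (VH h ≐ λ v → OnNRC k u v ⊎ ∃ λ j → OnGen (g j) v)

  module Positioned (c : Fin 3 → K) (b : Fin 6 → V7)
                    (p : Fin 3 → V7) (r : Fin 4 → V7) (φ : Projectivity) where
    open Spread c b
    open Quintic p r φ

    Bset : (Fin 6 → K) → BBPt → Set
    Bset wα (inj₁ v) = InV v
    Bset wα (inj₂ w) = SamePlane w wα

    Admissible : (Fin 6 → K) → (Fin 2 → V7) → V7 → Set
    Admissible wπ ℓ h =
      ¬ IsZero h ×
      (∀ k → InHyp h (spreadBasis wπ k)) ×
      (∀ k → InHyp h (ℓ k)) ×
      ¬ (∀ j → InHyp h (b j))

{-# OPTIONS --safe #-}

-- A hyperplane h is a linear functional.  Restricting it to the conic C and to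
-- the twisted cubic N of V gives binary forms Q h (quadratic) and R h (cubic),
-- and (Q h , R h) determines h.  The generator with parameter (s,t) lies in h
-- if both forms vanish there, and otherwise meets it in R h · C − Q h · N.  So
-- the section is a 5-dim nrc if Q h and R h are coprime; a common linear factor
-- splits off a generator, and Q h ∣ R h leaves the twisted cubic l C − N, with
-- R h = l Q h, and the generators at the roots of Q h.
--
-- The hyperplane at infinity h∞ has Q = 0 and R without roots.  The hyperplanes
-- through π and ℓ are h₀ + x h∞: Q is fixed, with the points of ℓ ∩ C as roots,
-- and R runs through a pencil in which each root of Q occurs for exactly one x.
-- It remains to see that π belongs to the splash exactly if Q h ∣ R h for some
-- member h of the pencil.  A line L of the subplane not through α meets every
-- generator, so R g · Q h = R h · Q g for all g, h vanishing on L, and this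
-- forces a common l with R h = l Q h.  Conversely, if R h = l Q h, then the line
-- of the subplane joining the points of l C − N at (1,0) and (0,1) has this same
-- l, so h contains it, and its spread element must be π.
module Submission where

open import Defs
open import Data.Nat as ℕ using (ℕ; zero; suc; _≤_; _∸_; z≤n; s≤s)
import Data.Nat.Properties as ℕₚ
open import Data.Integer as ℤ using (ℤ; -[1+_])
import Data.Integer.Properties as ℤₚ
open import Data.Fin using (Fin; zero; suc; toℕ; punchIn; punchOut; inject≤; _↑ˡ_; _↑ʳ_)
import Data.Fin.Properties as Finₚ
open import Data.Maybe using (Maybe; just; nothing)
open import Data.Product using (∃; ∃₂; _×_; _,_; proj₁; proj₂)
open import Data.Sum using (_⊎_; inj₁; inj₂; [_,_]′)
open import Data.Unit using (tt)
open import Data.Empty using (⊥; ⊥-elim)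
open import Relation.Nullary using (¬_; Dec; yes; no)
open import Relation.Nullary.Decidable using (¬?; via-injection; decidable-stable)
open import Relation.Binary.Definitions using (DecidableEquality)
open import Relation.Binary.PropositionalEquality
  using (_≡_; _≢_; refl; sym; trans; cong; cong₂; subst; module ≡-Reasoning)
open import Function using (_∘_)
open import Function.Bundles using (Inverse)
open import Function.Properties.Inverse using (↔-sym; ↔⇒↣)
open import Data.Vec.Functional using (_∷_; []; _++_)
open import Data.Vec.Functional.Properties using (lookup-++ˡ; lookup-++ʳ)
open import Algebra.Bundles using (CommutativeRing)
import Algebra.Properties.Ring as RingProperties
import Algebra.Properties.AbelianGroup as AbelianGroupProperties
import Algebra.Properties.Semiring.Mult.TCOptimised as Mult
open import Algebra.Solver.Ring.AlmostCommutativeRing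
  using (AlmostCommutativeRing; fromCommutativeRing; _-Raw-AlmostCommutative⟶_)
import Algebra.Solver.Ring as RingSolver

-- A form is used through its values, and a form of degree n is recovered from them when n < q. The
-- identities between forms of hyperplanes have degree at most 5, as in R g · Q h = R h · Q g; this
-- is where q ≥ 6 enters.
--
-- Over F_q a nontrivial common factor of Q h ≠ 0 and R h either yields a linear one, hence a common
-- root, or is Q h itself up to a scalar, and Q h may be irreducible and have no root. Coprimality
-- is therefore expressed as `NoCommonRoot` together with the negation of `LinearlyDivides`.
--
-- That a curve is a normal rational curve is a statement about the dimension of its span, and this
-- dimension is found dually. Let S and m be R h and Q h divided by their common factor. A
-- functional g vanishes on the curve S C - m N exactly if S · Q g = m · R g. The solutions (Q g, R
-- g) form a space of dimension 1, 2 or 3 according to the degree 2, 1 or 0 of m, which leaves a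
-- span of vector dimension 6, 5 or 4.

-- Ring identities in the field.

module FieldArithmetic (F : FiniteField) where
  open Geometry F public
  open ≡-Reasoning

  commutativeRing : CommutativeRing _ _
  commutativeRing = record { isCommutativeRing = isCommRing }

  open CommutativeRing commutativeRing public
    using (+-comm; +-assoc; *-comm; *-assoc; distribˡ; distribʳ;
           +-identityˡ; +-identityʳ; *-identityˡ; *-identityʳ; zeroˡ; zeroʳ;
           -‿inverseʳ)

  private
    open Mult (CommutativeRing.semiring commutativeRing) renaming (_×_ to _⋆_)
    open RingProperties (CommutativeRing.ring commutativeRing)
      using (-‿distribˡ-*; -‿distribʳ-*; -0#≈0#; -‿involutive)
    open AbelianGroupProperties (CommutativeRing.+-abelianGroup commutativeRing)
      using (⁻¹-∙-comm)

    -- The solver compares coefficients by computation, which equality in K does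
    -- not support; hence integer coefficients.
    fromℤ : ℤ → K
    fromℤ (ℤ.+ n)     = n ⋆ 1#
    fromℤ -[1+ n ]  = - (suc n ⋆ 1#)

    fromℤ-⊖ : ∀ m n → fromℤ (m ℤ.⊖ n) ≡ m ⋆ 1# + - (n ⋆ 1#)
    fromℤ-⊖ zero    zero    = sym (-‿inverseʳ 0#)
    fromℤ-⊖ zero    (suc n) = sym (+-identityˡ _)
    fromℤ-⊖ (suc m) zero    = sym (trans (cong (suc m ⋆ 1# +_) -0#≈0#) (+-identityʳ _))
    fromℤ-⊖ (suc m) (suc n) = begin
      fromℤ (suc m ℤ.⊖ suc n)                        ≡⟨ cong fromℤ (ℤₚ.[1+m]⊖[1+n]≡m⊖n m n) ⟩
      fromℤ (m ℤ.⊖ n)                                ≡⟨ fromℤ-⊖ m n ⟩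
      m ⋆ 1# + - (n ⋆ 1#)                            ≡⟨ cong (_+ - (n ⋆ 1#)) (sym (+-identityʳ _)) ⟩
      m ⋆ 1# + 0# + - (n ⋆ 1#)                       ≡⟨ cong (λ z → m ⋆ 1# + z + - (n ⋆ 1#)) (sym (-‿inverseʳ 1#)) ⟩
      m ⋆ 1# + (1# + - 1#) + - (n ⋆ 1#)              ≡⟨ cong (_+ - (n ⋆ 1#)) (sym (+-assoc _ _ _)) ⟩
      (m ⋆ 1# + 1#) + - 1# + - (n ⋆ 1#)              ≡⟨ +-assoc _ _ _ ⟩
      (m ⋆ 1# + 1#) + (- 1# + - (n ⋆ 1#))            ≡⟨ cong₂ _+_ (+-comm _ _) (⁻¹-∙-comm _ _) ⟩
      (1# + m ⋆ 1#) + - (1# + n ⋆ 1#)                ≡⟨ cong₂ (λ x y → x + - y) (sym (1+× m 1#)) (sym (1+× n 1#)) ⟩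
      suc m ⋆ 1# + - (suc n ⋆ 1#)                    ∎

    fromℤ-neg : ∀ i → fromℤ (ℤ.- i) ≡ - fromℤ i
    fromℤ-neg (ℤ.+ zero)   = sym -0#≈0#
    fromℤ-neg (ℤ.+ suc n)  = refl
    fromℤ-neg -[1+ n ]   = sym (-‿involutive _)

    fromℤ-+ : ∀ i j → fromℤ (i ℤ.+ j) ≡ fromℤ i + fromℤ j
    fromℤ-+ (ℤ.+ m)    (ℤ.+ n)    = ×-homo-+ 1# m n
    fromℤ-+ (ℤ.+ m)    -[1+ n ] = fromℤ-⊖ m (suc n)
    fromℤ-+ -[1+ m ] (ℤ.+ n)    = trans (fromℤ-⊖ n (suc m)) (+-comm _ _)
    fromℤ-+ -[1+ m ] -[1+ n ] = begin
      - (suc (suc (m ℕ.+ n)) ⋆ 1#)       ≡⟨ cong (λ k → - (k ⋆ 1#)) (sym (ℕₚ.+-suc (suc m) n)) ⟩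
      - ((suc m ℕ.+ suc n) ⋆ 1#)         ≡⟨ cong -_ (×-homo-+ 1# (suc m) (suc n)) ⟩
      - (suc m ⋆ 1# + suc n ⋆ 1#)        ≡⟨ sym (⁻¹-∙-comm _ _) ⟩
      - (suc m ⋆ 1#) + - (suc n ⋆ 1#)    ∎

    fromℤ-pos* : ∀ m j → fromℤ (ℤ.+ m ℤ.* j) ≡ fromℤ (ℤ.+ m) * fromℤ j
    fromℤ-pos* m (ℤ.+ n)  = trans (cong fromℤ (sym (ℤₚ.pos-* m n))) (×1-homo-* m n)
    fromℤ-pos* m -[1+ n ] = begin
      fromℤ (ℤ.+ m ℤ.* -[1+ n ])               ≡⟨ cong fromℤ (sym (ℤₚ.neg-distribʳ-* (ℤ.+ m) (ℤ.+ suc n))) ⟩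
      fromℤ (ℤ.- (ℤ.+ m ℤ.* ℤ.+ suc n))        ≡⟨ fromℤ-neg (ℤ.+ m ℤ.* ℤ.+ suc n) ⟩
      - fromℤ (ℤ.+ m ℤ.* ℤ.+ suc n)            ≡⟨ cong -_ (fromℤ-pos* m (ℤ.+ suc n)) ⟩
      - (fromℤ (ℤ.+ m) * fromℤ (ℤ.+ suc n))    ≡⟨ -‿distribʳ-* _ _ ⟩
      fromℤ (ℤ.+ m) * fromℤ -[1+ n ]           ∎

    fromℤ-* : ∀ i j → fromℤ (i ℤ.* j) ≡ fromℤ i * fromℤ j
    fromℤ-* (ℤ.+ m) j  = fromℤ-pos* m j
    fromℤ-* -[1+ m ] j = begin
      fromℤ (-[1+ m ] ℤ.* j)               ≡⟨ cong fromℤ (sym (ℤₚ.neg-distribˡ-* (ℤ.+ suc m) j)) ⟩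
      fromℤ (ℤ.- (ℤ.+ suc m ℤ.* j))        ≡⟨ fromℤ-neg (ℤ.+ suc m ℤ.* j) ⟩
      - fromℤ (ℤ.+ suc m ℤ.* j)            ≡⟨ cong -_ (fromℤ-pos* (suc m) j) ⟩
      - (fromℤ (ℤ.+ suc m) * fromℤ j)      ≡⟨ -‿distribˡ-* _ _ ⟩
      fromℤ -[1+ m ] * fromℤ j             ∎

    almostCommutativeRing : AlmostCommutativeRing _ _
    almostCommutativeRing = fromCommutativeRing commutativeRing

    ℤ⟶K : CommutativeRing.rawRing ℤₚ.+-*-commutativeRing
            -Raw-AlmostCommutative⟶ almostCommutativeRing
    ℤ⟶K = record
      { ⟦_⟧ = fromℤ ; +-homo = fromℤ-+ ; *-homo = fromℤ-* ; -‿homo = fromℤ-neg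
      ; 0-homo = refl ; 1-homo = refl }

    coefficient≟ : ∀ i j → Maybe (fromℤ i ≡ fromℤ j)
    coefficient≟ i j with i ℤ.≟ j
    ... | yes eq = just (cong fromℤ eq)
    ... | no  _  = nothing

  open RingSolver (CommutativeRing.rawRing ℤₚ.+-*-commutativeRing)
                  almostCommutativeRing ℤ⟶K coefficient≟ public
    using (solve; _:=_; _:+_; _:*_; :-_; _:-_; con)
    renaming (Polynomial to Poly)

  :0 :1 : ∀ {n} → Poly n
  :0 = con (ℤ.+ 0)
  :1 = con (ℤ.+ 1)

-- Finite index sets.

-- Deleting the value `f zero` with `punchOut` leaves an injection of one element fewer into one
-- element fewer. The enumerated complement is the source of the counts `q ∸ n`.
injection-complement : ∀ {m n} (f : Fin m → Fin n) → (∀ j k → f j ≡ f k → j ≡ k) →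
  ∃ λ (g : Fin (n ℕ.∸ m) → Fin n) → (∀ j k → g j ≡ g k → j ≡ k) ×
    (∀ j k → g j ≢ f k) × (∀ x → (∀ k → x ≢ f k) → ∃ λ j → x ≡ g j)
injection-complement {zero} f inj = (λ j → j) , (λ j k eq → eq) , (λ j ()) , λ x _ → x , refl
injection-complement {suc m} {zero} f inj with () ← f zero
injection-complement {suc m} {suc n} f inj = compose (injection-complement f′ f′-inj)
  where
  f₀≢ : ∀ k → f zero ≢ f (suc k)
  f₀≢ k eq = Finₚ.0≢1+n (inj zero (suc k) eq)
  f′ : Fin m → Fin n
  f′ k = punchOut (f₀≢ k)
  f′-inj : ∀ j k → f′ j ≡ f′ k → j ≡ k
  f′-inj j k eq = Finₚ.suc-injective (inj (suc j) (suc k) (Finₚ.punchOut-injective (f₀≢ j) (f₀≢ k) eq))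
  compose : (∃ λ (g : Fin (n ℕ.∸ m) → Fin n) → (∀ j k → g j ≡ g k → j ≡ k) ×
               (∀ j k → g j ≢ f′ k) × (∀ x → (∀ k → x ≢ f′ k) → ∃ λ j → x ≡ g j)) →
            ∃ λ (g : Fin (n ℕ.∸ m) → Fin (suc n)) → (∀ j k → g j ≡ g k → j ≡ k) ×
               (∀ j k → g j ≢ f k) × (∀ x → (∀ k → x ≢ f k) → ∃ λ j → x ≡ g j)
  compose (g , g-inj , avoids , covers) = punchIn (f zero) ∘ g ,
    (λ j k eq → g-inj j k (Finₚ.punchIn-injective (f zero) (g j) (g k) eq)) , avoids′ , covers′
    where
    avoids′ : ∀ j k → punchIn (f zero) (g j) ≢ f k
    avoids′ j zero    eq = Finₚ.punchInᵢ≢i (f zero) (g j) eq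
    avoids′ j (suc k) eq = avoids j k (Finₚ.punchIn-injective (f zero) (g j) (f′ k)
      (trans eq (sym (Finₚ.punchIn-punchOut (f₀≢ k)))))
    covers′ : ∀ x → (∀ k → x ≢ f k) → ∃ λ j → x ≡ punchIn (f zero) (g j)
    covers′ x x≢f = lift (covers (punchOut f₀≢x) (λ k eq →
        x≢f (suc k) (Finₚ.punchOut-injective f₀≢x (f₀≢ k) eq)))
      where
      f₀≢x : f zero ≢ x
      f₀≢x eq = x≢f zero (sym eq)
      lift : (∃ λ j → punchOut f₀≢x ≡ g j) → ∃ λ j → x ≡ punchIn (f zero) (g j)
      lift (j , eq) = j , trans (sym (Finₚ.punchIn-punchOut f₀≢x)) (cong (punchIn (f zero)) eq)

↑-elim : ∀ m {n} {A : Fin (m ℕ.+ n) → Set} → (∀ j → A (j ↑ˡ n)) → (∀ j → A (m ↑ʳ j)) → ∀ j → A j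
↑-elim zero    left right j       = right j
↑-elim (suc m) left right zero    = left zero
↑-elim (suc m) left right (suc j) = ↑-elim m (left ∘ suc) right j

-- Linear algebra over F_q.

module LinearAlgebra (F : FiniteField) where
  open FieldArithmetic F public
  open ≡-Reasoning

  infix 4 _≟_
  _≟_ : DecidableEquality K
  _≟_ = via-injection (↔⇒↣ (↔-sym enumeration)) Finₚ._≟_

  element : Fin q → K
  element = Inverse.to enumeration

  element-injective : ∀ j k → element j ≡ element k → j ≡ k
  element-injective j k eq =
    trans (sym (Inverse.strictlyInverseʳ enumeration j))
          (trans (cong (Inverse.from enumeration) eq) (Inverse.strictlyInverseʳ enumeration k))

  index : K → Fin q
  index = Inverse.from enumeration

  element-index : ∀ x → element (index x) ≡ x
  element-index = Inverse.strictlyInverseˡ enumeration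

  index-injective : ∀ x y → index x ≡ index y → x ≡ y
  index-injective x y eq =
    trans (sym (element-index x)) (trans (cong element eq) (element-index y))

  -- x ≡ y modulo hypotheses: the last argument is the ring identity writing x − y
  -- as a linear combination of their differences.
  lincomb₁ : ∀ {x y a b} k → a ≡ b → x ≡ y + k * (a + - b) → x ≡ y
  lincomb₁ {y = y} {a} k refl eq = trans eq
    (solve 3 (λ y k a → y :+ k :* (a :- a) := y) refl y k a)

  lincomb₂ : ∀ {x y a b c d} k l → a ≡ b → c ≡ d →
             x ≡ y + k * (a + - b) + l * (c + - d) → x ≡ y
  lincomb₂ k l eq eq′ eq″ = lincomb₁ k eq (lincomb₁ l eq′ eq″)

  lincomb₃ : ∀ {x y a b c d e f} k l m → a ≡ b → c ≡ d → e ≡ f →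
             x ≡ y + k * (a + - b) + l * (c + - d) + m * (e + - f) → x ≡ y
  lincomb₃ k l m eq eq′ eq″ eq‴ = lincomb₂ k l eq eq′ (lincomb₁ m eq″ eq‴)

  recip : ∀ {a} → a ≢ 0# → K
  recip {a} a≢0 = proj₁ (inverse a a≢0)

  *-recip : ∀ {a} (a≢0 : a ≢ 0#) → a * recip a≢0 ≡ 1#
  *-recip {a} a≢0 = proj₂ (inverse a a≢0)

  *-cancelˡ-≢0 : ∀ {a x y} → a ≢ 0# → a * x ≡ a * y → x ≡ y
  *-cancelˡ-≢0 {a} {x} {y} a≢0 eq with inverse a a≢0
  ... | (a⁻¹ , inv) = lincomb₂ a⁻¹ (y + - x) eq inv
    (solve 4 (λ a a⁻¹ x y → x := y :+ a⁻¹ :* (a :* x :- a :* y) :+ (y :- x) :* (a :* a⁻¹ :- :1))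
       refl a a⁻¹ x y)

  *≡0 : ∀ {a b} → a ≢ 0# → a * b ≡ 0# → b ≡ 0#
  *≡0 {a} a≢0 eq = *-cancelˡ-≢0 a≢0 (trans eq (sym (zeroʳ a)))

  *≢0 : ∀ {a b} → a ≢ 0# → b ≢ 0# → a * b ≢ 0#
  *≢0 a≢0 b≢0 eq = b≢0 (*≡0 a≢0 eq)

  *≡0⇒⊎ : ∀ a b → a * b ≡ 0# → a ≡ 0# ⊎ b ≡ 0#
  *≡0⇒⊎ a b eq with a ≟ 0#
  ... | yes a≡0 = inj₁ a≡0
  ... | no  a≢0 = inj₂ (*≡0 a≢0 eq)

  a-b≡0⇒a≡b : ∀ {a b} → a + - b ≡ 0# → a ≡ b
  a-b≡0⇒a≡b {a} {b} eq = lincomb₁ 1# eq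
    (solve 2 (λ a b → a := b :+ :1 :* (a :- b :- :0)) refl a b)

  -a≢0 : ∀ {a} → a ≢ 0# → - a ≢ 0#
  -a≢0 {a} a≢0 eq = a≢0 (lincomb₁ (- 1#) eq
    (solve 1 (λ a → a := :0 :+ :- :1 :* (:- a :- :0)) refl a))

  inverse≢0 : ∀ {a b} → a * b ≡ 1# → b ≢ 0#
  inverse≢0 {a} eq refl = 0≢1 (trans (sym (zeroʳ a)) eq)

  sumF-cong : ∀ {n} {f g : Fin n → K} → (∀ j → f j ≡ g j) → sumF f ≡ sumF g
  sumF-cong {zero}  eq = refl
  sumF-cong {suc n} eq = cong₂ _+_ (eq zero) (sumF-cong (eq ∘ suc))

  sumF-zero : ∀ {n} {f : Fin n → K} → (∀ j → f j ≡ 0#) → sumF f ≡ 0#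
  sumF-zero {zero}  eq = refl
  sumF-zero {suc n} eq = trans (cong₂ _+_ (eq zero) (sumF-zero (eq ∘ suc))) (+-identityˡ 0#)

  sumF-+ : ∀ {n} (f g : Fin n → K) → sumF (λ j → f j + g j) ≡ sumF f + sumF g
  sumF-+ {zero}  f g = sym (+-identityˡ 0#)
  sumF-+ {suc n} f g = trans (cong (f zero + g zero +_) (sumF-+ (f ∘ suc) (g ∘ suc)))
    (solve 4 (λ a b c d → a :+ b :+ (c :+ d) := a :+ c :+ (b :+ d)) refl
       (f zero) (g zero) (sumF (f ∘ suc)) (sumF (g ∘ suc)))

  sumF-* : ∀ {n} a (f : Fin n → K) → sumF (λ j → a * f j) ≡ a * sumF f
  sumF-* {zero}  a f = sym (zeroʳ a)
  sumF-* {suc n} a f = trans (cong (a * f zero +_) (sumF-* a (f ∘ suc))) (sym (distribˡ a _ _))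

  sumF-swap : ∀ {m n} (f : Fin m → Fin n → K) →
              sumF (λ i → sumF (f i)) ≡ sumF (λ j → sumF (λ i → f i j))
  sumF-swap {zero} {n} f = sym (sumF-zero {n} {f = λ _ → 0#} (λ _ → refl))
  sumF-swap {suc m} f = trans (cong (sumF (f zero) +_) (sumF-swap (f ∘ suc)))
    (sym (sumF-+ (f zero) (λ j → sumF (λ i → f (suc i) j))))

  sumF-splitAt : ∀ m {n} (f : Fin (m ℕ.+ n) → K) →
                 sumF f ≡ sumF (λ j → f (j ↑ˡ n)) + sumF (λ j → f (m ↑ʳ j))
  sumF-splitAt zero    f = sym (+-identityˡ _)
  sumF-splitAt (suc m) f =
    trans (cong (f zero +_) (sumF-splitAt m (f ∘ suc))) (sym (+-assoc _ _ _))

  δ : ∀ {n} → Fin n → Fin n → K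
  δ zero    zero    = 1#
  δ zero    (suc j) = 0#
  δ (suc i) zero    = 0#
  δ (suc i) (suc j) = δ i j

  δ-diagonal : ∀ {n} (i : Fin n) → δ i i ≡ 1#
  δ-diagonal zero    = refl
  δ-diagonal (suc i) = δ-diagonal i

  sumF-δ : ∀ {n} (i : Fin n) (f : Fin n → K) → sumF (λ j → δ i j * f j) ≡ f i
  sumF-δ zero    f = trans (cong₂ _+_ (*-identityˡ (f zero)) (sumF-zero (λ j → zeroˡ (f (suc j)))))
                           (+-identityʳ (f zero))
  sumF-δ (suc i) f = trans (cong₂ _+_ (zeroˡ (f zero)) (sumF-δ i (f ∘ suc))) (+-identityˡ _)

  Vect : ℕ → Set
  Vect n = Fin n → K

  infix 8 _∙_
  _∙_ : ∀ {n} → Vect n → Vect n → K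
  h ∙ v = sumF (λ i → h i * v i)

  infixl 6 _⊕_
  infixr 7 _⊛_
  _⊕_ : ∀ {n} → Vect n → Vect n → Vect n
  (v ⊕ w) i = v i + w i

  _⊛_ : ∀ {n} → K → Vect n → Vect n
  (a ⊛ v) i = a * v i

  comb : ∀ {m n} → Vect m → (Fin m → Vect n) → Vect n
  comb c u i = sumF (λ j → c j * u j i)

  InSpanOf : ∀ {m n} → (Fin m → Vect n) → Vect n → Set
  InSpanOf u v = ∃ λ c → ∀ i → v i ≡ comb c u i

  LinIndep : ∀ {m n} → (Fin m → Vect n) → Set
  LinIndep u = ∀ c → (∀ i → comb c u i ≡ 0#) → ∀ j → c j ≡ 0#

  ∙-comm : ∀ {n} (h v : Vect n) → h ∙ v ≡ v ∙ h
  ∙-comm h v = sumF-cong (λ i → *-comm (h i) (v i))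

  ∙-congʳ : ∀ {n} (h : Vect n) {v w} → (∀ i → v i ≡ w i) → h ∙ v ≡ h ∙ w
  ∙-congʳ h eq = sumF-cong (λ i → cong (h i *_) (eq i))

  ∙-congˡ : ∀ {n} {g h : Vect n} v → (∀ i → g i ≡ h i) → g ∙ v ≡ h ∙ v
  ∙-congˡ v eq = sumF-cong (λ i → cong (_* v i) (eq i))

  ∙-⊕ʳ : ∀ {n} (h v w : Vect n) → h ∙ (v ⊕ w) ≡ h ∙ v + h ∙ w
  ∙-⊕ʳ h v w = trans (sumF-cong (λ i → distribˡ (h i) (v i) (w i))) (sumF-+ (λ i → h i * v i) (λ i → h i * w i))

  ∙-⊛ʳ : ∀ {n} (h : Vect n) a v → h ∙ (a ⊛ v) ≡ a * (h ∙ v)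
  ∙-⊛ʳ h a v = trans
    (sumF-cong (λ i → solve 3 (λ h a v → h :* (a :* v) := a :* (h :* v)) refl (h i) a (v i)))
    (sumF-* a (λ i → h i * v i))

  ∙-⊕ˡ : ∀ {n} (g h v : Vect n) → (g ⊕ h) ∙ v ≡ g ∙ v + h ∙ v
  ∙-⊕ˡ g h v = trans (sumF-cong (λ i → distribʳ (v i) (g i) (h i))) (sumF-+ (λ i → g i * v i) (λ i → h i * v i))

  ∙-⊛ˡ : ∀ {n} a (h v : Vect n) → (a ⊛ h) ∙ v ≡ a * (h ∙ v)
  ∙-⊛ˡ a h v = trans (sumF-cong (λ i → *-assoc a (h i) (v i))) (sumF-* a (λ i → h i * v i))

  ∙-combʳ : ∀ {m n} (h : Vect n) (c : Vect m) u → h ∙ comb c u ≡ sumF (λ j → c j * (h ∙ u j))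
  ∙-combʳ h c u = begin
    sumF (λ i → h i * sumF (λ j → c j * u j i))
      ≡⟨ sumF-cong (λ i → sym (sumF-* (h i) (λ j → c j * u j i))) ⟩
    sumF (λ i → sumF (λ j → h i * (c j * u j i)))
      ≡⟨ sumF-swap (λ i j → h i * (c j * u j i)) ⟩
    sumF (λ j → sumF (λ i → h i * (c j * u j i)))
      ≡⟨ sumF-cong (λ j → ∙-⊛ʳ h (c j) (u j)) ⟩
    sumF (λ j → c j * (h ∙ u j)) ∎

  ∙-δ : ∀ {n} (i : Fin n) (v : Vect n) → δ i ∙ v ≡ v i
  ∙-δ = sumF-δ

  comb-comb : ∀ {l m n} (c : Vect l) (a : Fin l → Vect m) (u : Fin m → Vect n) i →
              comb c (λ k → comb (a k) u) i ≡ comb (comb c a) u i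
  comb-comb c a u i = begin
    sumF (λ k → c k * sumF (λ j → a k j * u j i))
      ≡⟨ sumF-cong (λ k → sym (sumF-* (c k) (λ j → a k j * u j i))) ⟩
    sumF (λ k → sumF (λ j → c k * (a k j * u j i)))
      ≡⟨ sumF-swap (λ k j → c k * (a k j * u j i)) ⟩
    sumF (λ j → sumF (λ k → c k * (a k j * u j i)))
      ≡⟨ sumF-cong (λ j → trans (sumF-cong (λ k →
           solve 3 (λ c a u → c :* (a :* u) := u :* (c :* a)) refl (c k) (a k j) (u j i)))
           (trans (sumF-* (u j i) (λ k → c k * a k j)) (*-comm (u j i) (comb c a j)))) ⟩
    sumF (λ j → comb c a j * u j i) ∎

  comb-++ : ∀ {m m′ n} (c : Vect (m ℕ.+ m′)) (u : Fin m → Vect n) (w : Fin m′ → Vect n) i →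
            comb c (u ++ w) i ≡ comb (λ j → c (j ↑ˡ m′)) u i + comb (λ j → c (m ↑ʳ j)) w i
  comb-++ {m} {m′} c u w i = trans (sumF-splitAt m _)
    (cong₂ _+_ (sumF-cong (λ j → cong (λ v → c (j ↑ˡ m′) * v i) (lookup-++ˡ u w j)))
               (sumF-cong (λ j → cong (λ v → c (m ↑ʳ j) * v i) (lookup-++ʳ u w j))))

  InSpanOf-member : ∀ {m n} (u : Fin m → Vect n) j → InSpanOf u (u j)
  InSpanOf-member u j = δ j , λ i → sym (sumF-δ j (λ k → u k i))

  InSpanOf-resp : ∀ {m n} {u : Fin m → Vect n} {v w} → (∀ i → w i ≡ v i) →
                  InSpanOf u v → InSpanOf u w
  InSpanOf-resp eq (c , e) = c , λ i → trans (eq i) (e i)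

  InSpanOf-comb : ∀ {l m n} {u : Fin m → Vect n} (c : Vect l) (w : Fin l → Vect n) →
                  (∀ k → InSpanOf u (w k)) → InSpanOf u (comb c w)
  InSpanOf-comb {u = u} c w mem =
    comb c (λ k → proj₁ (mem k)) ,
    λ i → trans (sumF-cong (λ k → cong (c k *_) (proj₂ (mem k) i)))
                (comb-comb c (λ k → proj₁ (mem k)) u i)

  InSpanOf-trans : ∀ {l m n} {u : Fin m → Vect n} {w : Fin l → Vect n} {v} →
                   (∀ k → InSpanOf u (w k)) → InSpanOf w v → InSpanOf u v
  InSpanOf-trans {w = w} mem (c , e) = InSpanOf-resp e (InSpanOf-comb c w mem)

  InSpanOf-⊕ : ∀ {m n} {u : Fin m → Vect n} {v w} → InSpanOf u v → InSpanOf u w → InSpanOf u (v ⊕ w)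
  InSpanOf-⊕ {u = u} (c , e) (d , e′) = c ⊕ d , λ i →
    trans (cong₂ _+_ (e i) (e′ i))
      (sym (trans (sumF-cong (λ j → distribʳ (u j i) (c j) (d j))) (sumF-+ (λ j → c j * u j i) (λ j → d j * u j i))))

  InSpanOf-⊛ : ∀ {m n} {u : Fin m → Vect n} {v} a → InSpanOf u v → InSpanOf u (a ⊛ v)
  InSpanOf-⊛ {u = u} a (c , e) = a ⊛ c , λ i →
    trans (cong (a *_) (e i))
      (sym (trans (sumF-cong (λ j → *-assoc a (c j) (u j i))) (sumF-* a (λ j → c j * u j i))))

  kills-span : ∀ {m n} {u : Fin m → Vect n} {v} h → (∀ j → h ∙ u j ≡ 0#) → InSpanOf u v → h ∙ v ≡ 0#
  kills-span {u = u} h kills (c , e) = trans (∙-congʳ h e) (trans (∙-combʳ h c u)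
    (sumF-zero {f = λ j → c j * (h ∙ u j)}
       (λ j → trans (cong (c j *_) (kills j)) (zeroʳ (c j)))))

  abstract
    pivot : ∀ {n} (f : Fin n → K) → (∃ λ i → f i ≢ 0#) ⊎ (∀ i → f i ≡ 0#)
    pivot f with Finₚ.any? (λ i → ¬? (f i ≟ 0#))
    ... | yes p = inj₁ p
    ... | no ¬p = inj₂ (λ i → decidable-stable (f i ≟ 0#) (λ fi≢0 → ¬p (i , fi≢0)))

    -- Gaussian elimination: a row `p` with nonzero first entry eliminates the first unknown from
    -- the other rows and then determines it. If the first column is zero, the first unit vector is
    -- a solution.
    homogeneous-solution : ∀ n (A : Fin n → Vect (suc n)) →
      ∃ λ x → (∃ λ j → x j ≢ 0#) × (∀ i → A i ∙ x ≡ 0#)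
    homogeneous-solution zero    A = (λ _ → 1#) , (zero , λ eq → 0≢1 (sym eq)) , λ ()
    homogeneous-solution (suc n) A with pivot (λ i → A i zero)
    ... | inj₂ col0 = δ zero , (zero , λ eq → 0≢1 (sym eq)) ,
                      λ i → trans (∙-comm (A i) (δ zero)) (trans (∙-δ zero (A i)) (col0 i))
    ... | inj₁ (p , Ap≢0) with inverse (A p zero) Ap≢0
    ...   | (a⁻¹ , inv) = x , (suc (proj₁ nonzero) , proj₂ nonzero) , solves
      where
      A′ : Fin n → Vect (suc n)
      A′ k j = A (punchIn p k) (suc j) + - (A (punchIn p k) zero * a⁻¹) * A p (suc j)
      rest : ∃ λ x → (∃ λ j → x j ≢ 0#) × (∀ i → A′ i ∙ x ≡ 0#)
      rest = homogeneous-solution n A′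
      y : Vect (suc n)
      y = proj₁ rest
      nonzero : ∃ λ j → y j ≢ 0#
      nonzero = proj₁ (proj₂ rest)
      x : Vect (suc (suc n))
      x zero    = - (a⁻¹ * (A p ∘ suc) ∙ y)
      x (suc j) = y j
      solves-p : A p ∙ x ≡ 0#
      solves-p = lincomb₁ (- ((A p ∘ suc) ∙ y)) inv
        (solve 3 (λ a b d → a :* (:- (b :* d)) :+ d := :0 :+ (:- d) :* (a :* b :- :1)) refl
           (A p zero) a⁻¹ ((A p ∘ suc) ∙ y))
      solves-k : ∀ k → A (punchIn p k) ∙ x ≡ 0#
      solves-k k = trans
        (solve 4 (λ ak b d e → ak :* (:- (b :* d)) :+ e := e :+ (:- (ak :* b)) :* d) refl
           (A (punchIn p k) zero) a⁻¹ ((A p ∘ suc) ∙ y) ((A (punchIn p k) ∘ suc) ∙ y))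
        (trans (sym (trans (∙-⊕ˡ (A (punchIn p k) ∘ suc)
                                  (- (A (punchIn p k) zero * a⁻¹) ⊛ (A p ∘ suc)) y)
                           (cong ((A (punchIn p k) ∘ suc) ∙ y +_) (∙-⊛ˡ _ (A p ∘ suc) y))))
               (proj₂ (proj₂ rest) k))
      solves : ∀ i → A i ∙ x ≡ 0#
      solves i with p Finₚ.≟ i
      ... | yes refl = solves-p
      ... | no p≢i   = subst (λ i → A i ∙ x ≡ 0#) (Finₚ.punchIn-punchOut p≢i)
                         (solves-k (punchOut p≢i))

    -- The n coordinates give n equations for a relation between the n + 1 vectors `v` and `u j`.
    -- Independence forces the coefficient of `v` in it to be nonzero.
    spanning : ∀ {n} (u : Fin n → Vect n) → LinIndep u → ∀ v → InSpanOf u v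
    spanning {n} u indep v with homogeneous-solution n (λ i → v i ∷ (λ j → u j i))
    ... | (x , (j , xj≢0) , solves) = - z ⊛ (x ∘ suc) , mem
      where
      rows : ∀ i → v i * x zero + comb (x ∘ suc) u i ≡ 0#
      rows i = trans (cong (v i * x zero +_) (sumF-cong (λ j → *-comm (x (suc j)) (u j i)))) (solves i)
      x₀≢0 : x zero ≢ 0#
      x₀≢0 x₀≡0 = xj≢0 (all-zero j)
        where
        all-zero : ∀ j → x j ≡ 0#
        all-zero zero    = x₀≡0
        all-zero (suc j) = indep (x ∘ suc) (λ i → lincomb₂ 1# (- v i) (rows i) x₀≡0
          (solve 3 (λ v x c → c := :0 :+ :1 :* (v :* x :+ c :- :0) :+ (:- v) :* (x :- :0)) refl
             (v i) (x zero) (comb (x ∘ suc) u i))) j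
      z : K
      z = recip x₀≢0
      mem : ∀ i → v i ≡ comb (- z ⊛ (x ∘ suc)) u i
      mem i = begin
        v i                              ≡⟨ lincomb₂ z (- v i) (rows i) (*-recip x₀≢0)
          (solve 4 (λ v x z c → v := (:- z) :* c :+ z :* (v :* x :+ c :- :0) :+ (:- v) :* (x :* z :- :1))
             refl (v i) (x zero) z (comb (x ∘ suc) u i)) ⟩
        - z * comb (x ∘ suc) u i         ≡⟨ sym (sumF-* (- z) (λ j → x (suc j) * u j i)) ⟩
        sumF (λ j → - z * (x (suc j) * u j i)) ≡⟨ sumF-cong (λ j → sym (*-assoc (- z) (x (suc j)) (u j i))) ⟩
        comb (- z ⊛ (x ∘ suc)) u i ∎

  annihilator-trivial : ∀ {n} (u : Fin n → Vect n) → LinIndep u →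
                        ∀ h → (∀ j → h ∙ u j ≡ 0#) → ∀ i → h i ≡ 0#
  annihilator-trivial u indep h kills i =
    trans (sym (∙-δ i h)) (trans (∙-comm (δ i) h) (kills-span h kills (spanning u indep (δ i))))

  -- A relation between the rows of the matrix with columns `u j` is the same thing as a functional
  -- that kills every `u j`.
  transpose-indep : ∀ {n} (u : Fin n → Vect n) → LinIndep u → LinIndep (λ i j → u j i)
  transpose-indep u indep = annihilator-trivial u indep

  -- The hypothesis on functionals is, read as a matrix statement, the independence of the rows;
  -- transposing gives that of the columns.
  indep-of-annihilator : ∀ {m n} → m ≡ n → (u : Fin m → Vect n) →
    (∀ h → (∀ j → h ∙ u j ≡ 0#) → ∀ i → h i ≡ 0#) → LinIndep u
  indep-of-annihilator refl u trivial = transpose-indep (λ i j → u j i) trivial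

  -- The rows of the square matrix span, and the coefficients of `y` over the rows are the
  -- coordinates of the functional.
  dual-solution : ∀ {m n} → m ≡ n → (u : Fin m → Vect n) → LinIndep u →
                  (y : Vect m) → ∃ λ h → ∀ j → h ∙ u j ≡ y j
  dual-solution refl u indep y =
    let h , e = spanning (λ i j → u j i) (transpose-indep u indep) y
    in h , λ j → sym (e j)

  -- The coordinates of the `u j` over `g` form a square matrix with independent rows. Its rows
  -- span, so every unit vector is a combination of them, and this expresses `g k` over `u`.
  exchange : ∀ {m n} (u g : Fin m → Vect n) → LinIndep u → (∀ j → InSpanOf g (u j)) →
             ∀ k → InSpanOf u (g k)
  exchange {m} {n} u g indep mem k = proj₁ e_k , λ i → begin
      g k i                                  ≡⟨ sym (sumF-δ k (λ l → g l i)) ⟩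
      comb (δ k) g i                         ≡⟨ sumF-cong (λ l → cong (_* g l i) (proj₂ e_k l)) ⟩
      comb (comb (proj₁ e_k) a) g i          ≡⟨ sym (comb-comb (proj₁ e_k) a g i) ⟩
      comb (proj₁ e_k) (λ j → comb (a j) g) i ≡⟨ sumF-cong (λ j → cong (proj₁ e_k j *_) (sym (proj₂ (mem j) i))) ⟩
      comb (proj₁ e_k) u i                   ∎
    where
    a : Fin m → Vect m
    a j = proj₁ (mem j)
    a-indep : LinIndep a
    a-indep c c·a≡0 = indep c (λ i → begin
      comb c u i                    ≡⟨ sumF-cong (λ j → cong (c j *_) (proj₂ (mem j) i)) ⟩
      comb c (λ j → comb (a j) g) i ≡⟨ comb-comb c a g i ⟩
      comb (comb c a) g i           ≡⟨ sumF-zero (λ l → trans (cong (_* g l i) (c·a≡0 l)) (zeroˡ _)) ⟩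
      0#                            ∎)
    e_k : InSpanOf a (δ k)
    e_k = spanning a a-indep (δ k)

  kills-exchange : ∀ {m n} (u g : Fin m → Vect n) → LinIndep u → (∀ j → InSpanOf g (u j)) →
                   ∀ h → (∀ j → h ∙ u j ≡ 0#) → ∀ k → h ∙ g k ≡ 0#
  kills-exchange u g indep mem h kills k = kills-span h kills (exchange u g indep mem k)

  isZero? : ∀ {n} (v : Vect n) → Dec (IsZero v)
  isZero? v = Finₚ.all? (λ i → v i ≟ 0#)

  abstract
    nonzero-coordinate : ∀ {n} (v : Vect n) → ¬ IsZero v → ∃ λ i → v i ≢ 0#
    nonzero-coordinate v v≢0 with pivot v
    ... | inj₁ p = p
    ... | inj₂ z = ⊥-elim (v≢0 z)

    member-nonzero : ∀ {m n} (u : Fin m → Vect n) → LinIndep u → ∀ k → ¬ IsZero (u k)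
    member-nonzero u indep k z = 0≢1 (trans
      (sym (indep (δ k) (λ i → trans (sumF-δ k (λ j → u j i)) (z i)) k)) (δ-diagonal k))

    ∙-comb-∷ : ∀ {m n} (h : Vect n) (a : Vect (suc m)) f (u : Fin m → Vect n) → (∀ k → h ∙ u k ≡ 0#) →
               h ∙ comb a (f ∷ u) ≡ a zero * h ∙ f
    ∙-comb-∷ h a f u kills = trans (∙-combʳ h a (f ∷ u))
      (trans (cong (a zero * h ∙ f +_) (sumF-zero {f = λ k → a (suc k) * h ∙ u k}
                (λ k → trans (cong (a (suc k) *_) (kills k)) (zeroʳ (a (suc k))))))
             (+-identityʳ (a zero * h ∙ f)))

    comb-∷-tail : ∀ {m n} (a : Vect (suc m)) (f : Vect n) (u : Fin m → Vect n) → a zero ≡ 0# →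
                  ∀ {x} i → x ≡ comb a (f ∷ u) i → x ≡ comb (a ∘ suc) u i
    comb-∷-tail a f u a₀≡0 {x} i x≡ = lincomb₂ 1# (f i) x≡ a₀≡0
      (solve 4 (λ v a f x → v := x :+ :1 :* (v :- (a :* f :+ x)) :+ f :* (a :- :0)) refl
         x (a zero) (f i) (comb (a ∘ suc) u i))

    leading-coefficient : ∀ {m n} (h : Vect n) {f} {u : Fin m → Vect n} {v} → h ∙ f ≢ 0# → (∀ k → h ∙ u k ≡ 0#) →
      h ∙ v ≡ 0# → ∀ a → (∀ i → v i ≡ comb a (f ∷ u) i) → a zero ≡ 0#
    leading-coefficient h {f} {u} hf≢0 kills hv≡0 a v≡ = *≡0 hf≢0 (trans (*-comm (h ∙ f) (a zero))
      (trans (sym (∙-comb-∷ h a f u kills)) (trans (sym (∙-congʳ h v≡)) hv≡0)))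

    -- Applying `h` to a relation leaves only the term of `f`.
    indep-∷ : ∀ {m n} (h : Vect n) {f} {u : Fin m → Vect n} → h ∙ f ≢ 0# → (∀ k → h ∙ u k ≡ 0#) →
              LinIndep u → LinIndep (f ∷ u)
    indep-∷ h {f} {u} hf≢0 kills indep a rel =
        λ { zero → a₀≡0 ; (suc k) → indep (a ∘ suc) (λ i → sym (comb-∷-tail a f u a₀≡0 i (sym (rel i)))) k }
      where
      a₀≡0 : a zero ≡ 0#
      a₀≡0 = leading-coefficient h {f} {u} {λ _ → 0#} hf≢0 kills (sumF-zero (λ i → zeroʳ (h i))) a (λ i → sym (rel i))

    -- Serves to cut a join with a hyperplane: for `f` off `h`, the join of `f` with a subspace
    -- inside `h` meets `h` in that subspace only.
    span-∷-tail : ∀ {m n} (h : Vect n) {f} {u : Fin m → Vect n} {v} → h ∙ f ≢ 0# → (∀ k → h ∙ u k ≡ 0#) →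
                  h ∙ v ≡ 0# → InSpanOf (f ∷ u) v → InSpanOf u v
    span-∷-tail h {f} {u} {v} hf≢0 kills hv≡0 (a , v≡) = a ∘ suc ,
      λ i → comb-∷-tail a f u (leading-coefficient h {f} {u} {v} hf≢0 kills hv≡0 a v≡) i (v≡ i)

    InSpanOf-∷ : ∀ {m n} (f : Vect n) {u : Fin m → Vect n} {v} → InSpanOf u v → InSpanOf (f ∷ u) v
    InSpanOf-∷ f {u} (a , v≡) = 0# ∷ a , λ i → trans (v≡ i)
      (solve 2 (λ f x → x := :0 :* f :+ x) refl (f i) (comb a u i))

    ∷-kills : ∀ {m n} {h : Vect n} {f} {u : Fin m → Vect n} →
              h ∙ f ≡ 0# → (∀ j → h ∙ u j ≡ 0#) → ∀ j → h ∙ (f ∷ u) j ≡ 0#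
    ∷-kills z zs zero    = z
    ∷-kills z zs (suc j) = zs j

-- Binary forms as functions of two variables.

module BinaryForms (F : FiniteField) where
  open LinearAlgebra F public
  open ≡-Reasoning

  Fun : Set
  Fun = K → K → K

  infix 4 _≗₂_
  _≗₂_ : Fun → Fun → Set
  F ≗₂ G = ∀ s t → F s t ≡ G s t

  𝟎 : Fun
  𝟎 _ _ = 0#

  infixl 7 _⊗_
  infixl 6 _⊞_ _⊟_
  _⊗_ _⊞_ _⊟_ : Fun → Fun → Fun
  (F ⊗ G) s t = F s t * G s t
  (F ⊞ G) s t = F s t + G s t
  (F ⊟ G) s t = F s t + - G s t

  scale : K → Fun → Fun
  scale a F s t = a * F s t

  -- A homogeneous polynomial, given by its function and a scheme that peels off the power of s and
  -- continues with the cofactor of t. Products and substitutions can then be compared as functions,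
  -- without normalising coefficients.
  data Form : ℕ → Fun → Set where
    constant : ∀ {F} a → (∀ s t → F s t ≡ a) → Form zero F
    leading  : ∀ {n F} a G → Form n G → (∀ s t → F s t ≡ a * (s ^ suc n) + t * G s t) → Form (suc n) F

  -- The determinant of (s, t) and (x, y), that is, the linear form with root (x : y).
  lin : K → K → Fun
  lin x y s t = s * y + - (t * x)

  abstract
    Form-resp : ∀ {n F G} → F ≗₂ G → Form n F → Form n G
    Form-resp {zero}  eq (constant a e)         = constant a λ s t → trans (sym (eq s t)) (e s t)
    Form-resp {suc n} eq (leading a H h e) = leading a H h λ s t → trans (sym (eq s t)) (e s t)

    Form-⊞ : ∀ {n F G} → Form n F → Form n G → Form n (F ⊞ G)
    Form-⊞ {zero}  (constant a e) (constant b e′) = constant (a + b) λ s t → cong₂ _+_ (e s t) (e′ s t)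
    Form-⊞ {suc n} (leading a H h e) (leading b H′ h′ e′) = leading (a + b) (H ⊞ H′) (Form-⊞ h h′) λ s t →
      trans (cong₂ _+_ (e s t) (e′ s t))
        (solve 6 (λ a b p t h h′ → a :* p :+ t :* h :+ (b :* p :+ t :* h′)
                   := (a :+ b) :* p :+ t :* (h :+ h′)) refl a b (s ^ suc n) t (H s t) (H′ s t))

    Form-scale : ∀ {n F} c → Form n F → Form n (scale c F)
    Form-scale {zero}  c (constant a e) = constant (c * a) λ s t → cong (c *_) (e s t)
    Form-scale {suc n} c (leading a H h e) = leading (c * a) (scale c H) (Form-scale c h) λ s t →
      trans (cong (c *_) (e s t))
        (solve 5 (λ c a p t h → c :* (a :* p :+ t :* h) := c :* a :* p :+ t :* (c :* h)) refl
           c a (s ^ suc n) t (H s t))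

    Form-⊟ : ∀ {n F G} → Form n F → Form n G → Form n (F ⊟ G)
    Form-⊟ {G = G} f g = Form-resp
      (λ s t → cong (_ +_) (solve 1 (λ g → :- :1 :* g := :- g) refl (G s t)))
      (Form-⊞ f (Form-scale (- 1#) g))

    Form-s* : ∀ {n F} → Form n F → Form (suc n) (λ s t → s * F s t)
    Form-s* {zero} (constant a e) = leading a 𝟎 (constant 0# λ _ _ → refl) λ s t → trans (cong (s *_) (e s t))
      (solve 3 (λ a s t → s :* a := a :* (s :* :1) :+ t :* :0) refl a s t)
    Form-s* {suc n} (leading a H h e) = leading a _ (Form-s* h) λ s t → trans (cong (s *_) (e s t))
      (solve 5 (λ a s t p h → s :* (a :* p :+ t :* h) := a :* (s :* p) :+ t :* (s :* h)) refl
         a s t (s ^ suc n) (H s t))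

    Form-t* : ∀ {n F} → Form n F → Form (suc n) (λ s t → t * F s t)
    Form-t* {n} {F} f = leading 0# F f λ s t →
      solve 2 (λ p x → x := :0 :* p :+ x) refl (s ^ suc n) (t * F s t)

    Form-s^* : ∀ m {n F} → Form n F → Form (m ℕ.+ n) (λ s t → (s ^ m) * F s t)
    Form-s^* zero    f = Form-resp (λ s t → sym (*-identityˡ _)) f
    Form-s^* (suc m) f = Form-resp (λ s t → sym (*-assoc _ _ _)) (Form-s* (Form-s^* m f))

    Form-⊗ : ∀ {m n F G} → Form m F → Form n G → Form (m ℕ.+ n) (F ⊗ G)
    Form-⊗ {zero} (constant a e) g = Form-resp (λ s t → cong (_* _) (sym (e s t))) (Form-scale a g)
    Form-⊗ {suc m} {n} {F} {G} (leading a H h e) g = Form-resp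
      (λ s t → trans
        (solve 5 (λ a p t h g → a :* (p :* g) :+ t :* (h :* g) := (a :* p :+ t :* h) :* g) refl
           a (s ^ suc m) t (H s t) (G s t))
        (cong (_* G s t) (sym (e s t))))
      (Form-⊞ (Form-scale a (Form-s^* (suc m) g)) (Form-t* (Form-⊗ h g)))

    Form-lin : ∀ x y → Form 1 (lin x y)
    Form-lin x y = leading y (λ _ _ → - x) (constant (- x) λ _ _ → refl) λ s t →
      solve 4 (λ x y s t → s :* y :- t :* x := y :* (s :* :1) :+ t :* (:- x)) refl x y s t

    Form-pow-linear : ∀ n a b → Form n (λ s t → (a * s + b * t) ^ n)
    Form-pow-linear zero    a b = constant 1# λ _ _ → refl
    Form-pow-linear (suc n) a b = Form-⊗ {1}
      (leading a (λ _ _ → b) (constant b λ _ _ → refl) λ s t →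
        solve 4 (λ a b s t → a :* s :+ b :* t := a :* (s :* :1) :+ t :* b) refl a b s t)
      (Form-pow-linear n a b)

    Form-subst : ∀ {n F} a b c d → Form n F → Form n (λ s t → F (a * s + b * t) (c * s + d * t))
    Form-subst {zero}  a b c d (constant x e) = constant x λ s t → e _ _
    Form-subst {suc n} a b c d (leading x H h e) = Form-resp (λ s t → sym (e _ _))
      (Form-⊞ (Form-scale x (Form-pow-linear (suc n) a b))
              (Form-⊗ {1}
                 (leading c (λ _ _ → d) (constant d λ _ _ → refl) λ s t →
                    solve 4 (λ a b s t → a :* s :+ b :* t := a :* (s :* :1) :+ t :* b) refl c d s t)
                 (Form-subst a b c d h)))

    Form-homogeneous : ∀ {n F} → Form n F → ∀ c s t → F (c * s) (c * t) ≡ (c ^ n) * F s t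
    Form-homogeneous {zero}  (constant a e) c s t = trans (e _ _) (trans (sym (e s t)) (sym (*-identityˡ _)))
    Form-homogeneous {suc n} {F} (leading a H h e) c s t = begin
      F (c * s) (c * t)
        ≡⟨ e _ _ ⟩
      a * ((c * s) ^ suc n) + c * t * H (c * s) (c * t)
        ≡⟨ cong₂ (λ x y → a * x + c * t * y) (^-* (suc n)) (Form-homogeneous h c s t) ⟩
      a * ((c ^ suc n) * (s ^ suc n)) + c * t * ((c ^ n) * H s t)
        ≡⟨ solve 6 (λ a c cn sn t h → a :* ((c :* cn) :* sn) :+ c :* t :* (cn :* h)
                      := (c :* cn) :* (a :* sn :+ t :* h)) refl a c (c ^ n) (s ^ suc n) t (H s t) ⟩
      (c ^ suc n) * (a * (s ^ suc n) + t * H s t)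
        ≡⟨ cong ((c ^ suc n) *_) (sym (e s t)) ⟩
      (c ^ suc n) * F s t ∎
      where
      ^-* : ∀ k → (c * s) ^ k ≡ (c ^ k) * (s ^ k)
      ^-* zero    = sym (*-identityˡ 1#)
      ^-* (suc k) = trans (cong (c * s *_) (^-* k))
        (solve 4 (λ c s x y → c :* s :* (x :* y) := c :* x :* (s :* y)) refl c s (c ^ k) (s ^ k))

  ^≢0 : ∀ {a} n → a ≢ 0# → a ^ n ≢ 0#
  ^≢0 zero    a≢0 = λ eq → 0≢1 (sym eq)
  ^≢0 (suc n) a≢0 = *≢0 a≢0 (^≢0 n a≢0)

  evalForm : ∀ n → Vect (suc n) → Fun
  evalForm n f s t = sumF (λ j → ((s ^ (n ∸ toℕ j)) * (t ^ toℕ j)) * f j)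

  abstract
    evalForm-suc : ∀ n f s t →
      evalForm (suc n) f s t ≡ f zero * (s ^ suc n) + t * evalForm n (f ∘ suc) s t
    evalForm-suc n f s t = cong₂ _+_
      (solve 2 (λ p f → p :* :1 :* f := f :* p) refl (s ^ suc n) (f zero))
      (trans (sumF-cong (λ j → solve 4 (λ p t r f → p :* (t :* r) :* f := t :* (p :* r :* f)) refl
                (s ^ (n ∸ toℕ j)) t (t ^ toℕ j) (f (suc j))))
             (sumF-* t (λ j → ((s ^ (n ∸ toℕ j)) * (t ^ toℕ j)) * f (suc j))))

    Form-evalForm : ∀ n f → Form n (evalForm n f)
    Form-evalForm zero    f = constant (f zero) λ s t → solve 1 (λ f → :1 :* :1 :* f :+ :0 := f) refl (f zero)
    Form-evalForm (suc n) f =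
      leading (f zero) (evalForm n (f ∘ suc)) (Form-evalForm n (f ∘ suc)) (evalForm-suc n f)

    coefficients : ∀ {n F} → Form n F → ∃ λ f → F ≗₂ evalForm n f
    coefficients {zero} (constant a e) = (λ _ → a) , λ s t →
      trans (e s t) (solve 1 (λ f → f := :1 :* :1 :* f :+ :0) refl a)
    coefficients {suc n} {F} (leading a H h e) = g , λ s t →
      trans (e s t) (trans (cong (λ x → a * (s ^ suc n) + t * x) (proj₂ (coefficients h) s t))
                           (sym (evalForm-suc n g s t)))
      where
      g : Vect (suc (suc n))
      g zero    = a
      g (suc j) = proj₁ (coefficients h) j

  lin-self : ∀ x y → lin x y x y ≡ 0#
  lin-self x y = solve 2 (λ x y → x :* y :- y :* x := :0) refl x y

  private
    scalar : ∀ {x y s t} → x ≢ 0# → s * y + - (t * x) ≡ 0# → ∃ λ c → s ≡ c * x × t ≡ c * y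
    scalar {x} {y} {s} {t} x≢0 eq = s * recip x≢0 ,
      lincomb₁ (- s) (*-recip x≢0)
        (solve 3 (λ s x i → s := s :* i :* x :+ (:- s) :* (x :* i :- :1)) refl s x (recip x≢0)) ,
      lincomb₂ (- recip x≢0) (- t) eq (*-recip x≢0)
        (solve 5 (λ x y s t i → t := s :* i :* y :+ (:- i) :* (s :* y :- t :* x :- :0)
                                     :+ (:- t) :* (x :* i :- :1)) refl x y s t (recip x≢0))

  lin≡0⇒∼₂ : ∀ {x y s t} → ParamOK x y → ParamOK s t → lin x y s t ≡ 0# → (x , y) ∼₂ (s , t)
  lin≡0⇒∼₂ {x} {y} {s} {t} ok ok′ eq with x ≟ 0# | y ≟ 0#
  ... | yes x≡0 | yes y≡0 = ⊥-elim (ok (x≡0 , y≡0))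
  ... | no x≢0  | _       = nonzero (scalar x≢0 eq)
    where
    nonzero : (∃ λ c → s ≡ c * x × t ≡ c * y) → (x , y) ∼₂ (s , t)
    nonzero (c , s≡ , t≡) = c , (λ { refl → ok′ (trans s≡ (zeroˡ x) , trans t≡ (zeroˡ y)) }) , s≡ , t≡
  ... | yes _   | no y≢0  = nonzero (scalar y≢0 (lincomb₁ (- 1#) eq
      (solve 4 (λ x y s t → t :* x :- s :* y := :0 :+ (:- :1) :* (s :* y :- t :* x :- :0)) refl x y s t)))
    where
    nonzero : (∃ λ c → t ≡ c * y × s ≡ c * x) → (x , y) ∼₂ (s , t)
    nonzero (c , t≡ , s≡) = c , (λ { refl → ok′ (trans s≡ (zeroˡ x) , trans t≡ (zeroˡ y)) }) , s≡ , t≡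

  private
    -- Horner division by t - r s. The remainder is a multiple of a power of s, so it is visible at
    -- every point with s ≠ 0.
    divide : ∀ {n F} → Form (suc n) F → ∀ r → ∃ λ G → ∃ λ ρ → Form n G ×
             (∀ s t → F s t ≡ (t + - (r * s)) * G s t + ρ * (s ^ suc n))
    divide {zero} (leading a H (constant b e′) e) r =
      (λ _ _ → b) , a + r * b , constant b (λ _ _ → refl) , λ s t →
        trans (e s t) (trans (cong (λ h → a * (s * 1#) + t * h) (e′ s t))
          (solve 5 (λ a b r s t → a :* (s :* :1) :+ t :* b
                      := (t :- r :* s) :* b :+ (a :+ r :* b) :* (s :* :1)) refl a b r s t))
    divide {suc n} (leading a H h e) r with divide h r
    ... | (G , ρ , g , e′) =
      (λ s t → ρ * (s ^ suc n) + t * G s t) , a + r * ρ ,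
      leading ρ G g (λ _ _ → refl) , λ s t →
        trans (e s t) (trans (cong (λ h → a * (s ^ suc (suc n)) + t * h) (e′ s t))
          (solve 7 (λ a r ρ s p t g → a :* (s :* p) :+ t :* ((t :- r :* s) :* g :+ ρ :* p)
                      := (t :- r :* s) :* (ρ :* p :+ t :* g) :+ (a :+ r :* ρ) :* (s :* p)) refl
             a r ρ s (s ^ suc n) t (G s t)))

    -- The point (0 : 1) is a root of no t - r s and needs the factor s instead.
    divide-s : ∀ {n F} → Form (suc n) F → F 0# 1# ≡ 0# →
               ∃ λ G → Form n G × (∀ s t → F s t ≡ s * G s t)
    divide-s {zero} (leading a H (constant b e′) e) F01≡0 = (λ _ _ → a) , constant a (λ _ _ → refl) , λ s t →
      trans (e s t) (trans (cong (λ h → a * (s * 1#) + t * h) (e′ s t))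
        (lincomb₁ t b≡0
          (solve 4 (λ a b s t → a :* (s :* :1) :+ t :* b := s :* a :+ t :* (b :- :0)) refl a b s t)))
      where
      b≡0 : b ≡ 0#
      b≡0 = trans (solve 2 (λ a b → b := a :* (:0 :* :1) :+ :1 :* b) refl a b)
        (trans (cong (λ h → a * (0# * 1#) + 1# * h) (sym (e′ 0# 1#))) (trans (sym (e 0# 1#)) F01≡0))
    divide-s {suc n} (leading a H h e) F01≡0 with divide-s h H01≡0
      where
      H01≡0 : H 0# 1# ≡ 0#
      H01≡0 = trans (solve 3 (λ a p b → b := a :* (:0 :* p) :+ :1 :* b) refl a (0# ^ suc n) (H 0# 1#))
        (trans (sym (e 0# 1#)) F01≡0)
    ... | (G , g , e′) = (λ s t → a * (s ^ suc n) + t * G s t) , leading a G g (λ _ _ → refl) , λ s t →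
      trans (e s t) (trans (cong (λ h → a * (s ^ suc (suc n)) + t * h) (e′ s t))
        (solve 5 (λ a s p t g → a :* (s :* p) :+ t :* (s :* g) := s :* (a :* p :+ t :* g)) refl
           a s (s ^ suc n) t (G s t)))

  abstract
    factor : ∀ {n F x y} → Form (suc n) F → ParamOK x y → F x y ≡ 0# →
             ∃ λ G → Form n G × F ≗₂ lin x y ⊗ G
    factor {n} {F} {x} {y} f ok Fxy≡0 with x ≟ 0#
    -- With r = y / x the divisor t - r s is - 1 / x times `lin x y`, and the value at (x, y)
    -- reduces to the remainder.
    ... | no x≢0 = (λ s t → - x⁻¹ * G s t) , Form-scale (- x⁻¹) (proj₁ (proj₂ (proj₂ div))) , λ s t →
        lincomb₃ (s ^ suc n) (- (G s t) * t) 0# ρ≡0 inv refl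
          (trans (proj₂ (proj₂ (proj₂ div)) s t)
            (solve 8 (λ x y i s t g ρ p → (t :- i :* y :* s) :* g :+ ρ :* p
                := (s :* y :- t :* x) :* ((:- i) :* g) :+ p :* (ρ :- :0)
                   :+ (:- g) :* t :* (x :* i :- :1) :+ :0 :* (:0 :- :0)) refl
               x y x⁻¹ s t (G s t) ρ (s ^ suc n)))
      where
      x⁻¹ : K
      x⁻¹ = recip x≢0
      inv : x * x⁻¹ ≡ 1#
      inv = *-recip x≢0
      div : ∃ λ G → ∃ λ ρ → Form n G × (∀ s t → F s t ≡ (t + - (x⁻¹ * y * s)) * G s t + ρ * (s ^ suc n))
      div = divide f (x⁻¹ * y)
      G : Fun
      G = proj₁ div
      ρ : K
      ρ = proj₁ (proj₂ div)
      ρ≡0 : ρ ≡ 0#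
      ρ≡0 = *≡0 (^≢0 (suc n) x≢0) (trans (*-comm _ ρ) (lincomb₂ 1# (y * G x y) (trans (sym (proj₂ (proj₂ (proj₂ div)) x y)) Fxy≡0) inv
        (solve 6 (λ x y i g ρ p → ρ :* p := :0 :+ :1 :* ((y :- i :* y :* x) :* g :+ ρ :* p :- :0)
                    :+ (y :* g) :* (x :* i :- :1)) refl x y x⁻¹ (G x y) ρ (x ^ suc n))))
    ... | yes x≡0 with y ≟ 0#
    ...   | yes y≡0 = ⊥-elim (ok (x≡0 , y≡0))
    ...   | no y≢0 = (λ s t → y⁻¹ * G s t) , Form-scale y⁻¹ (proj₁ (proj₂ div)) , λ s t →
        lincomb₂ (- (s * G s t)) (t * (y⁻¹ * G s t)) inv x≡0
          (trans (proj₂ (proj₂ div) s t)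
            (solve 6 (λ x y i s t g → s :* g := (s :* y :- t :* x) :* (i :* g)
               :+ (:- (s :* g)) :* (y :* i :- :1) :+ (t :* (i :* g)) :* (x :- :0)) refl
               x y y⁻¹ s t (G s t)))
      where
      y⁻¹ : K
      y⁻¹ = recip y≢0
      inv : y * y⁻¹ ≡ 1#
      inv = *-recip y≢0
      F01≡0 : F 0# 1# ≡ 0#
      F01≡0 = *≡0 (^≢0 (suc n) y≢0) (begin
        (y ^ suc n) * F 0# 1#   ≡⟨ sym (Form-homogeneous f y 0# 1#) ⟩
        F (y * 0#) (y * 1#)     ≡⟨ cong₂ F (trans (zeroʳ y) (sym x≡0)) (*-identityʳ y) ⟩
        F x y                   ≡⟨ Fxy≡0 ⟩
        0#                      ∎)
      div : ∃ λ G → Form n G × (∀ s t → F s t ≡ s * G s t)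
      div = divide-s f F01≡0
      G : Fun
      G = proj₁ div

    lin-1-≢0 : ∀ {x y} → x ≢ y → lin 1# x 1# y ≢ 0#
    lin-1-≢0 {x} {y} x≢y eq = x≢y (lincomb₁ 1# eq
      (solve 2 (λ x y → x := y :+ :1 :* (:1 :* x :- y :* :1 :- :0)) refl x y))

    1-paramOK : ∀ {x} → ParamOK 1# x
    1-paramOK (1≡0 , _) = 0≢1 (sym 1≡0)

    -- Each root splits off a linear factor that does not vanish at the remaining `xs k`.
    many-roots : ∀ {n F} → Form n F → (xs : Fin (suc n) → K) → (∀ j k → xs j ≡ xs k → j ≡ k) →
                 (∀ k → F 1# (xs k) ≡ 0#) → F ≗₂ 𝟎
    many-roots {zero}  (constant a e) xs _ roots s t = trans (e s t) (trans (sym (e 1# (xs zero))) (roots zero))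
    many-roots {suc n} {F} f xs inj roots s t =
      trans (e s t) (trans (cong (lin 1# (xs zero) s t *_) (G≡0 s t)) (zeroʳ _))
      where
      fac : ∃ λ G → Form n G × F ≗₂ lin 1# (xs zero) ⊗ G
      fac = factor f 1-paramOK (roots zero)
      e : F ≗₂ lin 1# (xs zero) ⊗ proj₁ fac
      e = proj₂ (proj₂ fac)
      G≡0 : proj₁ fac ≗₂ 𝟎
      G≡0 = many-roots (proj₁ (proj₂ fac)) (xs ∘ suc) (λ j k eq → Finₚ.suc-injective (inj _ _ eq))
        (λ k → *≡0 (lin-1-≢0 (λ eq → Finₚ.0≢1+n (inj _ _ eq)))
                   (trans (sym (e 1# (xs (suc k)))) (roots (suc k))))

    avoiding : ∀ m → suc m ≤ q → (x : K) →
               ∃ λ (xs : Fin m → K) → (∀ j k → xs j ≡ xs k → j ≡ k) × (∀ k → xs k ≢ x)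
    avoiding m m<q x = (λ k → element (proj₁ ks k)) ,
        (λ j k eq → proj₁ (proj₂ ks) j k (element-injective _ _ eq)) ,
        (λ k eq → proj₂ (proj₂ ks) k (element-injective _ _ (trans eq (sym (element-index x)))))
      where
      indices : ∀ {n} → suc m ≤ n → (i : Fin n) →
                ∃ λ (ks : Fin m → Fin n) → (∀ j k → ks j ≡ ks k → j ≡ k) × (∀ k → ks k ≢ i)
      indices {suc n} m<n i = (λ k → punchIn i (inject≤ k (ℕₚ.≤-pred m<n))) ,
        (λ j k eq → Finₚ.inject≤-injective _ _ j k (Finₚ.punchIn-injective i _ _ eq)) ,
        (λ k → Finₚ.punchInᵢ≢i i _)
      ks : ∃ λ (ks : Fin m → Fin q) → (∀ j k → ks j ≡ ks k → j ≡ k) × (∀ k → ks k ≢ index x)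
      ks = indices m<q (index x)

    lin-nonroots : ∀ {m x y} → suc m ≤ q → ParamOK x y →
      ∃ λ (xs : Fin m → K) → (∀ j k → xs j ≡ xs k → j ≡ k) × (∀ k → lin x y 1# (xs k) ≢ 0#)
    lin-nonroots {m} {x} {y} m<q ok =
      let z₀ , nonroot = exceptional
          xs , injective , avoids = avoiding m m<q z₀
      in xs , injective , λ k → nonroot (xs k) (avoids k)
      where
      exceptional : ∃ λ z₀ → ∀ z → z ≢ z₀ → lin x y 1# z ≢ 0#
      exceptional with x ≟ 0#
      -- The only root is (0 : 1), so no point (1, z) has to be excluded and `0#` is an arbitrary
      -- value.
      ... | yes x≡0 = 0# , λ z _ eq → ok (x≡0 , lincomb₂ 1# z eq x≡0
        (solve 3 (λ x y z → y := :0 :+ :1 :* (:1 :* y :- z :* x :- :0) :+ z :* (x :- :0)) refl x y z))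
      ... | no x≢0 = x⁻¹ * y , λ z z≢ eq → z≢ (lincomb₂ (- x⁻¹) (- z) eq (*-recip x≢0)
        (solve 4 (λ x y z i → z := i :* y :+ (:- i) :* (:1 :* y :- z :* x :- :0)
                                :+ (:- z) :* (x :* i :- :1)) refl x y z x⁻¹))
        where
        x⁻¹ : K
        x⁻¹ = recip x≢0

    -- A form of degree n is tested at n + 1 points (1, z) that avoid the root of the linear factor.
    -- Since one of the q values z may be that root, the bound is n + 2 ≤ q.
    cancel-lin : ∀ {n G x y} → suc (suc n) ≤ q → Form n G → ParamOK x y →
                 lin x y ⊗ G ≗₂ 𝟎 → G ≗₂ 𝟎
    cancel-lin n<q g ok eq =
      let xs , injective , nonroot = lin-nonroots n<q ok
      in many-roots g xs injective (λ k → *≡0 (nonroot k) (eq 1# (xs k)))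

    cancel-lin-eq : ∀ {n F G x y} → suc (suc n) ≤ q → Form n F → Form n G → ParamOK x y →
                    lin x y ⊗ F ≗₂ lin x y ⊗ G → F ≗₂ G
    cancel-lin-eq {F = F} {G} {x} {y} n<q f g ok eq s t = a-b≡0⇒a≡b
      (cancel-lin n<q (Form-⊟ f g) ok
        (λ s t → lincomb₁ 1# (eq s t)
          (solve 3 (λ l f g → l :* (f :- g) := :0 :+ :1 :* (l :* f :- l :* g)) refl
             (lin x y s t) (F s t) (G s t))) s t)

    vanishing : ∀ {n F} → suc n ≤ q → Form n F → (∀ x → F 1# x ≡ 0#) → F ≗₂ 𝟎
    vanishing n<q f zeros = many-roots f (λ k → element (inject≤ k n<q))
      (λ j k eq → Finₚ.inject≤-injective n<q n<q j k (element-injective _ _ eq))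
      (λ k → zeros _)

    nonroot? : ∀ {n F} → suc n ≤ q → Form n F → F ≗₂ 𝟎 ⊎ (∃ λ x → F 1# x ≢ 0#)
    nonroot? {F = F} n<q f with pivot (F 1# ∘ element)
    ... | inj₁ (k , Fk≢0) = inj₂ (element k , Fk≢0)
    ... | inj₂ zeros = inj₁ (vanishing n<q f (λ x →
            trans (cong (F 1#) (sym (element-index x))) (zeros (index x))))

    1^ : ∀ n → 1# ^ n ≡ 1#
    1^ zero    = refl
    1^ (suc n) = trans (*-identityˡ _) (1^ n)

    leading-zero : ∀ n {a x} → a * (1# ^ suc n) + 0# * x ≡ 0# → a ≡ 0#
    leading-zero n {a} {x} eq = lincomb₂ 1# (- a) eq (1^ (suc n))
      (solve 3 (λ a p x → a := :0 :+ :1 :* (a :* p :+ :0 :* x :- :0) :+ (:- a) :* (p :- :1)) refl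
         a (1# ^ suc n) x)

    -- The form t is `lin (- 1#) 0#`; through this point t can be cancelled like any other linear
    -- factor.
    -1-paramOK : ParamOK (- 1#) 0#
    -1-paramOK (eq , _) = -a≢0 (λ 1≡0 → 0≢1 (sym 1≡0)) eq

    split-t : ∀ {m n F G} → suc (suc (m ℕ.+ n)) ≤ q → Form (suc m) F → Form n G → F 1# 0# ≡ 0# →
      F ⊗ G ≗₂ 𝟎 → ∃ λ F′ → Form m F′ × (∀ s t → F s t ≡ t * F′ s t) × F′ ⊗ G ≗₂ 𝟎
    split-t {m} {n} {F} {G} m+n<q (leading a F′ f′ F≡) g F10≡0 eq =
      F′ , f′ , F≡tF′ , cancel-lin m+n<q (Form-⊗ f′ g) -1-paramOK (λ s t → trans
        (trans (solve 4 (λ s t f g → (s :* :0 :- t :* (:- :1)) :* (f :* g) := t :* f :* g) refl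
                  s t (F′ s t) (G s t))
               (cong (_* G s t) (sym (F≡tF′ s t)))) (eq s t))
      where
      a≡0 : a ≡ 0#
      a≡0 = leading-zero m (trans (sym (F≡ 1# 0#)) F10≡0)
      F≡tF′ : ∀ s t → F s t ≡ t * F′ s t
      F≡tF′ s t = lincomb₂ 1# (s ^ suc m) (F≡ s t) a≡0
        (solve 4 (λ f a p h → f := h :+ :1 :* (f :- (a :* p :+ h)) :+ p :* (a :- :0)) refl
           (F s t) a (s ^ suc m) (t * F′ s t))

    -- At (1, 0) one of the two forms vanishes and so is divisible by t. Cancelling t lowers its
    -- degree until one form is constant.
    domain : ∀ {m n F G} → suc (m ℕ.+ n) ≤ q → Form m F → Form n G → F ⊗ G ≗₂ 𝟎 → F ≗₂ 𝟎 ⊎ G ≗₂ 𝟎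
    domain {zero} {F = F} {G} m+n<q (constant a e) g eq with a ≟ 0#
    ... | yes a≡0 = inj₁ (λ s t → trans (e s t) a≡0)
    ... | no  a≢0 = inj₂ (λ s t → *≡0 (λ Fst≡0 → a≢0 (trans (sym (e s t)) Fst≡0)) (eq s t))
    domain {suc m} {zero} {F} {G} m+n<q f (constant b e) eq with b ≟ 0#
    ... | yes b≡0 = inj₂ (λ s t → trans (e s t) b≡0)
    ... | no  b≢0 = inj₁ (λ s t → *≡0 (λ Gst≡0 → b≢0 (trans (sym (e s t)) Gst≡0))
                                     (trans (*-comm _ _) (eq s t)))
    domain {suc m} {suc n} {F} {G} m+n<q f g eq with *≡0⇒⊎ (F 1# 0#) (G 1# 0#) (eq 1# 0#)
    ... | inj₁ F10≡0 = reduce (split-t m+n<q f g F10≡0 eq)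
      where
      reduce : (∃ λ F′ → Form m F′ × (∀ s t → F s t ≡ t * F′ s t) × F′ ⊗ G ≗₂ 𝟎) → F ≗₂ 𝟎 ⊎ G ≗₂ 𝟎
      reduce (F′ , f′ , F≡ , eq′) =
        [ (λ F′≡0 → inj₁ (λ s t → trans (F≡ s t) (trans (cong (t *_) (F′≡0 s t)) (zeroʳ t)))) , inj₂ ]′
          (domain (ℕₚ.≤-trans (ℕₚ.n≤1+n _) m+n<q) f′ g eq′)
    ... | inj₂ G10≡0 = reduce (split-t (subst (λ k → suc k ≤ q) (ℕₚ.+-comm (suc m) (suc n)) m+n<q) g f G10≡0
                                 (λ s t → trans (*-comm (G s t) (F s t)) (eq s t)))
      where
      reduce : (∃ λ G′ → Form n G′ × (∀ s t → G s t ≡ t * G′ s t) × G′ ⊗ F ≗₂ 𝟎) → F ≗₂ 𝟎 ⊎ G ≗₂ 𝟎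
      reduce (G′ , g′ , G≡ , eq′) =
        [ inj₁ , (λ G′≡0 → inj₂ (λ s t → trans (G≡ s t) (trans (cong (t *_) (G′≡0 s t)) (zeroʳ t)))) ]′
          (domain (ℕₚ.≤-trans (ℕₚ.n≤1+n _) (subst (λ k → suc k ≤ q) (ℕₚ.+-suc (suc m) n) m+n<q)) f g′
            (λ s t → trans (*-comm (F s t) (G′ s t)) (eq′ s t)))

    linear-form : ∀ {F} → Form 1 F → F ≗₂ 𝟎 ⊎ (∃₂ λ x y → ParamOK x y × F ≗₂ lin x y)
    linear-form {F} (leading a H (constant b e′) e) with a ≟ 0# | b ≟ 0#
    ... | yes refl | yes refl = inj₁ (λ s t → trans (e s t) (trans (cong (λ h → 0# * (s * 1#) + t * h) (e′ s t))
            (solve 2 (λ s t → :0 :* (s :* :1) :+ t :* :0 := :0) refl s t)))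
    ... | no a≢0 | _ = inj₂ (- b , a , (λ ok → a≢0 (proj₂ ok)) , λ s t →
            trans (e s t) (trans (cong (λ h → a * (s * 1#) + t * h) (e′ s t))
              (solve 4 (λ a b s t → a :* (s :* :1) :+ t :* b := s :* a :- t :* (:- b)) refl a b s t)))
    ... | yes _ | no b≢0 = inj₂ (- b , a , (λ ok → -a≢0 b≢0 (proj₁ ok)) , λ s t →
            trans (e s t) (trans (cong (λ h → a * (s * 1#) + t * h) (e′ s t))
              (solve 4 (λ a b s t → a :* (s :* :1) :+ t :* b := s :* a :- t :* (:- b)) refl a b s t)))

    linear-form-ext : ∀ {F G} → Form 1 F → Form 1 G →
                      F 1# 0# ≡ G 1# 0# → F 0# 1# ≡ G 0# 1# → F ≗₂ G
    linear-form-ext {F} {G} f g eq eq′ s t = trans (expand f s t)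
      (trans (cong₂ (λ x y → s * x + t * y) eq eq′) (sym (expand g s t)))
      where
      expand : ∀ {F} → Form 1 F → ∀ s t → F s t ≡ s * F 1# 0# + t * F 0# 1#
      expand {F} (leading a H (constant b e′) e) s t = trans (e s t) (trans (cong (λ h → a * (s * 1#) + t * h) (e′ s t))
        (trans (solve 4 (λ a b s t → a :* (s :* :1) :+ t :* b
                   := s :* (a :* (:1 :* :1) :+ :0 :* b) :+ t :* (a :* (:0 :* :1) :+ :1 :* b)) refl a b s t)
          (sym (cong₂ (λ x y → s * x + t * y)
            (trans (e 1# 0#) (cong (λ h → a * (1# * 1#) + 0# * h) (e′ 1# 0#)))
            (trans (e 0# 1#) (cong (λ h → a * (0# * 1#) + 1# * h) (e′ 0# 1#)))))))

-- Coprime forms of degrees 2 and 3, and test forms.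

module SmallForms (F : FiniteField) (6≤q : 6 ≤ FiniteField.q F) where
  open BinaryForms F public
  open ≡-Reasoning

  below : ∀ {n} → n ≤ 6 → n ≤ q
  below n≤6 = ℕₚ.≤-trans n≤6 6≤q

  3≤q : 3 ≤ q
  3≤q = below (s≤s (s≤s (s≤s z≤n)))
  4≤q : 4 ≤ q
  4≤q = below (s≤s (s≤s (s≤s (s≤s z≤n))))
  5≤q : 5 ≤ q
  5≤q = below (s≤s (s≤s (s≤s (s≤s (s≤s z≤n)))))

  NoCommonRoot : Fun → Fun → Set
  NoCommonRoot F G = ∀ s t → ParamOK s t → ¬ (F s t ≡ 0# × G s t ≡ 0#)

  LinearlyDivides : Fun → Fun → Set
  LinearlyDivides Q R = ∃ λ l → Form 1 l × R ≗₂ l ⊗ Q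

  abstract
    -- Subtracting a multiple of Q we may assume that Q′ has a root at which Q
    -- does not vanish; the linear cofactor of that root is then what Q and R
    -- would have to share.
    coprime⇒proportional : ∀ {Q R Q′ R′} → Form 2 Q → Form 3 R → Form 2 Q′ → Form 3 R′ →
      ∀ x → Q 1# x ≢ 0# → NoCommonRoot Q R → ¬ LinearlyDivides Q R →
      Q ⊗ R′ ≗₂ Q′ ⊗ R → ∃ λ κ → Q′ ≗₂ scale κ Q × R′ ≗₂ scale κ R
    coprime⇒proportional {Q} {R} {Q′} {R′} fQ fR fQ′ fR′ x Qx≢0 no-common ¬divides eq =
      κ , (λ s t → a-b≡0⇒a≡b (trans (Q″≡ s t) (trans (cong (lin 1# x s t *_) (m≡0 s t)) (zeroʳ _)))) ,
          (λ s t → a-b≡0⇒a≡b (trans (R″≡ s t) (trans (cong (lin 1# x s t *_) (S≡0 s t)) (zeroʳ _))))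
      where
      i : K
      i = recip Qx≢0
      κ : K
      κ = Q′ 1# x * i
      Q″ R″ : Fun
      Q″ = Q′ ⊟ scale κ Q
      R″ = R′ ⊟ scale κ R
      fQ″ : Form 2 Q″
      fQ″ = Form-⊟ fQ′ (Form-scale κ fQ)
      fR″ : Form 3 R″
      fR″ = Form-⊟ fR′ (Form-scale κ fR)
      eq″ : Q ⊗ R″ ≗₂ Q″ ⊗ R
      eq″ s t = lincomb₁ 1# (eq s t)
        (solve 5 (λ a b c d k → a :* (b :- k :* d) := (c :- k :* a) :* d :+ :1 :* (a :* b :- c :* d))
           refl (Q s t) (R′ s t) (Q′ s t) (R s t) κ)
      Q″x≡0 : Q″ 1# x ≡ 0#
      Q″x≡0 = lincomb₁ (- Q′ 1# x) (*-recip Qx≢0)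
        (solve 3 (λ a b i → b :- b :* i :* a := :0 :+ (:- b) :* (a :* i :- :1)) refl
           (Q 1# x) (Q′ 1# x) i)
      R″x≡0 : R″ 1# x ≡ 0#
      R″x≡0 = *≡0 Qx≢0 (trans (eq″ 1# x) (trans (cong (_* R 1# x) Q″x≡0) (zeroˡ _)))
      Q″-factor : ∃ λ G → Form 1 G × Q″ ≗₂ lin 1# x ⊗ G
      Q″-factor = factor fQ″ 1-paramOK Q″x≡0
      R″-factor : ∃ λ G → Form 2 G × R″ ≗₂ lin 1# x ⊗ G
      R″-factor = factor fR″ 1-paramOK R″x≡0
      m S : Fun
      m = proj₁ Q″-factor
      S = proj₁ R″-factor
      fm : Form 1 m
      fm = proj₁ (proj₂ Q″-factor)
      fS : Form 2 S
      fS = proj₁ (proj₂ R″-factor)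
      Q″≡ : Q″ ≗₂ lin 1# x ⊗ m
      Q″≡ = proj₂ (proj₂ Q″-factor)
      R″≡ : R″ ≗₂ lin 1# x ⊗ S
      R″≡ = proj₂ (proj₂ R″-factor)
      QS≡mR : Q ⊗ S ≗₂ m ⊗ R
      QS≡mR = cancel-lin-eq 6≤q (Form-⊗ fQ fS) (Form-⊗ fm fR) 1-paramOK (λ s t → begin
        lin 1# x s t * (Q s t * S s t)
          ≡⟨ solve 3 (λ l a b → l :* (a :* b) := a :* (l :* b)) refl (lin 1# x s t) (Q s t) (S s t) ⟩
        Q s t * (lin 1# x s t * S s t) ≡⟨ cong (Q s t *_) (sym (R″≡ s t)) ⟩
        Q s t * R″ s t                 ≡⟨ eq″ s t ⟩
        Q″ s t * R s t                 ≡⟨ cong (_* R s t) (Q″≡ s t) ⟩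
        lin 1# x s t * m s t * R s t   ≡⟨ *-assoc _ _ _ ⟩
        lin 1# x s t * (m s t * R s t) ∎)
      nonzero-impossible : ∀ a b → ParamOK a b → m ≗₂ lin a b → ⊥
      nonzero-impossible a b ok m≡ = case (Q a b ≟ 0#)
        where
        QS≡ : ∀ s t → Q s t * S s t ≡ lin a b s t * R s t
        QS≡ s t = trans (QS≡mR s t) (cong (_* R s t) (m≡ s t))
        QSab≡0 : Q a b * S a b ≡ 0#
        QSab≡0 = trans (QS≡ a b) (trans (cong (_* R a b) (lin-self a b)) (zeroˡ _))
        case : Dec (Q a b ≡ 0#) → ⊥
        -- The root (a : b) is then a root of `S`. Cancelling `lin a b` from Q · S = `lin a b` · R
        -- makes R a multiple of Q.
        case (no Qab≢0) = ¬divides (n , fn , λ s t →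
            cancel-lin-eq 5≤q fR (Form-⊗ fn fQ) ok (λ s t → begin
              lin a b s t * R s t             ≡⟨ sym (QS≡ s t) ⟩
              Q s t * S s t                   ≡⟨ cong (Q s t *_) (proj₂ (proj₂ S-factor) s t) ⟩
              Q s t * (lin a b s t * n s t)   ≡⟨ solve 3 (λ q l n → q :* (l :* n) := l :* (n :* q)) refl
                                                  (Q s t) (lin a b s t) (n s t) ⟩
              lin a b s t * (n s t * Q s t)   ∎) s t)
          where
          S-factor : ∃ λ G → Form 1 G × S ≗₂ lin a b ⊗ G
          S-factor = factor fS ok (*≡0 Qab≢0 QSab≡0)
          n : Fun
          n = proj₁ S-factor
          fn : Form 1 n
          fn = proj₁ (proj₂ S-factor)
        -- Here Q = `lin a b` · `m₂` and R = `m₂` · S. Either `m₂` is zero, and with it Q, or its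
        -- root is common to Q and R.
        case (yes Qab≡0) = [ (λ m₂≡0 → Qx≢0 (trans (Q≡ 1# x) (trans (cong (lin a b 1# x *_) (m₂≡0 1# x)) (zeroʳ _))))
                           , (λ { (c , d , okcd , m₂≡) → no-common c d okcd
                                (trans (Q≡ c d) (trans (cong (lin a b c d *_) (trans (m₂≡ c d) (lin-self c d))) (zeroʳ _)) ,
                                 trans (R≡ c d) (trans (cong (_* S c d) (trans (m₂≡ c d) (lin-self c d))) (zeroˡ _))) })
                           ]′ (linear-form fm₂)
          where
          Q-factor : ∃ λ G → Form 1 G × Q ≗₂ lin a b ⊗ G
          Q-factor = factor fQ ok Qab≡0
          m₂ : Fun
          m₂ = proj₁ Q-factor
          fm₂ : Form 1 m₂
          fm₂ = proj₁ (proj₂ Q-factor)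
          Q≡ : Q ≗₂ lin a b ⊗ m₂
          Q≡ = proj₂ (proj₂ Q-factor)
          R≡ : R ≗₂ m₂ ⊗ S
          R≡ = cancel-lin-eq 5≤q fR (Form-⊗ fm₂ fS) ok (λ s t → begin
            lin a b s t * R s t            ≡⟨ sym (QS≡ s t) ⟩
            Q s t * S s t                  ≡⟨ cong (_* S s t) (Q≡ s t) ⟩
            lin a b s t * m₂ s t * S s t   ≡⟨ *-assoc _ _ _ ⟩
            lin a b s t * (m₂ s t * S s t) ∎)
      m≡0 : m ≗₂ 𝟎
      m≡0 = [ (λ z → z) , (λ { (a , b , ok , m≡) → ⊥-elim (nonzero-impossible a b ok m≡) }) ]′
              (linear-form fm)
      S≡0 : S ≗₂ 𝟎
      S≡0 = [ (λ Q≡0 → ⊥-elim (Qx≢0 (Q≡0 1# x))) , (λ z → z) ]′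
        (domain 5≤q fQ fS (λ s t → trans (QS≡mR s t) (trans (cong (_* R s t) (m≡0 s t)) (zeroˡ _))))

    -- The value at (1, 0) isolates the first coefficient; the rest is divisible by t, which is
    -- cancelled. This is the return from functions to coefficients.
    evalForm-zero : ∀ n → suc n ≤ q → ∀ f → evalForm n f ≗₂ 𝟎 → ∀ j → f j ≡ 0#
    evalForm-zero zero n<q f eq zero =
      trans (solve 1 (λ f → f := :1 :* :1 :* f :+ :0) refl (f zero)) (eq 1# 0#)
    evalForm-zero (suc n) n<q f eq = λ { zero → f₀≡0 ; (suc j) →
        evalForm-zero n (ℕₚ.≤-trans (ℕₚ.n≤1+n _) n<q) (f ∘ suc)
          (cancel-lin n<q (Form-evalForm n (f ∘ suc)) -1-paramOK tail≡0) j }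
      where
      E : Fun
      E = evalForm n (f ∘ suc)
      f₀≡0 : f zero ≡ 0#
      f₀≡0 = leading-zero n (trans (sym (evalForm-suc n f 1# 0#)) (eq 1# 0#))
      tail≡0 : lin (- 1#) 0# ⊗ E ≗₂ 𝟎
      tail≡0 s t = lincomb₂ 1# (- (s ^ suc n)) (trans (sym (evalForm-suc n f s t)) (eq s t)) f₀≡0
        (solve 5 (λ s t e a p → (s :* :0 :- t :* (:- :1)) :* e
            := :0 :+ :1 :* (a :* p :+ t :* e :- :0) :+ (:- p) :* (a :- :0)) refl
           s t (E s t) (f zero) (s ^ suc n))

    -- One of s^n and t^n serves. As a factor it raises a test form to a required degree without
    -- losing its value at (x, y).
    nonvanishing-form : ∀ n {x y} → ParamOK x y → ∃ λ F → Form n F × F x y ≢ 0#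
    nonvanishing-form n {x} {y} ok with x ≟ 0#
    ... | no x≢0 = _ , Form-pow-linear n 1# 0# ,
          λ eq → ^≢0 n x≢0 (trans (cong (_^ n) (solve 2 (λ x y → x := :1 :* x :+ :0 :* y) refl x y)) eq)
    ... | yes x≡0 = _ , Form-pow-linear n 0# 1# ,
          λ eq → ^≢0 n (λ y≡0 → ok (x≡0 , y≡0))
                   (trans (cong (_^ n) (solve 2 (λ x y → y := :0 :* x :+ :1 :* y) refl x y)) eq)

-- Hyperplanes as pairs of binary forms.

module Surface (F : FiniteField) (6≤q : 6 ≤ FiniteField.q F)
               (p : Fin 3 → Fin 7 → FiniteField.K F) (r : Fin 4 → Fin 7 → FiniteField.K F)
               (φ : Geometry.Projectivity F)
               (indep : Geometry.Independent F (p ++ r)) where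
  open SmallForms F 6≤q public
  open Quintic p r φ public
  open Projectivity φ
  open ≡-Reasoning

  abstract
    C N : K → K → V7
    C s t = nrcPt 2 p s t
    N s t = nrcPt 3 r (φs s t) (φt s t)

    C≡nrcPt : ∀ s t → C s t ≡ nrcPt 2 p s t
    C≡nrcPt s t = refl

  Q R : V7 → Fun
  Q h s t = h ∙ C s t
  R h s t = h ∙ N s t

  IsZeroFunctional : V7 → Set
  IsZeroFunctional h = ∀ i → h i ≡ 0#

  abstract
    ∙-nrcPt : ∀ n (u : Fin (suc n) → V7) h s t → h ∙ nrcPt n u s t ≡ evalForm n (λ j → h ∙ u j) s t
    ∙-nrcPt n u h s t = ∙-combʳ h (λ j → (s ^ (n ∸ toℕ j)) * (t ^ toℕ j)) u

    Form-∙-nrcPt : ∀ n (u : Fin (suc n) → V7) h → Form n (λ s t → h ∙ nrcPt n u s t)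
    Form-∙-nrcPt n u h = Form-resp (λ s t → sym (∙-nrcPt n u h s t)) (Form-evalForm n (λ j → h ∙ u j))

    Form-C : ∀ i → Form 2 (λ s t → C s t i)
    Form-C i = Form-evalForm 2 (λ j → p j i)

    Form-N : ∀ i → Form 3 (λ s t → N s t i)
    Form-N i = Form-subst a b c d (Form-evalForm 3 (λ j → r j i))

    Form-Q : ∀ h → Form 2 (Q h)
    Form-Q h = Form-∙-nrcPt 2 p h

    Form-R : ∀ h → Form 3 (R h)
    Form-R h = Form-subst a b c d (Form-∙-nrcPt 3 r h)

    private
      D : K
      D = recip det≢0
      D-inv : (a * d + - (b * c)) * D ≡ 1#
      D-inv = *-recip det≢0

      -- The inverse of φ: the adjugate matrix divided by the determinant, so that it inverts φ
      -- exactly and not only up to a scalar.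
      ψs ψt : Fun
      ψs s t = D * d * s + - (D * b) * t
      ψt s t = - (D * c) * s + D * a * t

      ψφs : ∀ s t → ψs (φs s t) (φt s t) ≡ s
      ψφs s t = lincomb₁ s D-inv
        (solve 7 (λ a b c d D s t → D :* d :* (a :* s :+ b :* t) :+ (:- (D :* b)) :* (c :* s :+ d :* t)
            := s :+ s :* ((a :* d :- b :* c) :* D :- :1)) refl a b c d D s t)
      ψφt : ∀ s t → ψt (φs s t) (φt s t) ≡ t
      ψφt s t = lincomb₁ t D-inv
        (solve 7 (λ a b c d D s t → (:- (D :* c)) :* (a :* s :+ b :* t) :+ D :* a :* (c :* s :+ d :* t)
            := t :+ t :* ((a :* d :- b :* c) :* D :- :1)) refl a b c d D s t)
      φψs : ∀ s t → φs (ψs s t) (ψt s t) ≡ s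
      φψs s t = lincomb₁ s D-inv
        (solve 7 (λ a b c d D s t → a :* (D :* d :* s :+ (:- (D :* b)) :* t) :+ b :* ((:- (D :* c)) :* s :+ D :* a :* t)
            := s :+ s :* ((a :* d :- b :* c) :* D :- :1)) refl a b c d D s t)
      φψt : ∀ s t → φt (ψs s t) (ψt s t) ≡ t
      φψt s t = lincomb₁ t D-inv
        (solve 7 (λ a b c d D s t → c :* (D :* d :* s :+ (:- (D :* b)) :* t) :+ d :* ((:- (D :* c)) :* s :+ D :* a :* t)
            := t :+ t :* ((a :* d :- b :* c) :* D :- :1)) refl a b c d D s t)

    -- The vectors `p ++ r` are a basis, so the coefficients of both forms can be prescribed as
    -- values on it. `N` runs through φ, hence the cubic form is first transported by the inverse ψ.
    functional-with : ∀ {A B} → Form 2 A → Form 3 B → ∃ λ h → Q h ≗₂ A × R h ≗₂ B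
    functional-with {A} {B} fA fB = h ,
      (λ s t → trans (∙-nrcPt 2 p h s t) (trans
         (sumF-cong (λ j → cong (((s ^ (2 ∸ toℕ j)) * (t ^ toℕ j)) *_)
           (trans (cong (h ∙_) (sym (lookup-++ˡ p r j))) (trans (h-values (j ↑ˡ 4)) (lookup-++ˡ α β j)))))
         (sym (proj₂ coefA s t)))) ,
      (λ s t → trans (∙-nrcPt 3 r h (φs s t) (φt s t)) (trans
         (sumF-cong (λ j → cong (((φs s t ^ (3 ∸ toℕ j)) * (φt s t ^ toℕ j)) *_)
           (trans (cong (h ∙_) (sym (lookup-++ʳ p r j))) (trans (h-values (3 ↑ʳ j)) (lookup-++ʳ α β j)))))
         (trans (sym (proj₂ coefB (φs s t) (φt s t))) (cong₂ B (ψφs s t) (ψφt s t)))))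
      where
      coefA : ∃ λ f → A ≗₂ evalForm 2 f
      coefA = coefficients fA
      coefB : ∃ λ f → (λ s t → B (ψs s t) (ψt s t)) ≗₂ evalForm 3 f
      coefB = coefficients (Form-subst (D * d) (- (D * b)) (- (D * c)) (D * a) fB)
      α : Vect 3
      α = proj₁ coefA
      β : Vect 4
      β = proj₁ coefB
      sol : ∃ λ h → ∀ j → h ∙ (p ++ r) j ≡ (α ++ β) j
      sol = dual-solution refl (p ++ r) indep (α ++ β)
      h : V7
      h = proj₁ sol
      h-values : ∀ j → h ∙ (p ++ r) j ≡ (α ++ β) j
      h-values = proj₂ sol

    Q≡0⇒kills-p : ∀ h → Q h ≗₂ 𝟎 → ∀ j → h ∙ p j ≡ 0#
    Q≡0⇒kills-p h eq = evalForm-zero 2 3≤q (λ j → h ∙ p j) (λ s t → trans (sym (∙-nrcPt 2 p h s t)) (eq s t))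

    kills-p⇒Q≡0 : ∀ h → (∀ j → h ∙ p j ≡ 0#) → Q h ≗₂ 𝟎
    kills-p⇒Q≡0 h kills s t = kills-span {u = p} h kills ((λ j → (s ^ (2 ∸ toℕ j)) * (t ^ toℕ j)) , λ _ → refl)

    R≡0⇒kills-r : ∀ h → R h ≗₂ 𝟎 → ∀ j → h ∙ r j ≡ 0#
    R≡0⇒kills-r h eq = evalForm-zero 3 4≤q (λ j → h ∙ r j) (λ s t → trans (sym (∙-nrcPt 3 r h s t))
      (trans (cong₂ (λ s t → h ∙ nrcPt 3 r s t) (sym (φψs s t)) (sym (φψt s t))) (eq (ψs s t) (ψt s t))))

    functional-zero : ∀ h → Q h ≗₂ 𝟎 → R h ≗₂ 𝟎 → IsZeroFunctional h
    functional-zero h Q≡0 R≡0 = annihilator-trivial (p ++ r) indep h kills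
      where
      kills : ∀ j → h ∙ (p ++ r) j ≡ 0#
      kills = ↑-elim 3
        (λ j → trans (cong (h ∙_) (lookup-++ˡ p r j)) (Q≡0⇒kills-p h Q≡0 j))
        (λ j → trans (cong (h ∙_) (lookup-++ʳ p r j)) (R≡0⇒kills-r h R≡0 j))

    Q-⊕ : ∀ g h s t → Q (g ⊕ h) s t ≡ Q g s t + Q h s t
    Q-⊕ g h s t = ∙-⊕ˡ g h (C s t)
    R-⊕ : ∀ g h s t → R (g ⊕ h) s t ≡ R g s t + R h s t
    R-⊕ g h s t = ∙-⊕ˡ g h (N s t)
    Q-⊛ : ∀ κ h s t → Q (κ ⊛ h) s t ≡ κ * Q h s t
    Q-⊛ κ h s t = ∙-⊛ˡ κ h (C s t)
    R-⊛ : ∀ κ h s t → R (κ ⊛ h) s t ≡ κ * R h s t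
    R-⊛ κ h s t = ∙-⊛ˡ κ h (N s t)

    functional-determined : ∀ g h κ → Q g ≗₂ scale κ (Q h) → R g ≗₂ scale κ (R h) → ∀ i → g i ≡ κ * h i
    functional-determined g h κ eq eq′ i = a-b≡0⇒a≡b (trans
      (solve 3 (λ g k h → g :- k :* h := g :+ (:- k) :* h) refl (g i) κ (h i))
      (functional-zero (g ⊕ (- κ) ⊛ h)
        (λ s t → trans (Q-⊕ g ((- κ) ⊛ h) s t) (trans (cong₂ _+_ (eq s t) (Q-⊛ (- κ) h s t))
          (solve 2 (λ k x → k :* x :+ (:- k) :* x := :0) refl κ (Q h s t))))
        (λ s t → trans (R-⊕ g ((- κ) ⊛ h) s t) (trans (cong₂ _+_ (eq′ s t) (R-⊛ (- κ) h s t))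
          (solve 2 (λ k x → k :* x :+ (:- k) :* x := :0) refl κ (R h s t)))) i))

  OnGenerator : K → K → V7 → Set
  OnGenerator s t v = ∃₂ λ x y → ∀ i → v i ≡ (x ⊛ C s t ⊕ y ⊛ N s t) i

  abstract
    span⇒OnGenerator : ∀ s t v → InSpan (genBasis s t) v → OnGenerator s t v
    span⇒OnGenerator s t v (c , e) = c zero , c (suc zero) , λ i → trans (e i)
      (cong (c zero * C s t i +_) (+-identityʳ _))

    OnGenerator⇒span : ∀ s t v → OnGenerator s t v → InSpan (genBasis s t) v
    OnGenerator⇒span s t v (x , y , e) = (x ∷ y ∷ []) , λ i → trans (e i)
      (cong (x * C s t i +_) (sym (+-identityʳ _)))

    -- `C` has degree 2 and `N` degree 3, so the two coordinates on the generator change by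
    -- different powers of the scalar.
    OnGenerator-scale : ∀ {s t s′ t′} c → s′ ≡ c * s → t′ ≡ c * t → ∀ v →
                        OnGenerator s′ t′ v → OnGenerator s t v
    OnGenerator-scale {s} {t} κ refl refl v (x , y , e) = x * (κ ^ 2) , y * (κ ^ 3) , λ i →
      trans (e i) (cong₂ _+_
        (trans (cong (x *_) (Form-homogeneous (Form-C i) κ s t)) (sym (*-assoc _ _ _)))
        (trans (cong (y *_) (Form-homogeneous (Form-N i) κ s t)) (sym (*-assoc _ _ _))))

    ∙-generator : ∀ h {s t v} x y → (∀ i → v i ≡ (x ⊛ C s t ⊕ y ⊛ N s t) i) →
                  h ∙ v ≡ x * Q h s t + y * R h s t
    ∙-generator h {s} {t} x y e = trans (∙-congʳ h e) (trans (∙-⊕ʳ h (x ⊛ C s t) (y ⊛ N s t))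
      (cong₂ _+_ (∙-⊛ʳ h x (C s t)) (∙-⊛ʳ h y (N s t))))

  -- For `m` of degree 2, 1 or 0, and `S` of degree one more, this parametrises the 5-dim nrc, the
  -- 4-dim nrc or the twisted cubic of the three types of section.
  residual : Fun → Fun → K → K → V7
  residual S m s t = S s t ⊛ C s t ⊕ (- m s t) ⊛ N s t

  abstract
    ∙-residual : ∀ h S m s t → h ∙ residual S m s t ≡ S s t * Q h s t + - m s t * R h s t
    ∙-residual h S m s t = ∙-generator h (S s t) (- m s t) (λ _ → refl)

    -- The `u j` are the coefficient vectors of the parametrisation. A functional that kills `e` and
    -- `u` kills the curve, so the seven vectors `e ++ u` have trivial annihilator and are
    -- independent. The vectors `e` make up for the functionals that do vanish on the curve.
    residual-nrc : ∀ {d k} → d ℕ.+ suc k ≡ 7 → (W : K → K → V7) → (∀ i → Form k (λ s t → W s t i)) →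
      (e : Fin d → V7) →
      (∀ h → (∀ s t → h ∙ W s t ≡ 0#) → (∀ j → h ∙ e j ≡ 0#) → IsZeroFunctional h) →
      ∃ λ (u : Fin (suc k) → V7) → Independent u × (∀ s t i → W s t i ≡ nrcPt k u s t i)
    residual-nrc {d} {k} d+k≡7 W fW e trivial = u , u-indep , W≡
      where
      u : Fin (suc k) → V7
      u j i = proj₁ (coefficients (fW i)) j
      W≡ : ∀ s t i → W s t i ≡ nrcPt k u s t i
      W≡ s t i = proj₂ (coefficients (fW i)) s t
      eu-indep : LinIndep (e ++ u)
      eu-indep = indep-of-annihilator d+k≡7 (e ++ u) (λ h kills → trivial h
        (λ s t → trans (∙-congʳ h (W≡ s t)) (kills-span {u = u} h
           (λ j → trans (cong (h ∙_) (sym (lookup-++ʳ e u j))) (kills (d ↑ʳ j)))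
           ((λ j → (s ^ (k ∸ toℕ j)) * (t ^ toℕ j)) , λ _ → refl)))
        (λ j → trans (cong (h ∙_) (sym (lookup-++ˡ e u j))) (kills (j ↑ˡ suc k))))
      u-indep : Independent u
      u-indep c c·u≡0 j = trans (sym (lookup-++ʳ z c j)) (eu-indep (z ++ c) comb≡0 (d ↑ʳ j))
        where
        z : Vect d
        z _ = 0#
        comb≡0 : ∀ i → comb (z ++ c) (e ++ u) i ≡ 0#
        comb≡0 i = trans (comb-++ (z ++ c) e u i) (trans (cong₂ _+_
          (sumF-zero (λ j → trans (cong (_* e j i) (lookup-++ˡ z c j)) (zeroˡ _)))
          (trans (sumF-cong (λ j → cong (_* u j i) (lookup-++ʳ z c j))) (c·u≡0 i))) (+-identityˡ _))

    residual-proportional : ∀ {m S x y} → ¬ (m ≡ 0# × S ≡ 0#) → x * m + y * S ≡ 0# →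
                            ∃ λ κ → x ≡ κ * S × y ≡ κ * (- m)
    residual-proportional {m} {S} {x} {y} ¬zero eq with S ≟ 0#
    ... | no S≢0 = x * S⁻¹ ,
        lincomb₁ (- x) inv (solve 3 (λ x S i → x := x :* i :* S :+ (:- x) :* (S :* i :- :1)) refl x S S⁻¹) ,
        lincomb₂ S⁻¹ (- y) eq inv
          (solve 5 (λ x y S m i → y := x :* i :* (:- m) :+ i :* (x :* m :+ y :* S :- :0)
             :+ (:- y) :* (S :* i :- :1)) refl x y S m S⁻¹)
      where
      S⁻¹ : K
      S⁻¹ = recip S≢0
      inv : S * S⁻¹ ≡ 1#
      inv = *-recip S≢0
    ... | yes S≡0 with m ≟ 0#
    ...   | yes m≡0 = ⊥-elim (¬zero (m≡0 , S≡0))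
    ...   | no  m≢0 = - (y * m⁻¹) ,
        lincomb₂ m⁻¹ (- x) eq inv
          (solve 5 (λ x y S m i → x := (:- (y :* i)) :* S :+ i :* (x :* m :+ y :* S :- :0)
             :+ (:- x) :* (m :* i :- :1)) refl x y S m m⁻¹) ,
        lincomb₁ (- y) inv (solve 3 (λ y m i → y := (:- (y :* i)) :* (:- m) :+ (:- y) :* (m :* i :- :1)) refl y m m⁻¹)
      where
      m⁻¹ : K
      m⁻¹ = recip m≢0
      inv : m * m⁻¹ ≡ 1#
      inv = *-recip m≢0

    -- A generator lies in the hyperplane h exactly when g vanishes at its
    -- parameter; every other generator meets h in the point S C − m N only.
    meets-in-residual : ∀ {d k n} → d ℕ.+ suc k ≡ 7 → ∀ h (g m S : Fun) →
      Q h ≗₂ g ⊗ m → R h ≗₂ g ⊗ S → NoCommonRoot m S →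
      (∀ i → Form k (λ s t → residual S m s t i)) →
      (e : Fin d → V7) →
      (∀ h → (∀ s t → h ∙ residual S m s t ≡ 0#) → (∀ j → h ∙ e j ≡ 0#) → IsZeroFunctional h) →
      (gs : Fin n → K × K) → (∀ j → ParamOK (proj₁ (gs j)) (proj₂ (gs j))) →
      (∀ j j′ → gs j ∼₂ gs j′ → j ≡ j′) →
      (∀ s t → ParamOK s t → g s t ≡ 0# → ∃ λ j → gs j ∼₂ (s , t)) →
      (∀ j → g (proj₁ (gs j)) (proj₂ (gs j)) ≡ 0#) →
      MeetsInNRCAndGens k n h
    meets-in-residual {d} {k} d+k≡7 h g m S Q≡ R≡ coprime fW e trivial gs gs-ok gs-inj gs-all gs-roots =
      u , u-indep , gs , gs-ok , gs-inj , λ v → forward v , backward v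
      where
      nrc : ∃ λ (u : Fin (suc k) → V7) → Independent u × (∀ s t i → residual S m s t i ≡ nrcPt k u s t i)
      nrc = residual-nrc d+k≡7 (residual S m) fW e trivial
      u : Fin (suc k) → V7
      u = proj₁ nrc
      u-indep : Independent u
      u-indep = proj₁ (proj₂ nrc)
      W≡ : ∀ s t i → residual S m s t i ≡ nrcPt k u s t i
      W≡ = proj₂ (proj₂ nrc)
      forward : ∀ v → VH h v → OnNRC k u v ⊎ (∃ λ j → OnGen (gs j) v)
      forward v (v≢0 , (s , t , ok , (_ , v∈gen)) , h·v≡0) with g s t ≟ 0#
      ... | yes g≡0 = inj₂ (proj₁ root , v≢0 , OnGenerator⇒span _ _ v
              (OnGenerator-scale (proj₁ (proj₂ root)) (proj₁ (proj₂ (proj₂ (proj₂ root))))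
                 (proj₂ (proj₂ (proj₂ (proj₂ root)))) v (span⇒OnGenerator s t v v∈gen)))
        where
        root : ∃ λ j → gs j ∼₂ (s , t)
        root = gs-all s t ok g≡0
      ... | no g≢0 = inj₁ (v≢0 , s , t , ok , κ , κ≢0 , v≡)
        where
        on : OnGenerator s t v
        on = span⇒OnGenerator s t v v∈gen
        x y : K
        x = proj₁ on
        y = proj₁ (proj₂ on)
        rel : x * m s t + y * S s t ≡ 0#
        rel = *≡0 g≢0 (begin
          g s t * (x * m s t + y * S s t)
            ≡⟨ solve 5 (λ g x m y S → g :* (x :* m :+ y :* S) := x :* (g :* m) :+ y :* (g :* S)) refl
                 (g s t) x (m s t) y (S s t) ⟩
          x * (g s t * m s t) + y * (g s t * S s t)
            ≡⟨ sym (cong₂ (λ a b → x * a + y * b) (Q≡ s t) (R≡ s t)) ⟩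
          x * Q h s t + y * R h s t ≡⟨ sym (∙-generator h x y (proj₂ (proj₂ on))) ⟩
          h ∙ v                     ≡⟨ h·v≡0 ⟩
          0# ∎)
        prop : ∃ λ κ → x ≡ κ * S s t × y ≡ κ * (- m s t)
        prop = residual-proportional (coprime s t ok) rel
        κ : K
        κ = proj₁ prop
        v≡ : ∀ i → v i ≡ κ * nrcPt k u s t i
        v≡ i = trans (proj₂ (proj₂ on) i) (trans
          (cong₂ (λ a b → a * C s t i + b * N s t i) (proj₁ (proj₂ prop)) (proj₂ (proj₂ prop)))
          (trans (solve 5 (λ k S c m n → k :* S :* c :+ k :* m :* n := k :* (S :* c :+ m :* n)) refl
                   κ (S s t) (C s t i) (- m s t) (N s t i))
                 (cong (κ *_) (W≡ s t i))))
        κ≢0 : κ ≢ 0#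
        κ≢0 κ≡0 = v≢0 (λ i → trans (v≡ i) (trans (cong (_* _) κ≡0) (zeroˡ _)))
      backward : ∀ v → OnNRC k u v ⊎ (∃ λ j → OnGen (gs j) v) → VH h v
      backward v (inj₁ (v≢0 , s , t , ok , κ , κ≢0 , v≡)) =
        v≢0 , (s , t , ok , v≢0 , OnGenerator⇒span s t v (κ * S s t , κ * (- m s t) , v≡′)) ,
        trans (∙-generator h _ _ v≡′) (trans
          (cong₂ (λ a b → κ * S s t * a + κ * (- m s t) * b) (Q≡ s t) (R≡ s t))
          (solve 4 (λ k S m g → k :* S :* (g :* m) :+ k :* (:- m) :* (g :* S) := :0) refl
             κ (S s t) (m s t) (g s t)))
        where
        v≡′ : ∀ i → v i ≡ ((κ * S s t) ⊛ C s t ⊕ (κ * (- m s t)) ⊛ N s t) i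
        v≡′ i = trans (v≡ i) (trans (cong (κ *_) (sym (W≡ s t i)))
          (solve 5 (λ k S c m n → k :* (S :* c :+ m :* n) := k :* S :* c :+ k :* m :* n) refl
             κ (S s t) (C s t i) (- m s t) (N s t i)))
      backward v (inj₂ (j , v≢0 , v∈gen)) =
        v≢0 , (_ , _ , gs-ok j , v≢0 , v∈gen) ,
        trans (∙-generator h x y (proj₂ (proj₂ on))) (trans
          (cong₂ (λ a b → x * a + y * b) (Q≡ _ _) (R≡ _ _))
          (trans (cong (λ z → x * (z * m _ _) + y * (z * S _ _)) (gs-roots j))
            (solve 4 (λ x m y S → x :* (:0 :* m) :+ y :* (:0 :* S) := :0) refl x (m _ _) y (S _ _))))
        where
        on : OnGenerator (proj₁ (gs j)) (proj₂ (gs j)) v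
        on = span⇒OnGenerator _ _ v v∈gen
        x y : K
        x = proj₁ on
        y = proj₁ (proj₂ on)

-- The three types of hyperplane section.

module Sections (F : FiniteField) (6≤q : 6 ≤ FiniteField.q F)
                (p : Fin 3 → Fin 7 → FiniteField.K F) (r : Fin 4 → Fin 7 → FiniteField.K F)
                (φ : Geometry.Projectivity F)
                (indep : Geometry.Independent F (p ++ r)) where
  open Surface F 6≤q p r φ indep public
  open ≡-Reasoning

  abstract
    Form-residual : ∀ {a S m} → Form (suc a) S → Form a m →
                    ∀ i → Form (suc a ℕ.+ 2) (λ s t → residual S m s t i)
    Form-residual {a} {S = S} {m} fS fm i = Form-⊞ (Form-⊗ fS (Form-C i))
      (subst (λ k → Form k (λ s t → - m s t * N s t i)) (ℕₚ.+-suc a 2)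
        (Form-⊗ (Form-resp (λ s t → solve 1 (λ m → :- :1 :* m := :- m) refl (m s t)) (Form-scale (- 1#) fm))
                (Form-N i)))

    common-zero-functional : ∀ h m S → (∀ s t → h ∙ residual S m s t ≡ 0#) → S ⊗ Q h ≗₂ m ⊗ R h
    common-zero-functional h m S kills s t = a-b≡0⇒a≡b (trans
      (solve 4 (λ a b c d → a :* b :- c :* d := a :* b :+ (:- c) :* d) refl (S s t) (Q h s t) (m s t) (R h s t))
      (trans (sym (∙-residual h S m s t)) (kills s t)))

    -- By `coprime⇒proportional` only the multiples of `h` vanish on the curve R C - Q N. It
    -- therefore spans the hyperplane, and one unit vector off `h` completes the basis.
    section-without-common-root : ∀ h x → Q h 1# x ≢ 0# → NoCommonRoot (Q h) (R h) →
      ¬ LinearlyDivides (Q h) (R h) → MeetsInNRC 5 h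
    section-without-common-root h x Qx≢0 coprime ¬divides =
      let u , u-indep , _ , _ , _ , VH≐ = meets in
      u , u-indep , λ v → (λ VHv → [ (λ z → z) , (λ { (() , _) }) ]′ (proj₁ (VH≐ v) VHv)) ,
                          (λ on → proj₂ (VH≐ v) (inj₁ on))
      where
      i₀ : ∃ λ i → h i ≢ 0#
      i₀ = nonzero-coordinate h (λ h≡0 → Qx≢0 (trans (∙-congˡ {g = h} {h = λ _ → 0#} (C 1# x) h≡0)
             (sumF-zero (λ i → zeroˡ (C 1# x i)))))
      e : Fin 1 → V7
      e _ = δ (proj₁ i₀)
      trivial : ∀ h′ → (∀ s t → h′ ∙ residual (R h) (Q h) s t ≡ 0#) → (∀ j → h′ ∙ e j ≡ 0#) →
                IsZeroFunctional h′
      trivial h′ kills kills-e i =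
        trans (h′≡ i) (trans (cong (_* h i) κ≡0) (zeroˡ _))
        where
        prop : ∃ λ κ → Q h′ ≗₂ scale κ (Q h) × R h′ ≗₂ scale κ (R h)
        prop = coprime⇒proportional (Form-Q h) (Form-R h) (Form-Q h′) (Form-R h′) x Qx≢0 coprime ¬divides
          (λ s t → trans (sym (common-zero-functional h′ (Q h) (R h) kills s t)) (*-comm _ _))
        κ : K
        κ = proj₁ prop
        h′≡ : ∀ i → h′ i ≡ κ * h i
        h′≡ = functional-determined h′ h κ (proj₁ (proj₂ prop)) (proj₂ (proj₂ prop))
        κ≡0 : κ ≡ 0#
        κ≡0 = *≡0 (proj₂ i₀) (trans (*-comm _ κ) (trans (sym (h′≡ (proj₁ i₀)))
          (trans (sym (∙-δ (proj₁ i₀) h′)) (trans (∙-comm (δ (proj₁ i₀)) h′) (kills-e zero)))))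
      meets : MeetsInNRCAndGens 5 0 h
      meets = meets-in-residual {d = 1} refl h (λ _ _ → 1#) (Q h) (R h)
        (λ s t → sym (*-identityˡ _)) (λ s t → sym (*-identityˡ _)) coprime
        (Form-residual (Form-R h) (Form-Q h)) e trivial (λ ()) (λ ()) (λ ())
        (λ s t _ 1≡0 → ⊥-elim (0≢1 (sym 1≡0))) (λ ())

    -- A functional that vanishes on S C - m N has Q = m n and R = S n for a linear form n. Two
    -- conic points at which m does not vanish are enough to force n = 0, and they serve as `e`.
    section-with-one-common-root : ∀ h {x y m S} → ParamOK x y → Form 1 m → Form 2 S →
      Q h ≗₂ lin x y ⊗ m → R h ≗₂ lin x y ⊗ S → ¬ (m ≗₂ 𝟎) → ¬ LinearlyDivides m S →
      MeetsInNRCAndGens 4 1 h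
    section-with-one-common-root h {x} {y} {m} {S} ok fm fS Q≡ R≡ m≢0 ¬divides =
      meets-in-residual {d = 2} {4} {1} refl h (lin x y) m S Q≡ R≡ coprime (Form-residual fS fm) e trivial
        (λ _ → x , y) (λ _ → ok) (λ { zero zero _ → refl })
        (λ s t ok′ root → zero , lin≡0⇒∼₂ ok ok′ root) (λ _ → lin-self x y)
      where
      -- A linear form `m` is a scalar times the factor of its root, so a common root would make `S`
      -- a multiple of `m`.
      coprime : NoCommonRoot m S
      coprime s₀ t₀ okst (mst≡0 , Sst≡0) with factor fm okst mst≡0 | factor fS okst Sst≡0
      ... | (G , constant c G≡c , m≡) | (n , fn , S≡) = ¬divides (scale (proj₁ inv) n , Form-scale _ fn , λ s′ t′ →
          trans (S≡ s′ t′) (lincomb₂ (- (lin s₀ t₀ s′ t′ * n s′ t′)) (- (proj₁ inv * n s′ t′))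
            (proj₂ inv) (trans (m≡ s′ t′) (cong (lin s₀ t₀ s′ t′ *_) (G≡c s′ t′)))
            (solve 5 (λ l n i c m → l :* n := i :* n :* m :+ (:- (l :* n)) :* (c :* i :- :1)
                :+ (:- (i :* n)) :* (m :- l :* c)) refl
               (lin s₀ t₀ s′ t′) (n s′ t′) (proj₁ inv) c (m s′ t′))))
        where
        c≢0 : c ≢ 0#
        c≢0 c≡0 = m≢0 (λ s t → trans (m≡ s t) (trans (cong (lin s₀ t₀ s t *_) (trans (G≡c s t) c≡0)) (zeroʳ _)))
        inv : ∃ λ i → c * i ≡ 1#
        inv = inverse c c≢0
      m-linear : ∃₂ λ a b → ParamOK a b × m ≗₂ lin a b
      m-linear = [ (λ m≡0 → ⊥-elim (m≢0 m≡0)) , (λ z → z) ]′ (linear-form fm)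
      a b : K
      a = proj₁ m-linear
      b = proj₁ (proj₂ m-linear)
      okab : ParamOK a b
      okab = proj₁ (proj₂ (proj₂ m-linear))
      m≡ : m ≗₂ lin a b
      m≡ = proj₂ (proj₂ (proj₂ m-linear))
      mab≡0 : m a b ≡ 0#
      mab≡0 = trans (m≡ a b) (lin-self a b)
      nonroots : ∃ λ (xs : Fin 2 → K) → (∀ j k → xs j ≡ xs k → j ≡ k) × (∀ k → lin a b 1# (xs k) ≢ 0#)
      nonroots = lin-nonroots 3≤q okab
      xs : Fin 2 → K
      xs = proj₁ nonroots
      e : Fin 2 → V7
      e k = C 1# (xs k)
      trivial : ∀ h′ → (∀ s t → h′ ∙ residual S m s t ≡ 0#) → (∀ j → h′ ∙ e j ≡ 0#) → IsZeroFunctional h′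
      trivial h′ kills kills-e = functional-zero h′
          (λ s t → trans (Q′≡ s t) (trans (cong (lin a b s t *_) (n≡0 s t)) (zeroʳ _)))
          (λ s t → trans (R′≡ s t) (trans (cong (S s t *_) (n≡0 s t)) (zeroʳ _)))
        where
        eq : S ⊗ Q h′ ≗₂ m ⊗ R h′
        eq = common-zero-functional h′ m S kills
        Q′ab≡0 : Q h′ a b ≡ 0#
        Q′ab≡0 = *≡0 (λ Sab≡0 → coprime a b okab (mab≡0 , Sab≡0))
          (trans (eq a b) (trans (cong (_* R h′ a b) mab≡0) (zeroˡ _)))
        Q′-factor : ∃ λ G → Form 1 G × Q h′ ≗₂ lin a b ⊗ G
        Q′-factor = factor (Form-Q h′) okab Q′ab≡0
        n : Fun
        n = proj₁ Q′-factor
        fn : Form 1 n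
        fn = proj₁ (proj₂ Q′-factor)
        Q′≡ : Q h′ ≗₂ lin a b ⊗ n
        Q′≡ = proj₂ (proj₂ Q′-factor)
        R′≡ : R h′ ≗₂ S ⊗ n
        R′≡ = cancel-lin-eq 5≤q (Form-R h′) (Form-⊗ fS fn) okab (λ s t → begin
          lin a b s t * R h′ s t          ≡⟨ cong (_* R h′ s t) (sym (m≡ s t)) ⟩
          m s t * R h′ s t                ≡⟨ sym (eq s t) ⟩
          S s t * Q h′ s t                ≡⟨ cong (S s t *_) (Q′≡ s t) ⟩
          S s t * (lin a b s t * n s t)   ≡⟨ solve 3 (λ S l n → S :* (l :* n) := l :* (S :* n)) refl
                                               (S s t) (lin a b s t) (n s t) ⟩
          lin a b s t * (S s t * n s t)   ∎)
        n≡0 : n ≗₂ 𝟎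
        n≡0 = many-roots fn xs (proj₁ (proj₂ nonroots))
          (λ k → *≡0 (proj₂ (proj₂ nonroots) k) (trans (sym (Q′≡ 1# (xs k))) (kills-e k)))

    -- A functional that vanishes on l C - N satisfies R = l Q and is thus determined by Q, that is,
    -- by its values on the conic plane. Hence `p` completes the basis.
    section-divisible : ∀ {n} h {l} → Form 1 l → R h ≗₂ l ⊗ Q h →
      (gs : Fin n → K × K) → (∀ j → ParamOK (proj₁ (gs j)) (proj₂ (gs j))) →
      (∀ j j′ → gs j ∼₂ gs j′ → j ≡ j′) →
      (∀ s t → ParamOK s t → Q h s t ≡ 0# → ∃ λ j → gs j ∼₂ (s , t)) →
      (∀ j → Q h (proj₁ (gs j)) (proj₂ (gs j)) ≡ 0#) →
      MeetsInNRCAndGens 3 n h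
    section-divisible h {l} fl R≡ = meets-in-residual {d = 3} refl h (Q h) one l
        (λ s t → sym (*-identityʳ _)) (λ s t → trans (R≡ s t) (*-comm _ _))
        (λ _ _ _ z → 0≢1 (sym (proj₁ z)))
        (Form-residual fl (constant 1# (λ _ _ → refl))) p trivial
      where
      one : Fun
      one _ _ = 1#
      trivial : ∀ h′ → (∀ s t → h′ ∙ residual l one s t ≡ 0#) → (∀ j → h′ ∙ p j ≡ 0#) → IsZeroFunctional h′
      trivial h′ kills kills-p = functional-zero h′ Q′≡0 (λ s t → begin
          R h′ s t          ≡⟨ sym (*-identityˡ _) ⟩
          1# * R h′ s t     ≡⟨ sym (common-zero-functional h′ one l kills s t) ⟩
          l s t * Q h′ s t  ≡⟨ cong (l s t *_) (Q′≡0 s t) ⟩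
          l s t * 0#        ≡⟨ zeroʳ _ ⟩
          0#                ∎)
        where
        Q′≡0 : Q h′ ≗₂ 𝟎
        Q′≡0 = kills-p⇒Q≡0 h′ kills-p

    -- Independence of `u` turns a relation between points of the curve into one between their
    -- monomial vectors, which every form of degree n inherits. Suitable forms then take the place
    -- of Vandermonde determinants.
    nrc-relation : ∀ {n l} (u : Fin (suc n) → V7) → Independent u → (ds : Vect l) (P : Fin l → K × K) →
      (∀ i → comb ds (λ k → nrcPt n u (proj₁ (P k)) (proj₂ (P k))) i ≡ 0#) →
      ∀ {G} → Form n G → sumF (λ k → ds k * G (proj₁ (P k)) (proj₂ (P k))) ≡ 0#
    nrc-relation {n} {l} u u-indep ds P rel {G} fG = begin
      sumF (λ k → ds k * G (proj₁ (P k)) (proj₂ (P k)))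
        ≡⟨ sumF-cong (λ k → cong (ds k *_) (trans (proj₂ (coefficients fG) _ _) (∙-comm (mono k) g))) ⟩
      sumF (λ k → ds k * (g ∙ mono k))  ≡⟨ sym (∙-combʳ g ds mono) ⟩
      g ∙ comb ds mono                  ≡⟨ sumF-zero (λ j → trans (cong (g j *_) (mono-relation j)) (zeroʳ _)) ⟩
      0# ∎
      where
      mono : Fin l → Vect (suc n)
      mono k j = (proj₁ (P k) ^ (n ∸ toℕ j)) * (proj₂ (P k) ^ toℕ j)
      g : Vect (suc n)
      g = proj₁ (coefficients fG)
      mono-relation : ∀ j → comb ds mono j ≡ 0#
      mono-relation = u-indep (comb ds mono) (λ i → trans (sym (comb-comb ds mono u i)) (rel i))

    nrcPt-isPoint : ∀ {n} (u : Fin (suc n) → V7) → Independent u → ∀ {s t} → ParamOK s t → IsPoint (nrcPt n u s t)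
    nrcPt-isPoint {n} u u-indep {s} {t} ok zero-pt = proj₂ (proj₂ nv)
        (trans (solve 1 (λ g → g := :1 :* g :+ :0) refl (proj₁ nv s t))
          (nrc-relation u u-indep (λ (_ : Fin 1) → 1#) (λ _ → s , t)
            (λ i → trans (solve 1 (λ g → :1 :* g :+ :0 := g) refl (nrcPt n u s t i)) (zero-pt i)) (proj₁ (proj₂ nv))))
      where
      nv : ∃ λ G → Form n G × G s t ≢ 0#
      nv = nonvanishing-form n ok

    C-functional : ∀ {s t} → ParamOK s t → ∃ λ h → Q h s t ≢ 0# × R h ≗₂ 𝟎
    C-functional ok =
      let A , fA , A≢0 = nonvanishing-form 2 ok
          h , Q≡ , R≡ = functional-with fA (Form-scale 0# (proj₁ (proj₂ (nonvanishing-form 3 ok))))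
      in h , (λ eq → A≢0 (trans (sym (Q≡ _ _)) eq)) , λ s t → trans (R≡ s t) (zeroˡ _)

    N-functional : ∀ {s t} → ParamOK s t → ∃ λ h → R h s t ≢ 0# × Q h ≗₂ 𝟎
    N-functional ok =
      let A , fA , A≢0 = nonvanishing-form 3 ok
          h , Q≡ , R≡ = functional-with (Form-scale 0# (proj₁ (proj₂ (nonvanishing-form 2 ok)))) fA
      in h , (λ eq → A≢0 (trans (sym (R≡ _ _)) eq)) , λ s t → trans (Q≡ s t) (zeroˡ _)

    ∙-nonzero⇒point : ∀ {h v : V7} → h ∙ v ≢ 0# → IsPoint v
    ∙-nonzero⇒point {h} h·v≢0 v≡0 = h·v≢0 (sumF-zero (λ i → trans (cong (h i *_) (v≡0 i)) (zeroʳ _)))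

    -- The test form is the product of the linear forms of the first two points with a cubic form
    -- that is nonzero at the third. The relation reduces to its value at the third point, which
    -- must vanish.
    collinear-nrc-points : ∀ (u : Fin 6 → V7) → Independent u → ∀ {s₁ t₁ s₂ t₂ s₃ t₃} c₁ c₂ {c₃} → c₃ ≢ 0# →
      ParamOK s₃ t₃ →
      (∀ i → c₁ * nrcPt 5 u s₁ t₁ i + c₂ * nrcPt 5 u s₂ t₂ i ≡ c₃ * nrcPt 5 u s₃ t₃ i) →
      lin s₁ t₁ s₃ t₃ ≡ 0# ⊎ lin s₂ t₂ s₃ t₃ ≡ 0#
    collinear-nrc-points u u-indep {s₁} {t₁} {s₂} {t₂} {s₃} {t₃} c₁ c₂ {c₃} c₃≢0 ok₃ collinear =
      *≡0⇒⊎ _ _ (*≡0 (proj₂ (proj₂ nv)) (trans (*-comm _ _) (*≡0 c₃≢0 (three-terms H₁≡0 H₂≡0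
        (nrc-relation u u-indep ds P relation fH)))))
      where
      three-terms : ∀ {x y z} → x ≡ 0# → y ≡ 0# → c₁ * x + (c₂ * y + (- c₃ * z + 0#)) ≡ 0# → c₃ * z ≡ 0#
      three-terms {z = z} refl refl eq = lincomb₁ (- 1#) eq
        (solve 4 (λ c₁ c₂ c₃ z → c₃ :* z := :0 :+ (:- :1) :* (c₁ :* :0 :+ (c₂ :* :0 :+ ((:- c₃) :* z :+ :0)) :- :0))
           refl c₁ c₂ c₃ z)
      ds : Vect 3
      ds = c₁ ∷ c₂ ∷ - c₃ ∷ []
      P : Fin 3 → K × K
      P = (s₁ , t₁) ∷ (s₂ , t₂) ∷ (s₃ , t₃) ∷ []
      nv : ∃ λ G → Form 3 G × G s₃ t₃ ≢ 0#
      nv = nonvanishing-form 3 ok₃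
      H : Fun
      H = lin s₁ t₁ ⊗ lin s₂ t₂ ⊗ proj₁ nv
      fH : Form 5 H
      fH = Form-⊗ (Form-⊗ (Form-lin s₁ t₁) (Form-lin s₂ t₂)) (proj₁ (proj₂ nv))
      H₁≡0 : H s₁ t₁ ≡ 0#
      H₁≡0 = trans (cong (λ z → z * lin s₂ t₂ s₁ t₁ * proj₁ nv s₁ t₁) (lin-self s₁ t₁))
        (solve 2 (λ a b → :0 :* a :* b := :0) refl (lin s₂ t₂ s₁ t₁) (proj₁ nv s₁ t₁))
      H₂≡0 : H s₂ t₂ ≡ 0#
      H₂≡0 = trans (cong (λ z → lin s₁ t₁ s₂ t₂ * z * proj₁ nv s₂ t₂) (lin-self s₂ t₂))
        (solve 2 (λ a b → a :* :0 :* b := :0) refl (lin s₁ t₁ s₂ t₂) (proj₁ nv s₂ t₂))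
      relation : ∀ i → comb ds (λ k → nrcPt 5 u (proj₁ (P k)) (proj₂ (P k))) i ≡ 0#
      relation i = lincomb₁ 1# (collinear i)
        (solve 6 (λ c₁ c₂ c₃ n₁ n₂ n₃ → c₁ :* n₁ :+ (c₂ :* n₂ :+ ((:- c₃) :* n₃ :+ :0))
           := :0 :+ :1 :* (c₁ :* n₁ :+ c₂ :* n₂ :- c₃ :* n₃)) refl
           c₁ c₂ c₃ (nrcPt 5 u s₁ t₁ i) (nrcPt 5 u s₂ t₂ i) (nrcPt 5 u s₃ t₃ i))

    ∙-nrcPt-zero : ∀ n (u : Fin (suc n) → V7) h {s t s′ t′} → ParamOK s t → ParamOK s′ t′ →
      lin s t s′ t′ ≡ 0# → h ∙ nrcPt n u s t ≡ 0# → h ∙ nrcPt n u s′ t′ ≡ 0#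
    ∙-nrcPt-zero n u h {s} {t} ok ok′ eq zero-at =
      let κ , _ , s′≡ , t′≡ = lin≡0⇒∼₂ ok ok′ eq
      in trans (cong₂ (λ a b → h ∙ nrcPt n u a b) s′≡ t′≡)
           (trans (Form-homogeneous (Form-∙-nrcPt n u h) κ s t)
             (trans (cong ((κ ^ n) *_) zero-at) (zeroʳ _)))

    ∙-scalar : ∀ (h : V7) {v w : V7} {κ} → κ ≢ 0# → (∀ i → v i ≡ κ * w i) → h ∙ v ≡ 0# → h ∙ w ≡ 0#
    ∙-scalar h {v} {w} {κ} κ≢0 v≡ h·v≡0 =
      *≡0 κ≢0 (trans (sym (∙-⊛ʳ h κ w)) (trans (sym (∙-congʳ h v≡)) h·v≡0))

    -- The points C, N and C + N of a generator would be three collinear points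
    -- of the normal rational curve.
    nrc-contains-no-generator : ∀ (u : Fin 6 → V7) → Independent u → ∀ {s t} → ParamOK s t →
      ¬ (∀ v → OnGen (s , t) v → OnNRC 5 u v)
    nrc-contains-no-generator u u-indep {s} {t} ok contained =
      absurd (contained _ onC) (contained _ onN) (contained _ onC+N)
      where
      hC′ : ∃ λ h → Q h s t ≢ 0# × R h ≗₂ 𝟎
      hC′ = C-functional ok
      hN′ : ∃ λ h → R h s t ≢ 0# × Q h ≗₂ 𝟎
      hN′ = N-functional ok
      hC hN : V7
      hC = proj₁ hC′
      hN = proj₁ hN′
      hC·C+N≡ : hC ∙ (C s t ⊕ N s t) ≡ Q hC s t
      hC·C+N≡ = trans (∙-⊕ʳ hC (C s t) (N s t))
        (trans (cong (Q hC s t +_) (proj₂ (proj₂ hC′) s t)) (+-identityʳ _))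
      hN·C+N≡ : hN ∙ (C s t ⊕ N s t) ≡ R hN s t
      hN·C+N≡ = trans (∙-⊕ʳ hN (C s t) (N s t))
        (trans (cong (_+ R hN s t) (proj₂ (proj₂ hN′) s t)) (+-identityˡ _))
      onC : OnGen (s , t) (C s t)
      onC = ∙-nonzero⇒point {hC} (proj₁ (proj₂ hC′)) , OnGenerator⇒span s t _
        (1# , 0# , λ i → solve 2 (λ c n → c := :1 :* c :+ :0 :* n) refl (C s t i) (N s t i))
      onN : OnGen (s , t) (N s t)
      onN = ∙-nonzero⇒point {hN} (proj₁ (proj₂ hN′)) , OnGenerator⇒span s t _
        (0# , 1# , λ i → solve 2 (λ c n → n := :0 :* c :+ :1 :* n) refl (C s t i) (N s t i))
      onC+N : OnGen (s , t) (C s t ⊕ N s t)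
      onC+N = ∙-nonzero⇒point {hN} (λ eq → proj₁ (proj₂ hN′) (trans (sym hN·C+N≡) eq)) ,
        OnGenerator⇒span s t _
          (1# , 1# , λ i → solve 2 (λ c n → c :+ n := :1 :* c :+ :1 :* n) refl (C s t i) (N s t i))
      absurd : OnNRC 5 u (C s t) → OnNRC 5 u (N s t) → OnNRC 5 u (C s t ⊕ N s t) → ⊥
      absurd (_ , s₁ , t₁ , ok₁ , c₁ , c₁≢0 , C≡) (_ , s₂ , t₂ , ok₂ , c₂ , c₂≢0 , N≡)
             (_ , s₃ , t₃ , ok₃ , c₃ , c₃≢0 , C+N≡) =
        -- If C + N had the parameter of C, then `hN`, which vanishes at C, would vanish at C + N;
        -- there its value is the nonzero R of `hN`. The other case exchanges the roles through
        -- `hC`.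
        [ (λ eq → proj₁ (proj₂ hN′) (trans (sym hN·C+N≡) (on-third hN
             (∙-nrcPt-zero 5 u hN ok₁ ok₃ eq (∙-scalar hN c₁≢0 C≡ (proj₂ (proj₂ hN′) s t))))))
        , (λ eq → proj₁ (proj₂ hC′) (trans (sym hC·C+N≡) (on-third hC
             (∙-nrcPt-zero 5 u hC ok₂ ok₃ eq (∙-scalar hC c₂≢0 N≡ (proj₂ (proj₂ hC′) s t))))))
        ]′ (collinear-nrc-points u u-indep c₁ c₂ c₃≢0 ok₃
              (λ i → trans (cong₂ _+_ (sym (C≡ i)) (sym (N≡ i))) (C+N≡ i)))
        where
        on-third : ∀ h → h ∙ nrcPt 5 u s₃ t₃ ≡ 0# → h ∙ (C s t ⊕ N s t) ≡ 0#
        on-third h zero-at = trans (∙-congʳ h C+N≡)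
          (trans (∙-⊛ʳ h c₃ (nrcPt 5 u s₃ t₃)) (trans (cong (c₃ *_) zero-at) (zeroʳ _)))

    sumF-single : ∀ {n} (k : Fin n) (f : Fin n → K) → (∀ j → j ≢ k → f j ≡ 0#) → sumF f ≡ f k
    sumF-single zero f zeros = trans (cong (f zero +_) (sumF-zero (λ j → zeros (suc j) (λ ())))) (+-identityʳ _)
    sumF-single (suc k) f zeros = trans
      (cong₂ _+_ (zeros zero (λ ())) (sumF-single k (f ∘ suc) (λ j j≢k → zeros (suc j) (λ eq → j≢k (Finₚ.suc-injective eq)))))
      (+-identityˡ _)

  -- The numerator of a Lagrange interpolation polynomial.
  linProduct : ∀ {n} → (Fin n → K) → Fun
  linProduct {zero}  xs _ _ = 1#
  linProduct {suc n} xs = lin 1# (xs zero) ⊗ linProduct (xs ∘ suc)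

  abstract
    Form-linProduct : ∀ {n} (xs : Fin n → K) → Form n (linProduct xs)
    Form-linProduct {zero}  xs = constant 1# (λ _ _ → refl)
    Form-linProduct {suc n} xs = Form-⊗ (Form-lin 1# (xs zero)) (Form-linProduct (xs ∘ suc))

    linProduct-root : ∀ {n} (xs : Fin n → K) j → linProduct xs 1# (xs j) ≡ 0#
    linProduct-root xs zero    = trans (cong (_* linProduct (xs ∘ suc) 1# (xs zero)) (lin-self 1# (xs zero))) (zeroˡ _)
    linProduct-root xs (suc j) = trans (cong (lin 1# (xs zero) 1# (xs (suc j)) *_) (linProduct-root (xs ∘ suc) j)) (zeroʳ _)

    linProduct≢0 : ∀ {n} (xs : Fin n → K) x → (∀ j → xs j ≢ x) → linProduct xs 1# x ≢ 0#
    linProduct≢0 {zero}  xs x ≢x = λ 1≡0 → 0≢1 (sym 1≡0)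
    linProduct≢0 {suc n} xs x ≢x = *≢0 (lin-1-≢0 (≢x zero)) (linProduct≢0 (xs ∘ suc) x (≢x ∘ suc))

    -- Five points in a space of vector dimension 4 satisfy a relation with some nonzero
    -- coefficient. A quintic form that vanishes at the other four points, but not at the one with
    -- this coefficient, contradicts it.
    nrc-not-in-solid : ∀ (u : Fin 6 → V7) → Independent u → (u′ : Fin 4 → V7) →
      ¬ (∀ s t → ParamOK s t → InSpan u′ (nrcPt 5 u s t))
    nrc-not-in-solid u u-indep u′ contained = proj₂ (proj₁ (proj₂ sol)) dk≡0
      where
      xs : Fin 5 → K
      xs k = element (inject≤ k 5≤q)
      xs-injective : ∀ j k → xs j ≡ xs k → j ≡ k
      xs-injective j k eq = Finₚ.inject≤-injective 5≤q 5≤q j k (element-injective _ _ eq)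
      a : Fin 5 → Vect 4
      a k = proj₁ (contained 1# (xs k) 1-paramOK)
      sol : ∃ λ d → (∃ λ k → d k ≢ 0#) × (∀ j → (λ k → a k j) ∙ d ≡ 0#)
      sol = homogeneous-solution 4 (λ j k → a k j)
      d : Vect 5
      d = proj₁ sol
      k : Fin 5
      k = proj₁ (proj₁ (proj₂ sol))
      relation : ∀ i → comb d (λ k → nrcPt 5 u 1# (xs k)) i ≡ 0#
      relation i = trans (sumF-cong (λ k → cong (d k *_) (proj₂ (contained 1# (xs k) 1-paramOK) i)))
        (trans (comb-comb d a u′ i) (sumF-zero (λ j → trans
          (cong (_* u′ j i) (trans (∙-comm d (λ k → a k j)) (proj₂ (proj₂ sol) j))) (zeroˡ _))))
      others : Fin 4 → K
      others j = xs (punchIn k j)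
      nv : ∃ λ G → Form 1 G × G 1# (xs k) ≢ 0#
      nv = nonvanishing-form 1 1-paramOK
      G : Fun
      G = linProduct others ⊗ proj₁ nv
      Gk≢0 : G 1# (xs k) ≢ 0#
      Gk≢0 = *≢0 (linProduct≢0 others (xs k) (λ j eq → Finₚ.punchInᵢ≢i k j (xs-injective _ _ eq))) (proj₂ (proj₂ nv))
      Gj≡0 : ∀ j → j ≢ k → G 1# (xs j) ≡ 0#
      Gj≡0 j j≢k = trans (cong (_* proj₁ nv 1# (xs j)) (trans
        (cong (λ j → linProduct others 1# (xs j)) (sym (Finₚ.punchIn-punchOut (j≢k ∘ sym))))
        (linProduct-root others (punchOut (j≢k ∘ sym))))) (zeroˡ _)
      dk≡0 : d k ≡ 0#
      dk≡0 = *≡0 Gk≢0 (trans (*-comm _ _) (trans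
        (sym (sumF-single k (λ j → d j * G 1# (xs j)) (λ j j≢k → trans (cong (d j *_) (Gj≡0 j j≢k)) (zeroʳ _))))
        (nrc-relation u u-indep d (λ k → 1# , xs k) relation (Form-⊗ (Form-linProduct others) (proj₁ (proj₂ nv))))))

    nrc-excludes-generators : ∀ {k n} h → MeetsInNRC 5 h → ¬ MeetsInNRCAndGens k (suc n) h
    nrc-excludes-generators h (u , u-indep , VH≐) (_ , _ , gs , gs-ok , _ , VH≐′) =
      nrc-contains-no-generator u u-indep (gs-ok zero)
        (λ v on → proj₁ (VH≐ v) (proj₂ (VH≐′ v) (inj₂ (zero , on))))

    -- With at least one generator the argument for generators applies. A bare twisted cubic, the
    -- case of a line ℓ without conic points, has to be told apart from a 5-dim nrc by its span.
    nrc-excludes-cubic : ∀ {n} h → MeetsInNRC 5 h → ¬ MeetsInNRCAndGens 3 n h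
    nrc-excludes-cubic {suc n} h five three = nrc-excludes-generators h five three
    nrc-excludes-cubic {zero} h (u , u-indep , VH≐) (u′ , _ , _ , _ , _ , VH≐′) =
      nrc-not-in-solid u u-indep u′ (λ s t ok → in-span s t (proj₁ (VH≐′ _) (proj₂ (VH≐ _)
        (nrcPt-isPoint u u-indep ok , s , t , ok , 1# , (λ 1≡0 → 0≢1 (sym 1≡0)) , λ i → sym (*-identityˡ _)))))
      where
      in-span : ∀ {A : Fin 0 → Set} s t → OnNRC 3 u′ (nrcPt 5 u s t) ⊎ ∃ A → InSpan u′ (nrcPt 5 u s t)
      in-span s t (inj₁ (_ , a , b , _ , κ , _ , v≡)) =
        InSpanOf-resp {u = u′} v≡ (InSpanOf-⊛ {u = u′} κ ((λ j → (a ^ (3 ∸ toℕ j)) * (b ^ toℕ j)) , λ _ → refl))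
      in-span s t (inj₂ (() , _))

  ∼-sym : ∀ {n} {v w : Vect n} → v ∼ w → w ∼ v
  ∼-sym {v = v} {w} (κ , κ≢0 , w≡) =
    let κ⁻¹ , inv = inverse κ κ≢0
    in κ⁻¹ , inverse≢0 inv , λ i → lincomb₂ (- κ⁻¹) (- v i) (w≡ i) inv
         (solve 4 (λ v w k i → v := i :* w :+ (:- i) :* (w :- k :* v) :+ (:- v) :* (k :* i :- :1)) refl
            (v i) (w i) κ κ⁻¹)

  ∼-trans : ∀ {n} {u v w : Vect n} → u ∼ v → v ∼ w → u ∼ w
  ∼-trans (κ , κ≢0 , v≡) (μ , μ≢0 , w≡) =
    μ * κ , *≢0 μ≢0 κ≢0 , λ i → trans (w≡ i) (trans (cong (μ *_) (v≡ i)) (sym (*-assoc _ _ _)))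

  VH-resp-∼ : ∀ {h h′ v} → h ∼ h′ → VH h v → VH h′ v
  VH-resp-∼ {h} {h′} {v} (κ , _ , h′≡) (v≢0 , inV , h·v≡0) =
    v≢0 , inV , trans (∙-congˡ v h′≡) (trans (∙-⊛ˡ κ h v) (trans (cong (κ *_) h·v≡0) (zeroʳ _)))

  MeetsInNRC-resp-∼ : ∀ {k h h′} → h ∼ h′ → MeetsInNRC k h → MeetsInNRC k h′
  MeetsInNRC-resp-∼ h∼h′ (u , u-indep , VH≐) = u , u-indep , λ v →
    (λ x → proj₁ (VH≐ v) (VH-resp-∼ (∼-sym h∼h′) x)) , (λ x → VH-resp-∼ h∼h′ (proj₂ (VH≐ v) x))

  MeetsInNRCAndGens-resp-∼ : ∀ {k n h h′} → h ∼ h′ → MeetsInNRCAndGens k n h → MeetsInNRCAndGens k n h′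
  MeetsInNRCAndGens-resp-∼ h∼h′ (u , u-indep , g , ok , inj , VH≐) = u , u-indep , g , ok , inj , λ v →
    (λ x → proj₁ (VH≐ v) (VH-resp-∼ (∼-sym h∼h′) x)) , (λ x → VH-resp-∼ h∼h′ (proj₂ (VH≐ v) x))

-- The regular spread and its hyperplane at infinity.

module SpreadGeometry (F : FiniteField)
                      (c : Fin 3 → FiniteField.K F) (irreducible : Geometry.IrreducibleCubic F c)
                      (b : Fin 6 → Fin 7 → FiniteField.K F) (b-indep : Geometry.Independent F b) where
  open LinearAlgebra F
  open Spread c b
  open ≡-Reasoning

  powers : Vect 6 → Fin 3 → Vect 6
  powers w zero             = w
  powers w (suc zero)       = mulx w
  powers w (suc (suc zero)) = mulx (mulx w)

  spreadBasis≡embed : ∀ w k i → spreadBasis w k i ≡ embed (powers w k) i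
  spreadBasis≡embed w zero             i = refl
  spreadBasis≡embed w (suc zero)       i = refl
  spreadBasis≡embed w (suc (suc zero)) i = refl

  abstract
    mulx-cong : ∀ {v w} → (∀ i → v i ≡ w i) → ∀ i → mulx v i ≡ mulx w i
    mulx-cong eq zero                               = cong (c₀ *_) (eq _)
    mulx-cong eq (suc zero)                         = cong₂ (λ x y → x + c₁ * y) (eq _) (eq _)
    mulx-cong eq (suc (suc zero))                   = cong₂ (λ x y → x + c₂ * y) (eq _) (eq _)
    mulx-cong eq (suc (suc (suc zero)))             = cong (c₀ *_) (eq _)
    mulx-cong eq (suc (suc (suc (suc zero))))       = cong₂ (λ x y → x + c₁ * y) (eq _) (eq _)
    mulx-cong eq (suc (suc (suc (suc (suc zero))))) = cong₂ (λ x y → x + c₂ * y) (eq _) (eq _)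

    mulx-comb : ∀ {m} (a : Vect m) (u : Fin m → Vect 6) i → mulx (comb a u) i ≡ comb a (mulx ∘ u) i
    mulx-comb {m} a u = λ
      { zero                               → scaled c₀ _
      ; (suc zero)                         → shifted c₁ _ _
      ; (suc (suc zero))                   → shifted c₂ _ _
      ; (suc (suc (suc zero)))             → scaled c₀ _
      ; (suc (suc (suc (suc zero))))       → shifted c₁ _ _
      ; (suc (suc (suc (suc (suc zero))))) → shifted c₂ _ _ }
      where
      scaled : ∀ k i → k * comb a u i ≡ sumF (λ j → a j * (k * u j i))
      scaled k i = trans (sym (sumF-* k (λ j → a j * u j i)))
        (sumF-cong (λ j → solve 3 (λ k a u → k :* (a :* u) := a :* (k :* u)) refl k (a j) (u j i)))
      shifted : ∀ k i i′ → comb a u i + k * comb a u i′ ≡ sumF (λ j → a j * (u j i + k * u j i′))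
      shifted k i i′ = trans (cong (comb a u i +_) (scaled k i′))
        (trans (sym (sumF-+ (λ j → a j * u j i) (λ j → a j * (k * u j i′))))
               (sumF-cong (λ j → sym (distribˡ (a j) (u j i) (k * u j i′)))))

    mulx-linear : ∀ x y v w i → mulx (x ⊛ v ⊕ y ⊛ w) i ≡ x * mulx v i + y * mulx w i
    mulx-linear x y v w = λ
      { zero                               → scaled c₀ _ _
      ; (suc zero)                         → shifted c₁ _ _ _ _
      ; (suc (suc zero))                   → shifted c₂ _ _ _ _
      ; (suc (suc (suc zero)))             → scaled c₀ _ _
      ; (suc (suc (suc (suc zero))))       → shifted c₁ _ _ _ _
      ; (suc (suc (suc (suc (suc zero))))) → shifted c₂ _ _ _ _ }
      where
      scaled : ∀ k v w → k * (x * v + y * w) ≡ x * (k * v) + y * (k * w)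
      scaled k v w = solve 5 (λ k x v y w → k :* (x :* v :+ y :* w) := x :* (k :* v) :+ y :* (k :* w)) refl k x v y w
      shifted : ∀ k v w v′ w′ → x * v + y * w + k * (x * v′ + y * w′) ≡ x * (v + k * v′) + y * (w + k * w′)
      shifted k v w v′ w′ = solve 7 (λ k x v y w v′ w′ → x :* v :+ y :* w :+ k :* (x :* v′ :+ y :* w′)
         := x :* (v :+ k :* v′) :+ y :* (w :+ k :* w′)) refl k x v y w v′ w′

    mulx³ : ∀ w i → mulx (mulx (mulx w)) i ≡ c₀ * w i + (c₁ * mulx w i + c₂ * mulx (mulx w) i)
    mulx³ w = λ
      { zero                               → first _ _ _
      ; (suc zero)                         → second _ _ _
      ; (suc (suc zero))                   → third _ _ _
      ; (suc (suc (suc zero)))             → first _ _ _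
      ; (suc (suc (suc (suc zero))))       → second _ _ _
      ; (suc (suc (suc (suc (suc zero))))) → third _ _ _ }
      where
      first : ∀ x y z → c₀ * (x + c₁ * z + c₂ * (y + c₂ * z)) ≡ c₀ * x + (c₁ * (c₀ * z) + c₂ * (c₀ * (y + c₂ * z)))
      first = solve 6 (λ c₀ c₁ c₂ x y z → c₀ :* (x :+ c₁ :* z :+ c₂ :* (y :+ c₂ :* z))
         := c₀ :* x :+ (c₁ :* (c₀ :* z) :+ c₂ :* (c₀ :* (y :+ c₂ :* z)))) refl c₀ c₁ c₂
      second : ∀ x y z → c₀ * (y + c₂ * z) + c₁ * (x + c₁ * z + c₂ * (y + c₂ * z)) ≡
                         c₀ * y + (c₁ * (x + c₁ * z) + c₂ * (c₀ * z + c₁ * (y + c₂ * z)))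
      second = solve 6 (λ c₀ c₁ c₂ x y z → c₀ :* (y :+ c₂ :* z) :+ c₁ :* (x :+ c₁ :* z :+ c₂ :* (y :+ c₂ :* z))
         := c₀ :* y :+ (c₁ :* (x :+ c₁ :* z) :+ c₂ :* (c₀ :* z :+ c₁ :* (y :+ c₂ :* z)))) refl c₀ c₁ c₂
      third : ∀ x y z → c₀ * z + c₁ * (y + c₂ * z) + c₂ * (x + c₁ * z + c₂ * (y + c₂ * z)) ≡
                        c₀ * z + (c₁ * (y + c₂ * z) + c₂ * (x + c₁ * z + c₂ * (y + c₂ * z)))
      third x y z = +-assoc _ _ _

    -- By `mulx³` an eigenvalue would be a root of the irreducible cubic.
    no-eigenvector : ∀ y e → ¬ IsZero y → ¬ (∀ i → mulx y i ≡ e * y i)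
    no-eigenvector y e y≢0 eigen = irreducible e (*-cancelˡ-≢0 (proj₂ k)
        (trans (solve 2 (λ y e → y :* (e :* (e :* (e :* :1))) := e :* (e :* (e :* y))) refl yₖ e)
        (trans (sym cube) (trans (mulx³ y (proj₁ k)) (trans
          (cong₂ (λ x x′ → c₀ * yₖ + (c₁ * x + c₂ * x′)) (eigen (proj₁ k)) (square (proj₁ k)))
          (solve 5 (λ c₀ c₁ c₂ y e → c₀ :* y :+ (c₁ :* (e :* y) :+ c₂ :* (e :* (e :* y)))
             := y :* (c₀ :+ c₁ :* e :+ c₂ :* (e :* (e :* :1)))) refl c₀ c₁ c₂ yₖ e))))))
      where
      k : ∃ λ i → y i ≢ 0#
      k = nonzero-coordinate y y≢0
      yₖ : K
      yₖ = y (proj₁ k)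
      multiple : ∀ {v a} → (∀ i → v i ≡ a * y i) → ∀ i → mulx v i ≡ a * (e * y i)
      multiple {v} {a} eq i = trans (mulx-cong (λ i → trans (eq i)
          (solve 2 (λ a y → a :* y := a :* y :+ :0 :* y) refl a (y i))) i)
        (trans (mulx-linear a 0# y y i) (trans
          (solve 2 (λ a y → a :* y :+ :0 :* y := a :* y) refl a (mulx y i)) (cong (a *_) (eigen i))))
      square : ∀ i → mulx (mulx y) i ≡ e * (e * y i)
      square = multiple eigen
      cube : mulx (mulx (mulx y)) (proj₁ k) ≡ e * (e * (e * yₖ))
      cube = trans (multiple (λ i → trans (square i) (sym (*-assoc e e (y i)))) (proj₁ k)) (*-assoc e e _)

    -- Reducing the cubic relation modulo the quadratic one leaves ω x y = ζ y. If ω ≠ 0, then y is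
    -- an eigenvector; if ω = 0, then ζ = 0 as well and the cubic is reducible.
    no-quadratic-relation : ∀ y a′ b′ → ¬ IsZero y → ¬ (∀ i → mulx (mulx y) i ≡ a′ * y i + b′ * mulx y i)
    no-quadratic-relation y a′ b′ y≢0 rel = case (ω ≟ 0#)
      where
      ω ζ : K
      ω = a′ + b′ * b′ + - c₁ + - (c₂ * b′)
      ζ = c₀ + c₂ * a′ + - (a′ * b′)
      linear : ∀ i → ω * mulx y i ≡ ζ * y i
      linear i = lincomb₃ 1# (- (b′ + - c₂)) (- 1#) (mulx³ y i) (rel i) (trans (mulx-cong rel i) (mulx-linear a′ b′ y (mulx y) i))
        (solve 9 (λ a b c₀ c₁ c₂ y t t₂ t₃ → (a :+ b :* b :- c₁ :- c₂ :* b) :* t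
            := (c₀ :+ c₂ :* a :- a :* b) :* y :+ :1 :* (t₃ :- (c₀ :* y :+ (c₁ :* t :+ c₂ :* t₂)))
               :+ (:- (b :- c₂)) :* (t₂ :- (a :* y :+ b :* t)) :+ (:- :1) :* (t₃ :- (a :* t :+ b :* t₂))) refl
            a′ b′ c₀ c₁ c₂ (y i) (mulx y i) (mulx (mulx y) i) (mulx (mulx (mulx y)) i))
      case : Dec (ω ≡ 0#) → ⊥
      case (no ω≢0) = no-eigenvector y (ζ * ω⁻¹) y≢0 (λ i → lincomb₂ ω⁻¹ (- mulx y i) (linear i) (*-recip ω≢0)
          (solve 5 (λ ω i ζ y t → t := ζ :* i :* y :+ i :* (ω :* t :- ζ :* y) :+ (:- t) :* (ω :* i :- :1)) refl
             ω ω⁻¹ ζ (y i) (mulx y i)))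
        where
        ω⁻¹ : K
        ω⁻¹ = recip ω≢0
      -- Now x³ − c₂x² − c₁x − c₀ = (x² − b′x − a′)(x − (c₂ − b′)).
      case (yes ω≡0) = irreducible e (lincomb₂ (- 1#) e ζ≡0 ω≡0
          (solve 5 (λ a b c₀ c₁ c₂ → (c₂ :- b) :* ((c₂ :- b) :* ((c₂ :- b) :* :1))
             := c₀ :+ c₁ :* (c₂ :- b) :+ c₂ :* ((c₂ :- b) :* ((c₂ :- b) :* :1))
                :+ (:- :1) :* (c₀ :+ c₂ :* a :- a :* b :- :0)
                :+ (c₂ :- b) :* (a :+ b :* b :- c₁ :- c₂ :* b :- :0)) refl a′ b′ c₀ c₁ c₂))
        where
        e : K
        e = c₂ + - b′
        i : Fin 6
        i = proj₁ (nonzero-coordinate y y≢0)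
        ζ≡0 : ζ ≡ 0#
        ζ≡0 = *≡0 (proj₂ (nonzero-coordinate y y≢0)) (trans (*-comm _ ζ)
          (trans (sym (linear i)) (trans (cong (_* mulx y i) ω≡0) (zeroˡ _))))

    powers-indep : ∀ y → ¬ IsZero y → LinIndep (powers y)
    powers-indep y y≢0 a rel = all-zero
      where
      α β γ : K
      α = a zero
      β = a (suc zero)
      γ = a (suc (suc zero))
      γ≡0 : γ ≡ 0#
      γ≡0 with γ ≟ 0#
      ... | yes eq = eq
      ... | no γ≢0 = ⊥-elim (no-quadratic-relation y (- (γ⁻¹ * α)) (- (γ⁻¹ * β)) y≢0 (λ i →
          lincomb₂ γ⁻¹ (- mulx (mulx y) i) (rel i) (*-recip γ≢0)
            (solve 7 (λ α β γ g y t t₂ → t₂ := (:- (g :* α)) :* y :+ (:- (g :* β)) :* t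
                :+ g :* (α :* y :+ (β :* t :+ (γ :* t₂ :+ :0)) :- :0) :+ (:- t₂) :* (γ :* g :- :1)) refl
              α β γ γ⁻¹ (y i) (mulx y i) (mulx (mulx y) i))))
        where
        γ⁻¹ : K
        γ⁻¹ = recip γ≢0
      β≡0 : β ≡ 0#
      β≡0 with β ≟ 0#
      ... | yes eq = eq
      ... | no β≢0 = ⊥-elim (no-eigenvector y (- (β⁻¹ * α)) y≢0 (λ i →
          lincomb₃ β⁻¹ (- mulx y i) (- (β⁻¹ * mulx (mulx y) i)) (rel i) (*-recip β≢0) γ≡0
            (solve 7 (λ α β γ g y t t₂ → t := (:- (g :* α)) :* y
                :+ g :* (α :* y :+ (β :* t :+ (γ :* t₂ :+ :0)) :- :0) :+ (:- t) :* (β :* g :- :1)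
                :+ (:- (g :* t₂)) :* (γ :- :0)) refl
              α β γ β⁻¹ (y i) (mulx y i) (mulx (mulx y) i))))
        where
        β⁻¹ : K
        β⁻¹ = recip β≢0
      i : Fin 6
      i = proj₁ (nonzero-coordinate y y≢0)
      α≡0 : α ≡ 0#
      α≡0 = *≡0 (proj₂ (nonzero-coordinate y y≢0)) (lincomb₃ 1# (- mulx y i) (- mulx (mulx y) i) (rel i) β≡0 γ≡0
        (solve 6 (λ α β γ y t t₂ → y :* α := :0 :+ :1 :* (α :* y :+ (β :* t :+ (γ :* t₂ :+ :0)) :- :0)
            :+ (:- t) :* (β :- :0) :+ (:- t₂) :* (γ :- :0)) refl
          α β γ (y i) (mulx y i) (mulx (mulx y) i)))
      all-zero : ∀ j → a j ≡ 0#
      all-zero zero             = α≡0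
      all-zero (suc zero)       = β≡0
      all-zero (suc (suc zero)) = γ≡0

    mulx-closed : ∀ {w y} → InSpanOf (powers w) y → InSpanOf (powers w) (mulx y)
    mulx-closed {w} {y} (a , y≡) = InSpanOf-resp {u = powers w}
      (λ i → trans (mulx-cong y≡ i) (mulx-comb a (powers w) i))
      (InSpanOf-comb {u = powers w} a (mulx ∘ powers w) member)
      where
      member : ∀ k → InSpanOf (powers w) (mulx (powers w k))
      member zero             = InSpanOf-member (powers w) (suc zero)
      member (suc zero)       = InSpanOf-member (powers w) (suc (suc zero))
      member (suc (suc zero)) = (c₀ ∷ c₁ ∷ c₂ ∷ []) , λ i → trans (mulx³ w i)
        (solve 6 (λ c₀ c₁ c₂ y t t₂ → c₀ :* y :+ (c₁ :* t :+ c₂ :* t₂) := c₀ :* y :+ (c₁ :* t :+ (c₂ :* t₂ :+ :0))) refl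
           c₀ c₁ c₂ (w i) (mulx w i) (mulx (mulx w) i))

    powers-closed : ∀ {w y} → InSpanOf (powers w) y → ∀ k → InSpanOf (powers w) (powers y k)
    powers-closed y∈w zero             = y∈w
    powers-closed y∈w (suc zero)       = mulx-closed y∈w
    powers-closed y∈w (suc (suc zero)) = mulx-closed (mulx-closed y∈w)

    spreadBasis-span : ∀ {w v} → InSpan (spreadBasis w) v →
                       ∃ λ y → InSpanOf (powers w) y × (∀ i → v i ≡ embed y i)
    spreadBasis-span {w} (a , v≡) = comb a (powers w) , (a , λ _ → refl) , λ i →
      trans (v≡ i) (trans (sumF-cong (λ k → cong (a k *_) (spreadBasis≡embed w k i)))
                          (comb-comb a (powers w) b i))

    span-spreadBasis : ∀ {w y} → InSpanOf (powers w) y → InSpan (spreadBasis w) (embed y)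
    span-spreadBasis {w} {y} (a , y≡) = a , λ i →
      trans (sumF-cong (λ j → cong (_* b j i) (y≡ j)))
        (trans (sym (comb-comb a (powers w) b i))
               (sumF-cong (λ k → cong (a k *_) (sym (spreadBasis≡embed w k i)))))

    SpreadPlane-⊆ : ∀ {w w′} → (∀ k → InSpanOf (powers w′) (powers w k)) →
                    ∀ v → SpreadPlane w v → SpreadPlane w′ v
    SpreadPlane-⊆ {w} {w′} sub v (v≢0 , v∈w) = v≢0 ,
      let y , y∈w , v≡ = spreadBasis-span {w} v∈w
      in InSpanOf-resp {u = spreadBasis w′} v≡ (span-spreadBasis {w′} (InSpanOf-trans {u = powers w′} {powers w} sub y∈w))

    embed-injective : ∀ y y′ → (∀ i → embed y i ≡ embed y′ i) → ∀ i → y i ≡ y′ i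
    embed-injective y y′ eq i = a-b≡0⇒a≡b (trans
      (solve 2 (λ y y′ → y :- y′ := y :+ (:- :1) :* y′) refl (y i) (y′ i))
      (b-indep (y ⊕ (- 1#) ⊛ y′) (λ k → trans
         (trans (sumF-cong (λ j → solve 3 (λ y y′ b → (y :+ (:- :1) :* y′) :* b := y :* b :+ (:- :1) :* (y′ :* b)) refl
                  (y j) (y′ j) (b j k)))
           (trans (sumF-+ (λ j → y j * b j k) (λ j → - 1# * (y′ j * b j k)))
             (cong (embed y k +_) (sumF-* (- 1#) (λ j → y′ j * b j k)))))
         (lincomb₁ 1# (eq k) (solve 2 (λ y y′ → y :+ (:- :1) :* y′ := :0 :+ :1 :* (y :- y′)) refl
            (embed y k) (embed y′ k)))) i))

    embed-zero : ∀ y → (∀ i → embed y i ≡ 0#) → IsZero y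
    embed-zero y eq = b-indep y eq

    -- A nonzero y common to two spread elements spans, with its multiples by x,
    -- each of them.
    index-planes-meet : ∀ {w w′ y} → ¬ IsZero y → InSpanOf (powers w) y → InSpanOf (powers w′) y → SamePlane w w′
    index-planes-meet {w} {w′} {y} y≢0 y∈w y∈w′ v = inclusion y∈w y∈w′ v , inclusion y∈w′ y∈w v
      where
      inclusion : ∀ {w w′} → InSpanOf (powers w) y → InSpanOf (powers w′) y →
                  ∀ v → SpreadPlane w v → SpreadPlane w′ v
      inclusion {w} {w′} y∈w y∈w′ = SpreadPlane-⊆ (λ k → InSpanOf-trans {u = powers w′} {powers y} (powers-closed y∈w′)
        (exchange (powers y) (powers w) (powers-indep y y≢0) (powers-closed y∈w) k))

    planes-meet : ∀ {w w′ v} → SpreadPlane w v → SpreadPlane w′ v → SamePlane w w′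
    planes-meet {w} {w′} {v} (v≢0 , v∈w) (_ , v∈w′) =
      let y , y∈w , v≡ = spreadBasis-span {w} v∈w
          y′ , y′∈w′ , v≡′ = spreadBasis-span {w′} v∈w′
          y≡y′ = embed-injective y y′ (λ i → trans (sym (v≡ i)) (v≡′ i))
      in index-planes-meet {w} {w′}
           (λ y≡0 → v≢0 (λ i → trans (v≡ i) (sumF-zero (λ j → trans (cong (_* b j i) (y≡0 j)) (zeroˡ (b j i))))))
           y∈w (InSpanOf-resp {u = powers w′} y≡y′ y′∈w′)

  SamePlane-sym : ∀ {w w′} → SamePlane w w′ → SamePlane w′ w
  SamePlane-sym eq v = proj₂ (eq v) , proj₁ (eq v)

  SamePlane-trans : ∀ {w w′ w″} → SamePlane w w′ → SamePlane w′ w″ → SamePlane w w″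
  SamePlane-trans eq eq′ v = (λ x → proj₁ (eq′ v) (proj₁ (eq v) x)) , (λ x → proj₂ (eq v) (proj₂ (eq′ v) x))

  abstract
    spreadBasis-indep : ∀ w → ValidIdx w → Independent (spreadBasis w)
    spreadBasis-indep w w≢0 a rel = powers-indep w w≢0 a (embed-zero (comb a (powers w)) (λ i →
      trans (sym (comb-comb a (powers w) b i))
        (trans (sumF-cong (λ k → cong (a k *_) (sym (spreadBasis≡embed w k i)))) (rel i))))

    spreadBasis-point : ∀ w → ValidIdx w → ∀ k → SpreadPlane w (spreadBasis w k)
    spreadBasis-point w w≢0 k =
      member-nonzero (spreadBasis w) (spreadBasis-indep w w≢0) k , InSpanOf-member (spreadBasis w) k

    SpreadPlane⇒InSigma : ∀ {w v} → InSpan (spreadBasis w) v → InSigma v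
    SpreadPlane⇒InSigma {w} v∈w = let y , _ , v≡ = spreadBasis-span {w} v∈w in y , v≡

    -- Restricted to Σ∞, `h` is a functional in the coordinates with respect to `b`. The six vectors
    -- of the two planes are independent there, since a relation would produce a common nonzero
    -- vector and `index-planes-meet` would identify the planes.
    distinct-planes-span : ∀ {w w′} → ValidIdx w → ValidIdx w′ → ¬ SamePlane w w′ → ∀ h →
      (∀ k → h ∙ spreadBasis w k ≡ 0#) → (∀ k → h ∙ spreadBasis w′ k ≡ 0#) → ∀ j → h ∙ b j ≡ 0#
    distinct-planes-span {w} {w′} w≢0 w′≢0 distinct h kills kills′ =
      annihilator-trivial (powers w ++ powers w′) independent (λ j → h ∙ b j) (↑-elim 3
        (λ k → trans (cong ((λ j → h ∙ b j) ∙_) (lookup-++ˡ (powers w) (powers w′) k)) (killed {w} kills k))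
        (λ k → trans (cong ((λ j → h ∙ b j) ∙_) (lookup-++ʳ (powers w) (powers w′) k)) (killed {w′} kills′ k)))
      where
      killed : ∀ {w} → (∀ k → h ∙ spreadBasis w k ≡ 0#) → ∀ k → (λ j → h ∙ b j) ∙ powers w k ≡ 0#
      killed {w} kills k = trans (∙-comm (λ j → h ∙ b j) (powers w k))
        (trans (sym (∙-combʳ h (powers w k) b))
          (trans (sym (∙-congʳ h (spreadBasis≡embed w k))) (kills k)))
      independent : LinIndep (powers w ++ powers w′)
      independent a rel = ↑-elim 3 z₁ z₂
        where
        a₁ a₂ : Vect 3
        a₁ j = a (j ↑ˡ 3)
        a₂ j = a (3 ↑ʳ j)
        y : Vect 6
        y = comb a₁ (powers w)
        sum≡0 : ∀ i → y i + comb a₂ (powers w′) i ≡ 0#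
        sum≡0 i = trans (sym (comb-++ a (powers w) (powers w′) i)) (rel i)
        y≡0 : IsZero y
        y≡0 with isZero? y
        ... | yes z = z
        ... | no y≢0 = ⊥-elim (distinct (index-planes-meet {w} {w′} y≢0 (a₁ , λ _ → refl)
              ((- 1#) ⊛ a₂ , λ i → trans
                (lincomb₁ 1# (sum≡0 i) (solve 2 (λ y z → y := (:- :1) :* z :+ :1 :* (y :+ z :- :0)) refl
                   (y i) (comb a₂ (powers w′) i)))
                (trans (sym (sumF-* (- 1#) (λ j → a₂ j * powers w′ j i)))
                       (sumF-cong (λ j → sym (*-assoc (- 1#) (a₂ j) (powers w′ j i))))))))
        z₁ : ∀ j → a₁ j ≡ 0#
        z₁ = powers-indep w w≢0 a₁ y≡0
        z₂ : ∀ j → a₂ j ≡ 0#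
        z₂ = powers-indep w′ w′≢0 a₂ (λ i → trans (sym (+-identityˡ _))
               (trans (cong (_+ comb a₂ (powers w′) i) (sym (y≡0 i))) (sum≡0 i)))

    ∞-equation : ∃ λ h → (∃ λ i → h i ≢ 0#) × (∀ j → h ∙ b j ≡ 0#)
    ∞-equation =
      let h , nonzero , kills = homogeneous-solution 6 b
      in h , nonzero , λ j → trans (∙-comm h (b j)) (kills j)

  h∞ : V7
  h∞ = proj₁ ∞-equation

  abstract
    h∞-kills-b : ∀ j → h∞ ∙ b j ≡ 0#
    h∞-kills-b = proj₂ (proj₂ ∞-equation)

    InSigma⇒h∞≡0 : ∀ {v} → InSigma v → h∞ ∙ v ≡ 0#
    InSigma⇒h∞≡0 = kills-span {u = b} h∞ h∞-kills-b

    affine-basis : ∀ {f : V7} → h∞ ∙ f ≢ 0# → LinIndep (f ∷ b)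
    affine-basis {f} hf≢0 = indep-∷ h∞ {f} {b} hf≢0 h∞-kills-b b-indep

    affine-vector : ∃ λ (f : V7) → h∞ ∙ f ≢ 0#
    affine-vector =
      let i , hᵢ≢0 = proj₁ (proj₂ ∞-equation)
      in δ i , λ eq → hᵢ≢0 (trans (sym (∙-δ i h∞)) (trans (∙-comm (δ i) h∞) eq))

    h∞≡0⇒InSigma : ∀ {v} → h∞ ∙ v ≡ 0# → InSigma v
    h∞≡0⇒InSigma {v} hv≡0 = span-∷-tail h∞ {proj₁ affine-vector} {b} {v} (proj₂ affine-vector)
      h∞-kills-b hv≡0
      (spanning (proj₁ affine-vector ∷ b) (affine-basis (proj₂ affine-vector)) v)

    -- The scalar is chosen so that the difference also vanishes at an affine vector `f`; together
    -- with `b` this is a basis.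
    h∞-unique : ∀ h → (∀ j → h ∙ b j ≡ 0#) → ∃ λ κ → ∀ i → h i ≡ κ * h∞ i
    h∞-unique h kills = κ , λ i → a-b≡0⇒a≡b (trans
        (solve 3 (λ g k h → g :- k :* h := g :+ (:- k) :* h) refl (h i) κ (h∞ i))
        (annihilator-trivial (f ∷ b) (affine-basis hf≢0) g kills-basis i))
      where
      f : V7
      f = proj₁ affine-vector
      hf≢0 : h∞ ∙ f ≢ 0#
      hf≢0 = proj₂ affine-vector
      inv : ∃ λ i → h∞ ∙ f * i ≡ 1#
      inv = inverse (h∞ ∙ f) hf≢0
      κ : K
      κ = h ∙ f * proj₁ inv
      g : V7
      g = h ⊕ (- κ) ⊛ h∞
      g∙ : ∀ v → g ∙ v ≡ h ∙ v + - κ * h∞ ∙ v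
      g∙ v = trans (∙-⊕ˡ h ((- κ) ⊛ h∞) v) (cong (h ∙ v +_) (∙-⊛ˡ (- κ) h∞ v))
      kills-basis : ∀ j → g ∙ (f ∷ b) j ≡ 0#
      kills-basis zero = trans (g∙ f) (lincomb₁ (- (h ∙ f)) (proj₂ inv)
        (solve 3 (λ a b i → a :+ (:- (a :* i)) :* b := :0 :+ (:- a) :* (b :* i :- :1)) refl
           (h ∙ f) (h∞ ∙ f) (proj₁ inv)))
      kills-basis (suc j) = trans (g∙ (b j)) (lincomb₂ 1# (- κ) (kills j) (h∞-kills-b j)
        (solve 3 (λ a b k → a :+ (:- k) :* b := :0 :+ :1 :* (a :- :0) :+ (:- k) :* (b :- :0)) refl
           (h ∙ b j) (h∞ ∙ b j) κ))

    h∞-kills-spreadBasis : ∀ w k → h∞ ∙ spreadBasis w k ≡ 0#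
    h∞-kills-spreadBasis w k = InSigma⇒h∞≡0 (powers w k , spreadBasis≡embed w k)

    join-indep : ∀ {f w} → h∞ ∙ f ≢ 0# → ValidIdx w → Independent (f ∷ spreadBasis w)
    join-indep {f} {w} hf≢0 w≢0 =
      indep-∷ h∞ {f} {spreadBasis w} hf≢0 (h∞-kills-spreadBasis w) (spreadBasis-indep w w≢0)

    join-at-infinity : ∀ {f w} → h∞ ∙ f ≢ 0# →
      (λ v → SubspacePts (f ∷ spreadBasis w) v × InSigma v) ≐ SpreadPlane w
    join-at-infinity {f} {w} hf≢0 v =
      (λ { ((v≢0 , v∈U) , v∈Σ) → v≢0 , span-∷-tail h∞ {f} {spreadBasis w} {v} hf≢0 (h∞-kills-spreadBasis w)
                                           (InSigma⇒h∞≡0 {v} v∈Σ) v∈U }) ,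
      (λ { (v≢0 , v∈w) → (v≢0 , InSpanOf-∷ f {spreadBasis w} {v} v∈w) , SpreadPlane⇒InSigma {w} {v} v∈w })

  join-valid : ∀ {f w} → h∞ ∙ f ≢ 0# → ValidIdx w → ValidLine (inj₁ (f ∷ spreadBasis w))
  join-valid {f} {w} hf≢0 w≢0 = join-indep {f} {w} hf≢0 w≢0 , w , w≢0 , join-at-infinity {f} {w} hf≢0

-- The surface in Bruck-Bose position.

module Placement (F : FiniteField) (6≤q : 6 ≤ FiniteField.q F)
                 (b : Fin 6 → Fin 7 → FiniteField.K F) (b-indep : Geometry.Independent F b)
                 (c : Fin 3 → FiniteField.K F) (irreducible : Geometry.IrreducibleCubic F c)
                 (p : Fin 3 → Fin 7 → FiniteField.K F) (r : Fin 4 → Fin 7 → FiniteField.K F)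
                 (φ : Geometry.Projectivity F)
                 (indep : Geometry.Independent F (p ++ r)) where
  open Sections F 6≤q p r φ indep public
  open SpreadGeometry F c irreducible b b-indep public
  open Spread c b public
  open Positioned c b p r φ public
  open ≡-Reasoning

  ConicAtInfinity : Set
  ConicAtInfinity = (λ v → IsPoint v × InV v × InSigma v) ≐ InConic

  10-paramOK : ParamOK 1# 0#
  10-paramOK = 1-paramOK

  01-paramOK : ParamOK 0# 1#
  01-paramOK (_ , 1≡0) = 0≢1 (sym 1≡0)

  abstract
    p-indep : Independent p
    p-indep a rel j = trans (sym (lookup-++ˡ a z j)) (indep (a ++ z) (λ i →
        trans (comb-++ (a ++ z) p r i) (trans (cong₂ _+_
          (trans (sumF-cong (λ j → cong (_* p j i) (lookup-++ˡ a z j))) (rel i))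
          (sumF-zero (λ j → trans (cong (_* r j i) (lookup-++ʳ a z j)) (zeroˡ _)))) (+-identityˡ _))) (j ↑ˡ 4))
      where
      z : Vect 4
      z _ = 0#

    C-isPoint : ∀ {s t} → ParamOK s t → IsPoint (C s t)
    C-isPoint ok = let h , Qh≢0 , _ = C-functional ok in ∙-nonzero⇒point {h} Qh≢0

    N-isPoint : ∀ {s t} → ParamOK s t → IsPoint (N s t)
    N-isPoint ok = let h , Rh≢0 , _ = N-functional ok in ∙-nonzero⇒point {h} Rh≢0

    C-InConic : ∀ {s t} → ParamOK s t → InConic (C s t)
    C-InConic {s} {t} ok = C-isPoint ok , s , t , ok , 1# , (λ 1≡0 → 0≢1 (sym 1≡0)) ,
      λ i → trans (cong (λ v → v i) (C≡nrcPt s t)) (sym (*-identityˡ _))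

    generator-InV : ∀ {s t v} → ParamOK s t → IsPoint v → OnGenerator s t v → InV v
    generator-InV {s} {t} {v} ok v≢0 on = s , t , ok , v≢0 , OnGenerator⇒span s t v on

    N-on-generator : ∀ s t → OnGenerator s t (N s t)
    N-on-generator s t = 0# , 1# , λ i → solve 2 (λ c n → n := :0 :* c :+ :1 :* n) refl (C s t i) (N s t i)

    -- The cubic form is the linear form of (s : t) times a quadratic form that is nonzero at (s′,
    -- t′). The condition Q h = 0 makes `h` a functional modulo the plane of the conic.
    separating-N : ∀ {s t s′ t′} → ParamOK s′ t′ →
      ∃ λ h → Q h ≗₂ 𝟎 × R h s t ≡ 0# × (R h s′ t′ ≡ 0# → lin s t s′ t′ ≡ 0#)
    separating-N {s} {t} {s′} {t′} ok′ = separates (nonvanishing-form 2 ok′)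
      where
      separates : (∃ λ G → Form 2 G × G s′ t′ ≢ 0#) →
                  ∃ λ h → Q h ≗₂ 𝟎 × R h s t ≡ 0# × (R h s′ t′ ≡ 0# → lin s t s′ t′ ≡ 0#)
      separates (G , fG , G≢0) with functional-with (Form-scale 0# fG) (Form-⊗ (Form-lin s t) fG)
      ... | (h , Q≡ , R≡) = h , (λ s t → trans (Q≡ s t) (zeroˡ _)) ,
         trans (R≡ s t) (trans (cong (_* G s t) (lin-self s t)) (zeroˡ _)) ,
         λ eq → *≡0 G≢0 (trans (*-comm _ _) (trans (sym (R≡ s′ t′)) eq))

    separating-C : ∀ {s t s′ t′} → ParamOK s′ t′ →
      ∃ λ h → Q h s t ≡ 0# × (Q h s′ t′ ≡ 0# → lin s t s′ t′ ≡ 0#)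
    separating-C {s} {t} {s′} {t′} ok′ = separates (nonvanishing-form 1 ok′) (nonvanishing-form 3 ok′)
      where
      separates : (∃ λ G → Form 1 G × G s′ t′ ≢ 0#) → (∃ λ H → Form 3 H × H s′ t′ ≢ 0#) →
                  ∃ λ h → Q h s t ≡ 0# × (Q h s′ t′ ≡ 0# → lin s t s′ t′ ≡ 0#)
      separates (G , fG , G≢0) (H , fH , _) with functional-with (Form-⊗ (Form-lin s t) fG) fH
      ... | (h , Q≡ , _) = h , trans (Q≡ s t) (trans (cong (_* G s t) (lin-self s t)) (zeroˡ _)) ,
         λ eq → *≡0 G≢0 (trans (*-comm _ _) (trans (sym (Q≡ s′ t′)) eq))

  -- The plane α and the lines of the subplane through it.

  module Subplane (wα : Fin 6 → K) (wα≢0 : ValidIdx wα)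
                  (conic-at-infinity : ConicAtInfinity)
                  (conic⊆α : ∀ v → InConic v → SpreadPlane wα v)
                  (subplane : IsSubplaneOfOrder (Bset wα) q) where
    abstract
      C∈Σ : ∀ {s t} → ParamOK s t → h∞ ∙ C s t ≡ 0#
      C∈Σ ok = InSigma⇒h∞≡0 (proj₂ (proj₂ (proj₂ (conic-at-infinity _) (C-InConic ok))))

      Q∞≡0 : Q h∞ ≗₂ 𝟎
      Q∞≡0 = vanishing 3≤q (Form-Q h∞) (λ x → C∈Σ 1-paramOK)

      -- A point of the twisted cubic at infinity would belong to the conic, although some
      -- functional vanishes on the whole conic and not at this point.
      R∞≢0 : ∀ {s t} → ParamOK s t → R h∞ s t ≢ 0#
      R∞≢0 {s} {t} ok R≡0 with proj₁ (conic-at-infinity (N s t))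
        (N-isPoint ok , generator-InV ok (N-isPoint ok) (N-on-generator s t) , h∞≡0⇒InSigma R≡0)
      ... | (_ , a , a′ , _ , κ , _ , N≡) =
        let h , Rh≢0 , Qh≡0 = N-functional ok
        in Rh≢0 (trans (∙-congʳ h N≡) (trans (∙-⊛ʳ h κ (nrcPt 2 p a a′)) (trans
             (cong (κ *_) (trans (cong (h ∙_) (sym (C≡nrcPt a a′))) (Qh≡0 a a′))) (zeroʳ κ))))

      C∈α : ∀ {s t} → ParamOK s t → SpreadPlane wα (C s t)
      C∈α ok = conic⊆α _ (C-InConic ok)

      nrcPt∈α : ∀ {s t} → ParamOK s t → InSpan (spreadBasis wα) (nrcPt 2 p s t)
      nrcPt∈α {s} {t} ok = subst (InSpan (spreadBasis wα)) (C≡nrcPt s t) (proj₂ (C∈α ok))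

      -- The vectors of `p` are recovered from conic points: `p` 0 = C(1, 0), `p` 2 = C(0, 1) and
      -- `p` 1 = C(1, 1) - `p` 0 - `p` 2.
      p∈α : ∀ j → InSpan (spreadBasis wα) (p j)
      p∈α zero = InSpanOf-resp {u = spreadBasis wα}
        (λ i → solve 3 (λ x y z → x := (:1 :* (:1 :* :1)) :* :1 :* x :+ ((:1 :* :1) :* (:0 :* :1) :* y :+ (:1 :* (:0 :* (:0 :* :1)) :* z :+ :0)))
                 refl (p zero i) (p (suc zero) i) (p (suc (suc zero)) i))
        (nrcPt∈α 10-paramOK)
      p∈α (suc (suc zero)) = InSpanOf-resp {u = spreadBasis wα}
        (λ i → solve 3 (λ x y z → z := (:0 :* (:0 :* :1)) :* :1 :* x :+ ((:0 :* :1) :* (:1 :* :1) :* y :+ (:1 :* (:1 :* (:1 :* :1)) :* z :+ :0)))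
                 refl (p zero i) (p (suc zero) i) (p (suc (suc zero)) i))
        (nrcPt∈α 01-paramOK)
      p∈α (suc zero) = InSpanOf-resp {u = spreadBasis wα}
        (λ i → solve 3 (λ x y z → y := (:1 :* (:1 :* :1)) :* :1 :* x :+ ((:1 :* :1) :* (:1 :* :1) :* y :+ (:1 :* (:1 :* (:1 :* :1)) :* z :+ :0))
                                        :+ (:- :1) :* (x :+ z))
                 refl (p zero i) (p (suc zero) i) (p (suc (suc zero)) i))
        (InSpanOf-⊕ {u = spreadBasis wα} (nrcPt∈α (1-paramOK {1#}))
          (InSpanOf-⊛ {u = spreadBasis wα} (- 1#) (InSpanOf-⊕ {u = spreadBasis wα} (p∈α zero) (p∈α (suc (suc zero))))))

      Q≡0⇒kills-α : ∀ h → Q h ≗₂ 𝟎 → ∀ k → h ∙ spreadBasis wα k ≡ 0#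
      Q≡0⇒kills-α h Q≡0 = kills-exchange p (spreadBasis wα) p-indep p∈α h (Q≡0⇒kills-p h Q≡0)

      affine-generator-point : ∀ {s t v} x y → (∀ i → v i ≡ (x ⊛ C s t ⊕ y ⊛ N s t) i) → h∞ ∙ v ≢ 0# → y ≢ 0#
      affine-generator-point {s} {t} {v} x y v≡ hv≢0 y≡0 = hv≢0 (trans (∙-generator h∞ x y v≡)
        (trans (cong₂ (λ z y → x * z + y * R h∞ s t) (Q∞≡0 s t) y≡0)
          (solve 2 (λ x r → x :* :0 :+ :0 :* r := :0) refl x (R h∞ s t))))

    -- The line of the Bruck-Bose plane that joins α to `N s t`. As `C s t` lies in α, it contains
    -- the whole generator.
    joinα : K → K → Fin 4 → V7
    joinα s t = N s t ∷ spreadBasis wα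

    joinα-valid : ∀ {s t} → ParamOK s t → ValidLine (inj₁ (joinα s t))
    joinα-valid {s} {t} ok = join-valid {N s t} {wα} (R∞≢0 ok) wα≢0

    abstract
      SamePlane-refl : ∀ w → SamePlane w w
      SamePlane-refl w v = (λ x → x) , (λ x → x)

      spreadPlane⊆line : ∀ {U w} → ((λ v → SubspacePts U v × InSigma v) ≐ SpreadPlane w) →
                         ∀ {w′} → SamePlane w′ w → Inc (inj₂ w′) (inj₁ U)
      spreadPlane⊆line eq same v v∈w′ = proj₂ (proj₁ (proj₂ (eq v) (proj₁ (same v) v∈w′)))

      -- Spread elements with a common point coincide, so it is enough to follow one basis vector of
      -- `w′`.
      line-at-infinity : ∀ {U w} → ((λ v → SubspacePts U v × InSigma v) ≐ SpreadPlane w) →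
                         ∀ {w′} → ValidIdx w′ → Inc (inj₂ w′) (inj₁ U) → SamePlane w′ w
      line-at-infinity {U} {w} eq {w′} w′≢0 inc = meet (spreadBasis-point w′ w′≢0 zero)
        where
        meet : ∀ {v} → SpreadPlane w′ v → SamePlane w′ w
        meet {v} v∈w′ = planes-meet {w′} {w} {v} v∈w′
          (proj₁ (eq v) ((proj₁ v∈w′ , inc v v∈w′) , SpreadPlane⇒InSigma {w′} {v} (proj₂ v∈w′)))

      affine-BP : ∀ {v} → InV v → h∞ ∙ v ≢ 0# → BP (Bset wα) (inj₁ v)
      affine-BP {v} v∈V hv≢0 = (∙-nonzero⇒point {h∞} hv≢0 , λ v∈Σ → hv≢0 (InSigma⇒h∞≡0 v∈Σ)) , v∈V

      join-twoOn : ∀ {f} → InV f → h∞ ∙ f ≢ 0# → TwoOn (Bset wα) (inj₁ (f ∷ spreadBasis wα))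
      join-twoOn {f} f∈V hf≢0 = inj₁ f , inj₂ wα , affine-BP f∈V hf≢0 , (wα≢0 , SamePlane-refl wα) , (λ ()) ,
        InSpanOf-member (f ∷ spreadBasis wα) zero ,
        spreadPlane⊆line {f ∷ spreadBasis wα} {wα} (join-at-infinity {f} {wα} hf≢0) {wα} (SamePlane-refl wα)

      joinα-twoOn : ∀ {s t} → ParamOK s t → TwoOn (Bset wα) (inj₁ (joinα s t))
      joinα-twoOn {s} {t} ok = join-twoOn {N s t} (generator-InV ok (N-isPoint ok) (N-on-generator s t)) (R∞≢0 ok)

      -- Modulo α the points of V are points of the twisted cubic, and distinct
      -- ones are independent.
      generator-of-joinα-point : ∀ {s t v} → ParamOK s t → h∞ ∙ v ≢ 0# → InV v → InSpan (joinα s t) v →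
                                 OnGenerator s t v
      generator-of-joinα-point {s} {t} {v} ok hv≢0 (s′ , t′ , ok′ , _ , v∈gen) (a , v≡) =
        same-generator (span⇒OnGenerator s′ t′ v v∈gen) (separating-N {s} {t} ok′)
        where
        same-generator : OnGenerator s′ t′ v →
          (∃ λ h → Q h ≗₂ 𝟎 × R h s t ≡ 0# × (R h s′ t′ ≡ 0# → lin s t s′ t′ ≡ 0#)) → OnGenerator s t v
        same-generator (x , y , v≡′) (h , Qh≡0 , Rst≡0 , separates) =
          rescale (lin≡0⇒∼₂ ok ok′ (separates (*≡0 (affine-generator-point x y v≡′ hv≢0) yR≡0)))
          where
          h·v≡0 : h ∙ v ≡ 0#
          h·v≡0 = trans (∙-congʳ h v≡) (trans (∙-comb-∷ h a (N s t) (spreadBasis wα) (Q≡0⇒kills-α h Qh≡0))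
            (trans (cong (a zero *_) Rst≡0) (zeroʳ (a zero))))
          yR≡0 : y * R h s′ t′ ≡ 0#
          yR≡0 = begin
            y * R h s′ t′
              ≡⟨ solve 2 (λ x z → z := x :* :0 :+ z) refl x (y * R h s′ t′) ⟩
            x * 0# + y * R h s′ t′
              ≡⟨ cong (λ z → x * z + y * R h s′ t′) (sym (Qh≡0 s′ t′)) ⟩
            x * Q h s′ t′ + y * R h s′ t′
              ≡⟨ sym (∙-generator h x y v≡′) ⟩
            h ∙ v
              ≡⟨ h·v≡0 ⟩
            0# ∎
          rescale : (s , t) ∼₂ (s′ , t′) → OnGenerator s t v
          rescale (κ , _ , s′≡ , t′≡) = OnGenerator-scale κ s′≡ t′≡ v (x , y , v≡′)

    -- Lines of the subplane not through α.

    module SubplaneLine (U : Fin 4 → V7) (valid : ValidLine (inj₁ U)) (two : TwoOn (Bset wα) (inj₁ U))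
                        (α∉U : ¬ Inc (inj₂ wα) (inj₁ U)) where
      w : Fin 6 → K
      w = proj₁ (proj₂ valid)
      w≢0 : ValidIdx w
      w≢0 = proj₁ (proj₂ (proj₂ valid))
      U∩Σ : (λ v → SubspacePts U v × InSigma v) ≐ SpreadPlane w
      U∩Σ = proj₂ (proj₂ (proj₂ valid))
      U-indep : Independent U
      U-indep = proj₁ valid

      Kills : V7 → Set
      Kills h = ∀ j → h ∙ U j ≡ 0#

      abstract
        w≁α : ¬ SamePlane w wα
        w≁α same = α∉U (spreadPlane⊆line {U} {w} U∩Σ {wα} (SamePlane-sym {w} {wα} same))

        -- `U` and the join of α with `N s t` are lines of the subplane, distinct because only `U`
        -- contains the spread element `w`, so they meet in a point of the subplane. It is not α,
        -- which is off `U`; it is therefore an affine point of the generator.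
        meets-generator : ∀ {s t} → ParamOK s t →
          ∃₂ λ x y → y ≢ 0# × InSpan U (x ⊛ C s t ⊕ y ⊛ N s t)
        meets-generator {s} {t} ok = from-point (proj₁ (proj₂ subplane) (inj₁ U) (inj₁ (joinα s t)) valid
          (joinα-valid ok) two (joinα-twoOn ok)
          (inj₂ w , w≢0 , spreadPlane⊆line {U} {w} U∩Σ {w} (SamePlane-refl w) ,
           λ inc → w≁α (line-at-infinity {joinα s t} {wα} (join-at-infinity {N s t} {wα} (R∞≢0 ok)) {w} w≢0 inc)))
          where
          from-point : (∃ λ x → BP (Bset wα) x × Inc x (inj₁ U) × Inc x (inj₁ (joinα s t))) →
                       ∃₂ λ x y → y ≢ 0# × InSpan U (x ⊛ C s t ⊕ y ⊛ N s t)
          from-point (inj₁ v , ((v≢0 , v∉Σ) , v∈V) , v∈U , v∈M) =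
            from-generator (generator-of-joinα-point ok hv≢0 v∈V v∈M)
            where
            hv≢0 : h∞ ∙ v ≢ 0#
            hv≢0 eq = v∉Σ (h∞≡0⇒InSigma eq)
            from-generator : OnGenerator s t v → ∃₂ λ x y → y ≢ 0# × InSpan U (x ⊛ C s t ⊕ y ⊛ N s t)
            from-generator (x , y , v≡) =
              x , y , affine-generator-point x y v≡ hv≢0 , InSpanOf-resp {u = U} (λ i → sym (v≡ i)) v∈U
          from-point (inj₂ w′ , (_ , same) , w′∈U , _) =
            ⊥-elim (α∉U (λ v v∈α → w′∈U v (proj₂ (same v) v∈α)))

        -- A vector in the span of both `U` and `p` would lie in the two distinct spread elements
        -- `w` and α.
        Up-indep : LinIndep (U ++ p)
        Up-indep a rel = all-zero (isZero? v)
          where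
          a₁ : Vect 4
          a₁ j = a (j ↑ˡ 3)
          a₂ : Vect 3
          a₂ j = a (4 ↑ʳ j)
          v : V7
          v = comb a₁ U
          sum≡0 : ∀ i → v i + comb a₂ p i ≡ 0#
          sum≡0 i = trans (sym (comb-++ a U p i)) (rel i)
          all-zero : Dec (IsZero v) → ∀ j → a j ≡ 0#
          all-zero (yes v≡0) = ↑-elim 4 (U-indep a₁ v≡0) (p-indep a₂ (λ i → trans (sym (+-identityˡ _))
            (trans (cong (_+ comb a₂ p i) (sym (v≡0 i))) (sum≡0 i))))
          all-zero (no v≢0) = ⊥-elim (w≁α (planes-meet {w} {wα} {v}
              (proj₁ (U∩Σ v) ((v≢0 , a₁ , λ _ → refl) , SpreadPlane⇒InSigma {wα} {v} v∈α)) (v≢0 , v∈α)))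
            where
            v∈α : InSpan (spreadBasis wα) v
            v∈α = InSpanOf-resp {u = spreadBasis wα}
              (λ i → lincomb₁ 1# (sum≡0 i) (solve 2 (λ v x → v := (:- :1) :* x :+ :1 :* (v :+ x :- :0)) refl (v i) (comb a₂ p i)))
              (InSpanOf-⊛ {u = spreadBasis wα} (- 1#) (InSpanOf-comb {u = spreadBasis wα} a₂ p p∈α))

        -- `U ++ p` is a basis, so a functional can vanish on `U` and take any values on the plane
        -- of the conic: the hyperplanes through `U` realise every quadratic form as their Q.
        killing-functional : ∀ {A} → Form 2 A → ∃ λ h → Kills h × Q h ≗₂ A
        killing-functional {A} fA = h ,
            (λ j → trans (cong (h ∙_) (sym (lookup-++ˡ U p j))) (trans (values (j ↑ˡ 3)) (lookup-++ˡ z f j))) ,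
             λ s t → trans (trans (cong (h ∙_) (C≡nrcPt s t)) (∙-nrcPt 2 p h s t)) (trans
               (sumF-cong (λ j → cong (((s ^ (2 ∸ toℕ j)) * (t ^ toℕ j)) *_)
                 (trans (cong (h ∙_) (sym (lookup-++ʳ U p j))) (trans (values (4 ↑ʳ j)) (lookup-++ʳ z f j)))))
               (sym (proj₂ (coefficients fA) s t)))
          where
          z : Vect 4
          z _ = 0#
          f : Vect 3
          f = proj₁ (coefficients fA)
          solution : ∃ λ h → ∀ j → h ∙ (U ++ p) j ≡ (z ++ f) j
          solution = dual-solution refl (U ++ p) Up-indep (z ++ f)
          h : V7
          h = proj₁ solution
          values : ∀ j → h ∙ (U ++ p) j ≡ (z ++ f) j
          values = proj₂ solution

        -- On each generator `U` has a point x C + y N with y ≠ 0, and both (Q g, R g) and (Q h, R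
        -- h) are orthogonal to (x, y). Their determinant vanishes at the q points (1, z), which is
        -- enough for a form of degree 5.
        cross : ∀ g h → Kills g → Kills h → R g ⊗ Q h ≗₂ R h ⊗ Q g
        cross g h kg kh s t = a-b≡0⇒a≡b (vanishing 6≤q
          (Form-⊟ (Form-⊗ (Form-R g) (Form-Q h)) (Form-⊗ (Form-R h) (Form-Q g))) at s t)
          where
          at : ∀ z → R g 1# z * Q h 1# z + - (R h 1# z * Q g 1# z) ≡ 0#
          at z = from-point (meets-generator (1-paramOK {z}))
            where
            from-point : (∃₂ λ x y → y ≢ 0# × InSpan U (x ⊛ C 1# z ⊕ y ⊛ N 1# z)) →
                         R g 1# z * Q h 1# z + - (R h 1# z * Q g 1# z) ≡ 0#
            from-point (x , y , y≢0 , v∈U) = *≡0 y≢0 (lincomb₂ (Q h 1# z) (- Q g 1# z)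
              (trans (sym (∙-generator g x y (λ _ → refl))) (kills-span {u = U} g kg v∈U))
              (trans (sym (∙-generator h x y (λ _ → refl))) (kills-span {u = U} h kh v∈U))
              (solve 6 (λ x y qg qh rg rh → y :* (rg :* qh :- rh :* qg)
                 := :0 :+ qh :* (x :* qg :+ y :* rg :- :0) :+ (:- qg) :* (x :* qh :+ y :* rh :- :0)) refl
                 x y (Q g 1# z) (Q h 1# z) (R g 1# z) (R h 1# z)))

        -- For g, h killing U with Q g = s² and Q h = t², the identity
        -- R g · t² = R h · s² forces R g = s² l.  Here s and t are written as the
        -- forms lin 0# 1# and lin (- 1#) 0#.
        common-linear-factor : ∃ λ l → Form 1 l × (∀ h → Kills h → R h ≗₂ l ⊗ Q h)
        common-linear-factor = l , fl , λ h kh →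
            cancel-lin-eq 5≤q (Form-R h) (Form-⊗ fl (Form-Q h)) 01-paramOK
              (cancel-lin-eq 6≤q (Form-⊗ (Form-lin 0# 1#) (Form-R h))
                 (Form-⊗ (Form-lin 0# 1#) (Form-⊗ fl (Form-Q h))) 01-paramOK (λ s t → begin
                   σ s t * (σ s t * R h s t)
                     ≡⟨ solve 2 (λ σ x → σ :* (σ :* x) := x :* (σ :* σ)) refl (σ s t) (R h s t) ⟩
                   R h s t * (σ s t * σ s t)        ≡⟨ cong (R h s t *_) (sym (Qg≡ s t)) ⟩
                   R h s t * Q g s t                ≡⟨ cross h g kh kg s t ⟩
                   R g s t * Q h s t                ≡⟨ cong (_* Q h s t) (trans (G≡ s t) (cong (σ s t *_) (l≡ s t))) ⟩
                   σ s t * (σ s t * l s t) * Q h s t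
                     ≡⟨ solve 3 (λ σ l x → σ :* (σ :* l) :* x := σ :* (σ :* (l :* x))) refl (σ s t) (l s t) (Q h s t) ⟩
                   σ s t * (σ s t * (l s t * Q h s t)) ∎))
          where
          σ τ : Fun
          σ = lin 0# 1#
          τ = lin (- 1#) 0#
          kg′ : ∃ λ g → Kills g × Q g ≗₂ σ ⊗ σ
          kg′ = killing-functional (Form-⊗ (Form-lin 0# 1#) (Form-lin 0# 1#))
          kh′ : ∃ λ g → Kills g × Q g ≗₂ τ ⊗ τ
          kh′ = killing-functional (Form-⊗ (Form-lin (- 1#) 0#) (Form-lin (- 1#) 0#))
          g h₂ : V7
          g = proj₁ kg′
          h₂ = proj₁ kh′
          kg : Kills g
          kg = proj₁ (proj₂ kg′)
          Qg≡ : Q g ≗₂ σ ⊗ σ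
          Qg≡ = proj₂ (proj₂ kg′)
          τ01≡1 : τ 0# 1# ≡ 1#
          τ01≡1 = solve 0 (:0 :* :0 :- :1 :* (:- :1) := :1) refl
          crossed : ∀ s t → R g s t * (τ s t * τ s t) ≡ R h₂ s t * (σ s t * σ s t)
          crossed s t = trans (cong (R g s t *_) (sym (proj₂ (proj₂ kh′) s t)))
            (trans (cross g h₂ kg (proj₁ (proj₂ kh′)) s t) (cong (R h₂ s t *_) (Qg≡ s t)))
          vanish-at-01 : ∀ {x y} → x * (τ 0# 1# * τ 0# 1#) ≡ y → y ≡ 0# → x ≡ 0#
          vanish-at-01 {x} eq y≡0 = trans (trans (solve 1 (λ x → x := x :* (:1 :* :1)) refl x)
            (cong (λ z → x * (z * z)) (sym τ01≡1))) (trans eq y≡0)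
          G-factor : ∃ λ G → Form 2 G × R g ≗₂ σ ⊗ G
          G-factor = factor (Form-R g) 01-paramOK (vanish-at-01 (crossed 0# 1#)
            (trans (cong (λ z → R h₂ 0# 1# * (z * z)) (lin-self 0# 1#)) (solve 1 (λ x → x :* (:0 :* :0) := :0) refl (R h₂ 0# 1#))))
          G : Fun
          G = proj₁ G-factor
          fG : Form 2 G
          fG = proj₁ (proj₂ G-factor)
          G≡ : R g ≗₂ σ ⊗ G
          G≡ = proj₂ (proj₂ G-factor)
          G-crossed : G ⊗ (τ ⊗ τ) ≗₂ σ ⊗ R h₂
          G-crossed = cancel-lin-eq 6≤q (Form-⊗ fG (Form-⊗ (Form-lin (- 1#) 0#) (Form-lin (- 1#) 0#)))
            (Form-⊗ (Form-lin 0# 1#) (Form-R h₂)) 01-paramOK (λ s t → begin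
              σ s t * (G s t * (τ s t * τ s t)) ≡⟨ sym (*-assoc _ _ _) ⟩
              σ s t * G s t * (τ s t * τ s t)   ≡⟨ cong (_* (τ s t * τ s t)) (sym (G≡ s t)) ⟩
              R g s t * (τ s t * τ s t)         ≡⟨ crossed s t ⟩
              R h₂ s t * (σ s t * σ s t)
                ≡⟨ solve 2 (λ σ x → x :* (σ :* σ) := σ :* (σ :* x)) refl (σ s t) (R h₂ s t) ⟩
              σ s t * (σ s t * R h₂ s t) ∎)
          l-factor : ∃ λ l → Form 1 l × G ≗₂ σ ⊗ l
          l-factor = factor fG 01-paramOK (vanish-at-01 (G-crossed 0# 1#)
            (trans (cong (_* R h₂ 0# 1#) (lin-self 0# 1#)) (zeroˡ _)))
          l : Fun
          l = proj₁ l-factor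
          fl : Form 1 l
          fl = proj₁ (proj₂ l-factor)
          l≡ : G ≗₂ σ ⊗ l
          l≡ = proj₂ (proj₂ l-factor)

    -- The pencil of hyperplanes through π and ℓ.

    module Pencil (ℓ : Fin 2 → V7) (ℓ-indep : Independent ℓ)
                  (ℓ⊂α : ∀ v → SubspacePts ℓ v → SpreadPlane wα v)
                  (wπ : Fin 6 → K) (wπ≢0 : ValidIdx wπ) (π≁α : ¬ SamePlane wπ wα) where
      f : V7
      f = proj₁ affine-vector

      -- The conditions on `h₀`: three for π, two for ℓ, and one at the affine vector `f`, which
      -- keeps a nonzero solution from being a multiple of `h∞`.
      rows : Fin 6 → V7
      rows = f ∷ (spreadBasis wπ ++ ℓ)

      abstract
        ℓ∈α : ∀ k → InSpan (spreadBasis wα) (ℓ k)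
        ℓ∈α k = proj₂ (ℓ⊂α (ℓ k) (member-nonzero ℓ ℓ-indep k , InSpanOf-member ℓ k))

        h∞-kills-ℓ : ∀ k → h∞ ∙ ℓ k ≡ 0#
        h∞-kills-ℓ k = InSigma⇒h∞≡0 {ℓ k} (SpreadPlane⇒InSigma {wα} {ℓ k} (ℓ∈α k))

        base : ∃ λ h → (∃ λ i → h i ≢ 0#) × (∀ j → rows j ∙ h ≡ 0#)
        base = homogeneous-solution 6 rows

      h₀ : V7
      h₀ = proj₁ base

      abstract
        h₀-kills-rows : ∀ j → h₀ ∙ rows j ≡ 0#
        h₀-kills-rows j = trans (∙-comm h₀ (rows j)) (proj₂ (proj₂ base) j)

        h₀-kills-π : ∀ k → h₀ ∙ spreadBasis wπ k ≡ 0#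
        h₀-kills-π k = trans (cong (h₀ ∙_) (sym (lookup-++ˡ (spreadBasis wπ) ℓ k))) (h₀-kills-rows (suc (k ↑ˡ 2)))

        h₀-kills-ℓ : ∀ k → h₀ ∙ ℓ k ≡ 0#
        h₀-kills-ℓ k = trans (cong (h₀ ∙_) (sym (lookup-++ʳ (spreadBasis wπ) ℓ k))) (h₀-kills-rows (suc (3 ↑ʳ k)))

        h₀-not-at-infinity : ¬ (∀ j → h₀ ∙ b j ≡ 0#)
        h₀-not-at-infinity kills = proj₂ (proj₁ (proj₂ base))
          (annihilator-trivial (f ∷ b) (affine-basis {f} (proj₂ affine-vector)) h₀
             (∷-kills {h = h₀} {f} {b} (h₀-kills-rows zero) kills) _)

        kills-α-π⇒at-infinity : ∀ h → (∀ k → h ∙ spreadBasis wα k ≡ 0#) → (∀ k → h ∙ spreadBasis wπ k ≡ 0#) →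
                                ∀ j → h ∙ b j ≡ 0#
        kills-α-π⇒at-infinity h kα kπ = distinct-planes-span {wπ} {wα} wπ≢0 wα≢0 π≁α h kπ kα

        -- If Q h₀ were zero, `h₀` would contain α as well as π, and these span Σ∞.
        Q₀-nonroot : ∃ λ x → Q h₀ 1# x ≢ 0#
        Q₀-nonroot = [ (λ Q≡0 → ⊥-elim (h₀-not-at-infinity
                         (kills-α-π⇒at-infinity h₀ (Q≡0⇒kills-α h₀ Q≡0) h₀-kills-π))) , (λ x → x) ]′
                       (nonroot? 3≤q (Form-Q h₀))

      x₀ : K
      x₀ = proj₁ Q₀-nonroot

      -- A conic point off `h₀`; together with ℓ it spans α.
      e : V7
      e = C 1# x₀

      abstract
        Q₀x₀≢0 : Q h₀ 1# x₀ ≢ 0#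
        Q₀x₀≢0 = proj₂ Q₀-nonroot

        eℓ-indep : LinIndep (e ∷ ℓ)
        eℓ-indep = indep-∷ h₀ {e} {ℓ} Q₀x₀≢0 h₀-kills-ℓ ℓ-indep

        eℓ∈α : ∀ k → InSpan (spreadBasis wα) ((e ∷ ℓ) k)
        eℓ∈α zero    = proj₂ (C∈α 1-paramOK)
        eℓ∈α (suc k) = ℓ∈α k

        kills-eℓ⇒kills-α : ∀ h → h ∙ e ≡ 0# → (∀ k → h ∙ ℓ k ≡ 0#) → ∀ k → h ∙ spreadBasis wα k ≡ 0#
        kills-eℓ⇒kills-α h he hℓ = kills-exchange (e ∷ ℓ) (spreadBasis wα) eℓ-indep eℓ∈α h (∷-kills {h = h} {e} {ℓ} he hℓ)

        -- Since `e` is not in `h₀`, the hyperplane meets α in ℓ only. This identifies the roots of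
        -- Q h₀ with the points of ℓ on the conic.
        C∈ℓ : ∀ {s t} → ParamOK s t → Q h₀ s t ≡ 0# → InSpan ℓ (C s t)
        C∈ℓ {s} {t} ok Q₀≡0 = span-∷-tail h₀ {e} {ℓ} {C s t} Q₀x₀≢0 h₀-kills-ℓ Q₀≡0
          (InSpanOf-trans {u = e ∷ ℓ} {w = spreadBasis wα} {C s t}
             (exchange (e ∷ ℓ) (spreadBasis wα) eℓ-indep eℓ∈α) (proj₂ (C∈α ok)))

      family : K → V7
      family x = h₀ ⊕ x ⊛ h∞

      abstract
        family-∙ : ∀ x v → family x ∙ v ≡ h₀ ∙ v + x * h∞ ∙ v
        family-∙ x v = trans (∙-⊕ˡ h₀ (x ⊛ h∞) v) (cong (h₀ ∙ v +_) (∙-⊛ˡ x h∞ v))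

        family-∙-at-infinity : ∀ x v → h∞ ∙ v ≡ 0# → family x ∙ v ≡ h₀ ∙ v
        family-∙-at-infinity x v hv≡0 = trans (family-∙ x v)
          (trans (cong (λ z → h₀ ∙ v + x * z) hv≡0) (trans (cong (h₀ ∙ v +_) (zeroʳ x)) (+-identityʳ (h₀ ∙ v))))

        Q-family : ∀ x → Q (family x) ≗₂ Q h₀
        Q-family x s t = family-∙-at-infinity x (C s t) (Q∞≡0 s t)

        R-family : ∀ x s t → R (family x) s t ≡ R h₀ s t + x * R h∞ s t
        R-family x s t = family-∙ x (N s t)

        family-kills-π : ∀ x k → family x ∙ spreadBasis wπ k ≡ 0#
        family-kills-π x k = trans (family-∙-at-infinity x (spreadBasis wπ k) (h∞-kills-spreadBasis wπ k)) (h₀-kills-π k)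

        family-not-at-infinity : ∀ x → ¬ (∀ j → family x ∙ b j ≡ 0#)
        family-not-at-infinity x kills = h₀-not-at-infinity
          (λ j → trans (sym (family-∙-at-infinity x (b j) (h∞-kills-b j))) (kills j))

        family-admissible : ∀ x → Admissible wπ ℓ (family x)
        family-admissible x =
          (λ z → family-not-at-infinity x (λ j → sumF-zero (λ i → trans (cong (_* b j i) (z i)) (zeroˡ (b j i))))) ,
          family-kills-π x ,
          (λ k → trans (family-∙-at-infinity x (ℓ k) (h∞-kills-ℓ k)) (h₀-kills-ℓ k)) ,
          family-not-at-infinity x

        -- `h` is rescaled by ρ to agree with `h₀` at `e`. The difference vanishes at `e` and on ℓ,
        -- hence on α, and also on π; so it is a multiple of `h∞`.
        admissible⇒family : ∀ h → Admissible wπ ℓ h → ∃ λ x → h ∼ family x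
        admissible⇒family h (_ , kπ , kℓ , not∞) = proj₁ multiple , ρ , ρ≢0 , λ i →
            trans (cong (h₀ i +_) (sym (proj₂ multiple i)))
              (solve 3 (λ a r h → a :+ (r :* h :+ (:- :1) :* a) := r :* h) refl (h₀ i) ρ (h i))
          where
          Qhx₀≢0 : Q h 1# x₀ ≢ 0#
          Qhx₀≢0 eq = not∞ (kills-α-π⇒at-infinity h (kills-eℓ⇒kills-α h eq kℓ) kπ)
          i₀ : K
          i₀ = recip Qhx₀≢0
          ρ : K
          ρ = Q h₀ 1# x₀ * i₀
          ρ≢0 : ρ ≢ 0#
          ρ≢0 = *≢0 Q₀x₀≢0 (inverse≢0 (*-recip Qhx₀≢0))
          g : V7
          g = ρ ⊛ h ⊕ (- 1#) ⊛ h₀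
          g∙ : ∀ v → g ∙ v ≡ ρ * h ∙ v + - 1# * h₀ ∙ v
          g∙ v = trans (∙-⊕ˡ (ρ ⊛ h) ((- 1#) ⊛ h₀) v) (cong₂ _+_ (∙-⊛ˡ ρ h v) (∙-⊛ˡ (- 1#) h₀ v))
          both : ∀ v → h ∙ v ≡ 0# → h₀ ∙ v ≡ 0# → g ∙ v ≡ 0#
          both v eq eq′ = trans (g∙ v) (trans (cong₂ (λ x y → ρ * x + - 1# * y) eq eq′)
            (solve 1 (λ r → r :* :0 :+ (:- :1) :* :0 := :0) refl ρ))
          ge≡0 : g ∙ e ≡ 0#
          ge≡0 = trans (g∙ e) (lincomb₁ (Q h₀ 1# x₀) (*-recip Qhx₀≢0)
            (solve 3 (λ a b i → a :* i :* b :+ (:- :1) :* a := :0 :+ a :* (b :* i :- :1)) refl (Q h₀ 1# x₀) (Q h 1# x₀) i₀))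
          multiple : ∃ λ κ → ∀ i → g i ≡ κ * h∞ i
          multiple = h∞-unique g (kills-α-π⇒at-infinity g
            (kills-eℓ⇒kills-α g ge≡0 (λ k → both (ℓ k) (kℓ k) (h₀-kills-ℓ k)))
            (λ k → both (spreadBasis wπ k) (kπ k) (h₀-kills-π k)))

        -- Members of the pencil agree at `e`, which makes the scalar 1. Their values at `N` (1, 0)
        -- then differ by a multiple of R h∞ (1, 0) ≠ 0 and give the parameter.
        family-injective : ∀ x y → family x ∼ family y → x ≡ y
        family-injective x y (κ , _ , eq) = sym (*-cancelˡ-≢0 (R∞≢0 10-paramOK)
            (lincomb₂ 1# (R h₀ 1# 0# + x * ρ) R-eq κ≡1
              (solve 5 (λ ρ y x a k → ρ :* y := ρ :* x :+ :1 :* ((a :+ y :* ρ) :- k :* (a :+ x :* ρ))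
                  :+ (a :+ x :* ρ) :* (k :- :1)) refl ρ y x (R h₀ 1# 0#) κ)))
          where
          ρ : K
          ρ = R h∞ 1# 0#
          scaled : ∀ v → family y ∙ v ≡ κ * family x ∙ v
          scaled v = trans (∙-congˡ v eq) (∙-⊛ˡ κ (family x) v)
          R-eq : R h₀ 1# 0# + y * ρ ≡ κ * (R h₀ 1# 0# + x * ρ)
          R-eq = trans (sym (R-family y 1# 0#)) (trans (scaled (N 1# 0#)) (cong (κ *_) (R-family x 1# 0#)))
          κ≡1 : κ ≡ 1#
          κ≡1 = *-cancelˡ-≢0 Q₀x₀≢0 (trans (*-comm (Q h₀ 1# x₀) κ) (trans
            (sym (trans (sym (Q-family y 1# x₀)) (trans (scaled e) (cong (κ *_) (Q-family x 1# x₀)))))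
            (sym (*-identityʳ (Q h₀ 1# x₀)))))

        hyperplane-count : HasExactly _∼_ (Admissible wπ ℓ) q
        hyperplane-count = (λ k → family (element k)) , (λ k → family-admissible (element k)) ,
          (λ j k eq → element-injective j k (family-injective (element j) (element k) eq)) ,
          (λ h adm → enumerated h (admissible⇒family h adm))
          where
          enumerated : ∀ h → (∃ λ x → h ∼ family x) → ∃ λ k → h ∼ family (element k)
          enumerated h (x , h∼) = index x , subst (λ y → h ∼ family y) (sym (element-index x)) h∼

        -- The parameters `xs` carry the members of type `P₂` and all others those of type `P₁`.
        -- Because the types exclude each other, listing the parameters and their complement lists
        -- both types completely.
        dichotomy-count : ∀ {n} (P₁ P₂ : V7 → Set) →
          (∀ g h → g ∼ h → P₁ g → P₁ h) → (∀ g h → g ∼ h → P₂ g → P₂ h) →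
          (∀ h → P₁ h → ¬ P₂ h) →
          (xs : Fin n → K) → (∀ j k → xs j ≡ xs k → j ≡ k) →
          (∀ k → P₂ (family (xs k))) → (∀ x → (∀ k → x ≢ xs k) → P₁ (family x)) →
          HasExactly _∼_ (λ h → Admissible wπ ℓ h × P₁ h) (q ∸ n) ×
          HasExactly _∼_ (λ h → Admissible wπ ℓ h × P₂ h) n
        dichotomy-count {n} P₁ P₂ resp₁ resp₂ exclusive xs injective special generic =
          ((λ k → family (element (others k))) ,
           (λ k → family-admissible (element (others k)) , generic (element (others k)) (λ j eq → others-avoid k j
             (trans (element-injective _ _ (trans eq (sym (element-index (xs j))))) refl))) ,
           (λ j k eq → others-injective j k (element-injective _ _ (family-injective _ _ eq))) ,
           λ h adm → find-other h (proj₂ adm) (admissible⇒family h (proj₁ adm))) ,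
          ((λ k → family (xs k)) , (λ k → family-admissible (xs k) , special k) ,
           (λ j k eq → injective j k (family-injective _ _ eq)) ,
           λ h adm → find-special h (proj₂ adm) (admissible⇒family h (proj₁ adm)))
          where
          complement : ∃ λ (g : Fin (q ∸ n) → Fin q) → (∀ j k → g j ≡ g k → j ≡ k) ×
            (∀ j k → g j ≢ index (xs k)) × (∀ x → (∀ k → x ≢ index (xs k)) → ∃ λ j → x ≡ g j)
          complement = injection-complement (index ∘ xs) (λ j k eq → injective j k (index-injective _ _ eq))
          others : Fin (q ∸ n) → Fin q
          others = proj₁ complement
          others-injective : ∀ j k → others j ≡ others k → j ≡ k
          others-injective = proj₁ (proj₂ complement)
          others-avoid : ∀ j k → others j ≢ index (xs k)
          others-avoid = proj₁ (proj₂ (proj₂ complement))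
          others-cover : ∀ x → (∀ k → x ≢ index (xs k)) → ∃ λ j → x ≡ others j
          others-cover = proj₂ (proj₂ (proj₂ complement))
          find-other : ∀ h → P₁ h → (∃ λ x → h ∼ family x) → ∃ λ k → h ∼ family (element (others k))
          find-other h P₁h (x , h∼) = covered (others-cover (index x) (λ k eq → exclusive (family (xs k))
              (subst (λ y → P₁ (family y)) (index-injective x (xs k) eq) (resp₁ h (family x) h∼ P₁h)) (special k)))
            where
            covered : (∃ λ j → index x ≡ others j) → ∃ λ k → h ∼ family (element (others k))
            covered (j , eq) = j , subst (λ y → h ∼ family y) (trans (sym (element-index x)) (cong element eq)) h∼
          find-special : ∀ h → P₂ h → (∃ λ x → h ∼ family x) → ∃ λ k → h ∼ family (xs k)
          find-special h P₂h (x , h∼) with Finₚ.any? (λ k → x ≟ xs k)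
          ... | yes (k , eq) = k , subst (λ y → h ∼ family y) eq h∼
          ... | no none = ⊥-elim (exclusive (family x) (generic x (λ k eq → none (k , eq))) (resp₂ h (family x) h∼ P₂h))

      Divisible : K → Set
      Divisible x = LinearlyDivides (Q (family x)) (R (family x))

      abstract
        R-difference : ∀ x y s t → (x + - y) * R h∞ s t ≡ R (family x) s t + - R (family y) s t
        R-difference x y s t = trans
          (solve 4 (λ a x y r → (x :- y) :* r := (a :+ x :* r) :- (a :+ y :* r)) refl (R h₀ s t) x y (R h∞ s t))
          (sym (cong₂ (λ u v → u + - v) (R-family x s t) (R-family y s t)))

        equal-at-root : ∀ {x y s t} → ParamOK s t → R (family x) s t ≡ 0# → R (family y) s t ≡ 0# → x ≡ y
        equal-at-root {x} {y} {s} {t} ok eq eq′ = a-b≡0⇒a≡b (*≡0 (R∞≢0 ok) (trans (*-comm (R h∞ s t) (x + - y))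
          (trans (R-difference x y s t) (trans (cong₂ (λ u v → u + - v) eq eq′) (-‿inverseʳ 0#)))))

        -- Subtracting gives (x - y) R h∞ = (l - m) Q h₀. The linear form l - m has a root or is
        -- zero, whereas R h∞ has no root, so x = y.
        divisible-unique : ∀ {x y} → Divisible x → Divisible y → x ≡ y
        divisible-unique {x} {y} (l , fl , R≡) (m , fm , R≡′) =
            [ (λ n≡0 → equal-from n≡0 10-paramOK)
            , (λ { (a , a′ , ok , n≡) → equal-from′ ok (trans (n≡ a a′) (lin-self a a′)) }) ]′
            (linear-form (Form-⊟ fl fm))
          where
          difference : ∀ s t → (x + - y) * R h∞ s t ≡ (l s t + - m s t) * Q h₀ s t
          difference s t = trans (R-difference x y s t) (trans
            (cong₂ (λ u v → u + - v) (trans (R≡ s t) (cong (l s t *_) (Q-family x s t)))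
                                     (trans (R≡′ s t) (cong (m s t *_) (Q-family y s t))))
            (solve 3 (λ l m q → l :* q :- m :* q := (l :- m) :* q) refl (l s t) (m s t) (Q h₀ s t)))
          equal-from′ : ∀ {s t} → ParamOK s t → l s t + - m s t ≡ 0# → x ≡ y
          equal-from′ {s} {t} ok eq = a-b≡0⇒a≡b (*≡0 (R∞≢0 ok) (trans (*-comm (R h∞ s t) (x + - y))
            (trans (difference s t) (trans (cong (_* Q h₀ s t) eq) (zeroˡ (Q h₀ s t))))))
          equal-from : l ⊟ m ≗₂ 𝟎 → ∀ {s t} → ParamOK s t → x ≡ y
          equal-from n≡0 {s} {t} ok = equal-from′ ok (n≡0 s t)

        Q-family-nonroot : ∀ x → Q (family x) 1# x₀ ≢ 0#
        Q-family-nonroot x eq = Q₀x₀≢0 (trans (sym (Q-family x 1# x₀)) eq)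

      ConicPoint : V7 → Set
      ConicPoint v = SubspacePts ℓ v × InConic v

      -- Sections of the pencil and their number.

      module ConicPoints (i : ℕ) (points : HasExactly _∼_ ConicPoint i) where
        abstract
          root-list : ∃ λ (P : Fin i → K × K) → (∀ k → ParamOK (proj₁ (P k)) (proj₂ (P k))) ×
            (∀ k → nrcPt 2 p (proj₁ (P k)) (proj₂ (P k)) ∼ proj₁ points k)
          root-list = (λ k → proj₁ (on k) , proj₁ (proj₂ (on k))) ,
            (λ k → proj₁ (proj₂ (proj₂ (on k)))) , (λ k → proj₂ (proj₂ (proj₂ (on k))))
            where
            on : ∀ k → ∃₂ λ s t → ParamOK s t × nrcPt 2 p s t ∼ proj₁ points k
            on k = proj₂ (proj₂ (proj₁ (proj₂ points) k))

        P : Fin i → K × K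
        P = proj₁ root-list

        Ps Pt : Fin i → K
        Ps k = proj₁ (P k)
        Pt k = proj₂ (P k)

        abstract
          P-ok : ∀ k → ParamOK (Ps k) (Pt k)
          P-ok = proj₁ (proj₂ root-list)

          CP∼ : ∀ k → C (Ps k) (Pt k) ∼ proj₁ points k
          CP∼ k = subst (_∼ proj₁ points k) (sym (C≡nrcPt (Ps k) (Pt k))) (proj₂ (proj₂ root-list) k)

          Q₀P≡0 : ∀ k → Q h₀ (Ps k) (Pt k) ≡ 0#
          Q₀P≡0 k = from-scalar (CP∼ k)
            where
            from-scalar : C (Ps k) (Pt k) ∼ proj₁ points k → Q h₀ (Ps k) (Pt k) ≡ 0#
            from-scalar (κ , κ≢0 , v≡) = ∙-scalar h₀ {proj₁ points k} {C (Ps k) (Pt k)} κ≢0 v≡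
              (kills-span {u = ℓ} h₀ h₀-kills-ℓ (proj₂ (proj₁ (proj₁ (proj₂ points) k))))

          P-injective : ∀ j k → P j ∼₂ P k → j ≡ k
          P-injective j k (κ , κ≢0 , s≡ , t≡) = proj₁ (proj₂ (proj₂ points)) j k
            (∼-trans (∼-sym (CP∼ j)) (∼-trans (κ ^ 2 , ^≢0 2 κ≢0 , λ i →
              trans (cong₂ (λ a b → C a b i) s≡ t≡) (Form-homogeneous (Form-C i) κ (Ps j) (Pt j))) (CP∼ k)))

          P-complete : ∀ s t → ParamOK s t → Q h₀ s t ≡ 0# → ∃ λ k → P k ∼₂ (s , t)
          P-complete s t ok Q₀≡0 = listed (proj₂ (proj₂ (proj₂ points)) (C s t)
              ((C-isPoint ok , C∈ℓ ok Q₀≡0) , C-InConic ok))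
            where
            listed : (∃ λ k → C s t ∼ proj₁ points k) → ∃ λ k → P k ∼₂ (s , t)
            listed (k , C∼) = k , lin≡0⇒∼₂ (P-ok k) ok
                (separate (separating-C {Ps k} {Pt k} ok) (∼-trans (CP∼ k) (∼-sym C∼)))
              where
              separate : (∃ λ h → Q h (Ps k) (Pt k) ≡ 0# ×
                                  (Q h s t ≡ 0# → lin (Ps k) (Pt k) s t ≡ 0#)) →
                         C (Ps k) (Pt k) ∼ C s t → lin (Ps k) (Pt k) s t ≡ 0#
              separate (h , Qh≡0 , separates) (κ , _ , C≡) = separates (trans (∙-congʳ h C≡)
                (trans (∙-⊛ʳ h κ (C (Ps k) (Pt k))) (trans (cong (κ *_) Qh≡0) (zeroʳ κ))))

          divisible-section : ∀ x → Divisible x → MeetsInNRCAndGens 3 i (family x)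
          divisible-section x (l , fl , R≡) = section-divisible (family x) fl R≡ P P-ok P-injective
            (λ s t ok Q≡0 → P-complete s t ok (trans (sym (Q-family x s t)) Q≡0))
            (λ k → trans (Q-family x (Ps k) (Pt k)) (Q₀P≡0 k))

          special : Fin i → K
          special k = - (R h₀ (Ps k) (Pt k) * recip (R∞≢0 (P-ok k)))

          R-special : ∀ k → R (family (special k)) (Ps k) (Pt k) ≡ 0#
          R-special k = trans (R-family (special k) (Ps k) (Pt k))
            (lincomb₁ (- ρ₀) (*-recip (R∞≢0 (P-ok k)))
              (solve 3 (λ a r i → a :+ (:- (a :* i)) :* r := :0 :+ (:- a) :* (r :* i :- :1)) refl
                 ρ₀ ρ∞ (recip (R∞≢0 (P-ok k)))))
            where
            ρ₀ ρ∞ : K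
            ρ₀ = R h₀ (Ps k) (Pt k)
            ρ∞ = R h∞ (Ps k) (Pt k)

          common-root⇒special : ∀ {x s t} → ParamOK s t → Q (family x) s t ≡ 0# → R (family x) s t ≡ 0# →
                                ∃ λ k → x ≡ special k
          common-root⇒special {x} {s} {t} ok Q≡0 R≡0 = at-root (P-complete s t ok (trans (sym (Q-family x s t)) Q≡0))
            where
            at-root : (∃ λ k → P k ∼₂ (s , t)) → ∃ λ k → x ≡ special k
            at-root (k , κ , κ≢0 , s≡ , t≡) = k , equal-at-root (P-ok k)
              (*≡0 (^≢0 3 κ≢0) (trans (sym (Form-homogeneous (Form-R (family x)) κ (Ps k) (Pt k)))
                (trans (sym (cong₂ (R (family x)) s≡ t≡)) R≡0)))
              (R-special k)

          generic-section : ∀ x → ¬ Divisible x → (∀ k → x ≢ special k) → MeetsInNRC 5 (family x)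
          generic-section x ¬divisible ¬special = section-without-common-root (family x) x₀ (Q-family-nonroot x)
            (λ { s t ok (Q≡0 , R≡0) → not-listed (common-root⇒special ok Q≡0 R≡0) }) ¬divisible
            where
            not-listed : ¬ (∃ λ k → x ≡ special k)
            not-listed (k , eq) = ¬special k eq

          -- Two distinct roots exhaust Q up to a nonzero scalar, and both of their linear factors
          -- also divide R.
          two-roots⇒divisible : ∀ x {a a′ s t} → ParamOK a a′ → ParamOK s t → lin a a′ s t ≢ 0# →
            Q (family x) a a′ ≡ 0# → R (family x) a a′ ≡ 0# → Q (family x) s t ≡ 0# → R (family x) s t ≡ 0# →
            Divisible x
          two-roots⇒divisible x {a} {a′} {s} {t} ok ok′ distinct Q≡0 R≡0 Q≡0′ R≡0′ =
            first (factor (Form-Q (family x)) ok Q≡0) (factor (Form-R (family x)) ok R≡0)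
            where
            first : (∃ λ G → Form 1 G × Q (family x) ≗₂ lin a a′ ⊗ G) →
                    (∃ λ G → Form 2 G × R (family x) ≗₂ lin a a′ ⊗ G) → Divisible x
            first (m , fm , Q≡) (S , fS , R≡) = second
                (factor fm ok′ (*≡0 distinct (trans (sym (Q≡ s t)) Q≡0′)))
                (factor fS ok′ (*≡0 distinct (trans (sym (R≡ s t)) R≡0′)))
              where
              second : (∃ λ G → Form 0 G × m ≗₂ lin s t ⊗ G) → (∃ λ G → Form 1 G × S ≗₂ lin s t ⊗ G) → Divisible x
              second (G , constant κ G≡ , m≡) (n , fn , S≡) = scale κ⁻¹ n , Form-scale κ⁻¹ fn , λ u v →
                  trans (R≡ u v) (trans (cong (lin a a′ u v *_) (S≡ u v))
                    (lincomb₂ (- (lin a a′ u v * (lin s t u v * n u v))) (- (κ⁻¹ * n u v)) (*-recip κ≢0) (Q≡′ u v)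
                      (solve 6 (λ l l′ n i κ x → l :* (l′ :* n) := i :* n :* x
                         :+ (:- (l :* (l′ :* n))) :* (κ :* i :- :1) :+ (:- (i :* n)) :* (x :- l :* (l′ :* κ))) refl
                         (lin a a′ u v) (lin s t u v) (n u v) κ⁻¹ κ (Q (family x) u v))))
                where
                Q≡′ : ∀ u v → Q (family x) u v ≡ lin a a′ u v * (lin s t u v * κ)
                Q≡′ u v = trans (Q≡ u v) (cong (lin a a′ u v *_) (trans (m≡ u v) (cong (lin s t u v *_) (G≡ u v))))
                κ≢0 : κ ≢ 0#
                κ≢0 κ≡0 = Q-family-nonroot x (trans (Q≡′ 1# x₀) (trans (cong (λ z → lin a a′ 1# x₀ * (lin s t 1# x₀ * z)) κ≡0)
                  (solve 2 (λ a b → a :* (b :* :0) := :0) refl (lin a a′ 1# x₀) (lin s t 1# x₀))))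
                κ⁻¹ : K
                κ⁻¹ = recip κ≢0

          -- A member that belongs to two points of ℓ on the conic would have two common roots,
          -- hence be divisible. So the i points give i different hyperplanes.
          special-injective : (∀ x → ¬ Divisible x) → ∀ j k → special j ≡ special k → j ≡ k
          special-injective ¬divisible j k eq =
            case (lin (Ps j) (Pt j) (Ps k) (Pt k) ≟ 0#)
            where
            Q≡0 : ∀ x k → Q (family x) (Ps k) (Pt k) ≡ 0#
            Q≡0 x k = trans (Q-family x (Ps k) (Pt k)) (Q₀P≡0 k)
            case : Dec (lin (Ps j) (Pt j) (Ps k) (Pt k) ≡ 0#) → j ≡ k
            case (yes l≡0) = P-injective j k (lin≡0⇒∼₂ (P-ok j) (P-ok k) l≡0)
            case (no l≢0) = ⊥-elim (¬divisible (special j) (two-roots⇒divisible (special j) (P-ok j) (P-ok k) l≢0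
                (Q≡0 (special j) j) (R-special j) (Q≡0 (special j) k)
                (trans (cong (λ x → R (family x) (Ps k) (Pt k)) eq) (R-special k))))

          -- After removal of the common factor, divisibility of the cofactors would give back Q ∣
          -- R, which is excluded.
          special-section : (∀ x → ¬ Divisible x) → ∀ k → MeetsInNRCAndGens 4 1 (family (special k))
          special-section ¬divisible k = from-factors
              (factor (Form-Q h) (P-ok k) (trans (Q-family (special k) (Ps k) (Pt k)) (Q₀P≡0 k)))
              (factor (Form-R h) (P-ok k) (R-special k))
            where
            h : V7
            h = family (special k)
            l : Fun
            l = lin (Ps k) (Pt k)
            from-factors : (∃ λ G → Form 1 G × Q h ≗₂ l ⊗ G) → (∃ λ G → Form 2 G × R h ≗₂ l ⊗ G) →
                           MeetsInNRCAndGens 4 1 h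
            from-factors (m , fm , Q≡) (S , fS , R≡) = section-with-one-common-root h (P-ok k) fm fS Q≡ R≡
              (λ m≡0 → Q-family-nonroot (special k) (trans (Q≡ 1# x₀) (trans (cong (l 1# x₀ *_) (m≡0 1# x₀)) (zeroʳ (l 1# x₀)))))
              (λ { (n , fn , S≡) → ¬divisible (special k) (n , fn , λ s t → begin
                  R h s t                  ≡⟨ R≡ s t ⟩
                  l s t * S s t            ≡⟨ cong (l s t *_) (S≡ s t) ⟩
                  l s t * (n s t * m s t)  ≡⟨ solve 3 (λ l n m → l :* (n :* m) := n :* (l :* m)) refl (l s t) (n s t) (m s t) ⟩
                  n s t * (l s t * m s t)  ≡⟨ cong (n s t *_) (sym (Q≡ s t)) ⟩
                  n s t * Q h s t          ∎) })

          splash-count : ∀ x → Divisible x →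
            HasExactly _∼_ (λ h → Admissible wπ ℓ h × MeetsInNRC 5 h) (q ∸ 1) ×
            HasExactly _∼_ (λ h → Admissible wπ ℓ h × MeetsInNRCAndGens 3 i h) 1
          splash-count x divisible = dichotomy-count (MeetsInNRC 5) (MeetsInNRCAndGens 3 i)
            (λ g h → MeetsInNRC-resp-∼ {5} {g} {h}) (λ g h → MeetsInNRCAndGens-resp-∼ {3} {i} {g} {h})
            nrc-excludes-cubic (λ (_ : Fin 1) → x) (λ { zero zero _ → refl })
            (λ _ → divisible-section x divisible)
            -- R = l Q of the divisible member vanishes at every root of Q. Hence each `special k`
            -- equals x, and no other member has a common root.
            (λ y y≢x → generic-section y (λ divisible′ → y≢x zero (divisible-unique divisible′ divisible))
              (λ k eq → y≢x zero (equal-at-root (P-ok k)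
                (trans (cong (λ z → R (family z) (Ps k) (Pt k)) eq) (R-special k))
                (R-divisible k))))
            where
            R-divisible : ∀ k → R (family x) (Ps k) (Pt k) ≡ 0#
            R-divisible k = trans (proj₂ (proj₂ divisible) (Ps k) (Pt k))
              (trans (cong (proj₁ divisible (Ps k) (Pt k) *_)
                       (trans (Q-family x (Ps k) (Pt k)) (Q₀P≡0 k)))
                     (zeroʳ _))

          non-splash-count : (∀ x → ¬ Divisible x) →
            HasExactly _∼_ (λ h → Admissible wπ ℓ h × MeetsInNRC 5 h) (q ∸ i) ×
            HasExactly _∼_ (λ h → Admissible wπ ℓ h × MeetsInNRCAndGens 4 1 h) i
          non-splash-count ¬divisible = dichotomy-count (MeetsInNRC 5) (MeetsInNRCAndGens 4 1)
            (λ g h → MeetsInNRC-resp-∼ {5} {g} {h}) (λ g h → MeetsInNRCAndGens-resp-∼ {4} {1} {g} {h})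
            nrc-excludes-generators special (special-injective ¬divisible)
            (special-section ¬divisible)
            (λ x → generic-section x (¬divisible x))

      -- Splash membership and divisibility.

      abstract
        points-at-infinity-agree : ∀ x y → BP (Bset wα) x → Inc x ℓ∞ → BP (Bset wα) y → Inc y ℓ∞ → x ≈P y
        points-at-infinity-agree (inj₂ w) (inj₂ w′) (_ , same) _ (_ , same′) _ =
          SamePlane-trans {w} {wα} {w′} same (SamePlane-sym {w′} {wα} same′)

        -- The spread element of the line `U` is π. The member of the pencil through one affine
        -- point of `U` contains π and this point, hence all of `U`, and the common linear factor of
        -- the functionals that kill `U` applies to it.
        splash⇒divisible : InSplash (Bset wα) wπ → ∃ Divisible
        -- ℓ∞ has only the point α in common with the subplane, whereas q + 1 points include two
        -- distinct ones; `index 0#` merely names an element of `Fin q`.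
        splash⇒divisible (inj₂ tt , _ , _ , xs , on , xs-injective , _) = ⊥-elim (Finₚ.0≢1+n
          (xs-injective zero (suc (index 0#)) (points-at-infinity-agree (xs zero) (xs (suc (index 0#)))
            (proj₁ (on zero)) (proj₂ (on zero)) (proj₁ (on (suc (index 0#)))) (proj₂ (on (suc (index 0#)))))))
        splash⇒divisible (inj₁ U , valid , π∈U , xs , on , xs-injective , _) =
          from-point (SubplaneLine.meets-generator U valid two α∉U 10-paramOK)
                     (SubplaneLine.common-linear-factor U valid two α∉U)
          where
          w : Fin 6 → K
          w = proj₁ (proj₂ valid)
          U∩Σ : (λ v → SubspacePts U v × InSigma v) ≐ SpreadPlane w
          U∩Σ = proj₂ (proj₂ (proj₂ valid))
          two : TwoOn (Bset wα) (inj₁ U)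
          two = xs zero , xs (suc (index 0#)) , proj₁ (on zero) , proj₁ (on (suc (index 0#))) ,
            (λ eq → Finₚ.0≢1+n (xs-injective zero (suc (index 0#)) eq)) ,
            proj₂ (on zero) , proj₂ (on (suc (index 0#)))
          π≈w : SamePlane wπ w
          π≈w = line-at-infinity {U} {w} U∩Σ {wπ} wπ≢0 π∈U
          α∉U : ¬ Inc (inj₂ wα) (inj₁ U)
          α∉U α∈U = π≁α (SamePlane-trans {wπ} {w} {wα} π≈w
            (SamePlane-sym {wα} {w} (line-at-infinity {U} {w} U∩Σ {wα} wα≢0 α∈U)))
          from-point : (∃₂ λ x y → y ≢ 0# × InSpan U (x ⊛ C 1# 0# ⊕ y ⊛ N 1# 0#)) →
                       (∃ λ l → Form 1 l × (∀ h → (∀ j → h ∙ U j ≡ 0#) → R h ≗₂ l ⊗ Q h)) → ∃ Divisible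
          from-point (x , y , y≢0 , v∈U) (l , fl , divides) = κ , l , fl , divides (family κ) (λ j → kills (U j) (InSpanOf-member U j))
            where
            v : V7
            v = x ⊛ C 1# 0# ⊕ y ⊛ N 1# 0#
            hv≡ : h∞ ∙ v ≡ y * R h∞ 1# 0#
            hv≡ = trans (∙-generator h∞ {1#} {0#} {v} x y (λ _ → refl))
              (trans (cong (λ z → x * z + y * R h∞ 1# 0#) (Q∞≡0 1# 0#))
                     (solve 2 (λ x z → x :* :0 :+ z := z) refl x (y * R h∞ 1# 0#)))
            hv≢0 : h∞ ∙ v ≢ 0#
            hv≢0 eq = *≢0 y≢0 (R∞≢0 10-paramOK) (trans (sym hv≡) eq)
            i : K
            i = recip hv≢0
            κ : K
            κ = - (h₀ ∙ v * i)
            family·v≡0 : family κ ∙ v ≡ 0#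
            family·v≡0 = trans (family-∙ κ v) (lincomb₁ (- (h₀ ∙ v)) (*-recip hv≢0)
              (solve 3 (λ a b i → a :+ (:- (a :* i)) :* b := :0 :+ (:- a) :* (b :* i :- :1)) refl (h₀ ∙ v) (h∞ ∙ v) i))
            kills : ∀ u → InSpan U u → family κ ∙ u ≡ 0#
            kills u u∈U = lincomb₂ 1# μ (trans (sym (g∙ (family κ))) (kills-g (isZero? g))) family·v≡0
              (solve 3 (λ a m b → a := :0 :+ :1 :* (a :+ (:- m) :* b :- :0) :+ m :* (b :- :0)) refl
                 (family κ ∙ u) μ (family κ ∙ v))
              where
              -- With this scalar u - μ v lies at infinity, hence in π, where the member vanishes.
              μ : K
              μ = h∞ ∙ u * i
              g : V7
              g = u ⊕ (- μ) ⊛ v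
              g∙ : ∀ h → h ∙ g ≡ h ∙ u + - μ * h ∙ v
              g∙ h = trans (∙-⊕ʳ h u ((- μ) ⊛ v)) (cong (h ∙ u +_) (∙-⊛ʳ h (- μ) v))
              h∞·g≡0 : h∞ ∙ g ≡ 0#
              h∞·g≡0 = trans (g∙ h∞) (lincomb₁ (- (h∞ ∙ u)) (*-recip hv≢0)
                (solve 3 (λ a b i → a :+ (:- (a :* i)) :* b := :0 :+ (:- a) :* (b :* i :- :1)) refl (h∞ ∙ u) (h∞ ∙ v) i))
              kills-g : Dec (IsZero g) → family κ ∙ g ≡ 0#
              kills-g (yes g≡0) = sumF-zero (λ i → trans (cong (family κ i *_) (g≡0 i)) (zeroʳ (family κ i)))
              kills-g (no g≢0) = kills-span {u = spreadBasis wπ} {g} (family κ) (family-kills-π κ)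
                (proj₂ (proj₂ (π≈w g) (proj₁ (U∩Σ g)
                  ((g≢0 , InSpanOf-⊕ {u = U} {u} {(- μ) ⊛ v} u∈U (InSpanOf-⊛ {u = U} {v} (- μ) v∈U)) , h∞≡0⇒InSigma {g} h∞·g≡0))))

      -- The points l C − N of the section span a line of the subplane.
      module Divisor (x : K) (l : Fun) (fl : Form 1 l) (R≡ : R (family x) ≗₂ l ⊗ Q (family x)) where
        one : Fun
        one _ _ = 1#

        D : K → K → V7
        D = residual l one

        -- `d` is the point at infinity of the line through `D₁` and `D₂`: as `h∞` takes the value -
        -- R h∞ s t at `D s t`, the chosen coefficients cancel.
        D₁ D₂ d : V7
        D₁ = D 1# 0#
        D₂ = D 0# 1#
        d = R h∞ 1# 0# ⊛ D₂ ⊕ (- R h∞ 0# 1#) ⊛ D₁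

        abstract
          ∙-D : ∀ h s t → h ∙ D s t ≡ l s t * Q h s t + - 1# * R h s t
          ∙-D h s t = ∙-residual h l one s t

          ∙-d : ∀ h → h ∙ d ≡ R h∞ 1# 0# * h ∙ D₂ + - R h∞ 0# 1# * h ∙ D₁
          ∙-d h = trans (∙-⊕ʳ h (R h∞ 1# 0# ⊛ D₂) ((- R h∞ 0# 1#) ⊛ D₁))
            (cong₂ _+_ (∙-⊛ʳ h (R h∞ 1# 0#) D₂) (∙-⊛ʳ h (- R h∞ 0# 1#) D₁))

          ∙-D-α : ∀ h → Q h ≗₂ 𝟎 → ∀ s t → h ∙ D s t ≡ - R h s t
          ∙-D-α h Q≡0 s t = trans (∙-D h s t) (trans (cong (λ z → l s t * z + - 1# * R h s t) (Q≡0 s t))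
            (solve 2 (λ l r → l :* :0 :+ (:- :1) :* r := :- r) refl (l s t) (R h s t)))

          h∞·D≢0 : ∀ {s t} → ParamOK s t → h∞ ∙ D s t ≢ 0#
          h∞·D≢0 {s} {t} ok eq = -a≢0 (R∞≢0 ok) (trans (sym (∙-D-α h∞ Q∞≡0 s t)) eq)

          D∈V : ∀ {s t} → ParamOK s t → InV (D s t)
          D∈V {s} {t} ok = generator-InV {s} {t} {D s t} ok (∙-nonzero⇒point {h∞} {D s t} (h∞·D≢0 ok)) (l s t , - 1# , λ _ → refl)

          d∈Σ : InSigma d
          d∈Σ = h∞≡0⇒InSigma {d} (trans (∙-d h∞) (trans
            (cong₂ (λ u v → R h∞ 1# 0# * u + - R h∞ 0# 1# * v) (∙-D-α h∞ Q∞≡0 0# 1#) (∙-D-α h∞ Q∞≡0 1# 0#))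
            (solve 2 (λ a b → a :* (:- b) :+ (:- b) :* (:- a) := :0) refl (R h∞ 1# 0#) (R h∞ 0# 1#))))

          -- Vanishing on α and at `D₁` but not at `D₂`, this functional is nonzero at `d`. It shows
          -- that `d` is a point, that `d` is not in α, and that `D₁` and `D₂` are different.
          separator : ∃ λ h → Q h ≗₂ 𝟎 × h ∙ D₁ ≡ 0# × h ∙ D₂ ≢ 0#
          separator = adjust (separating-N {1#} {0#} {0#} {1#} 01-paramOK)
            where
            adjust : (∃ λ h → Q h ≗₂ 𝟎 × R h 1# 0# ≡ 0# × (R h 0# 1# ≡ 0# → lin 1# 0# 0# 1# ≡ 0#)) →
                     ∃ λ h → Q h ≗₂ 𝟎 × h ∙ D₁ ≡ 0# × h ∙ D₂ ≢ 0#
            adjust (h , Q≡0 , R₁≡0 , separates) = h , Q≡0 ,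
              trans (∙-D-α h Q≡0 1# 0#) (trans (cong -_ R₁≡0) (solve 0 (:- :0 := :0) refl)) ,
              λ eq → -a≢0 {1#} (λ 1≡0 → 0≢1 (sym 1≡0)) (trans (solve 0 (:- :1 := :0 :* :0 :- :1 :* :1) refl)
                (separates (lincomb₁ (- 1#) (trans (sym (∙-D-α h Q≡0 0# 1#)) eq)
                  (solve 1 (λ r → r := :0 :+ (:- :1) :* (:- r :- :0)) refl (R h 0# 1#)))))

          separator-d≢0 : proj₁ separator ∙ d ≢ 0#
          separator-d≢0 eq = *≢0 (R∞≢0 10-paramOK) (proj₂ (proj₂ (proj₂ separator)))
            (lincomb₂ 1# (R h∞ 0# 1#) (trans (sym (∙-d (proj₁ separator))) eq) (proj₁ (proj₂ (proj₂ separator)))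
              (solve 4 (λ a b u v → a :* u := :0 :+ :1 :* (a :* u :+ (:- b) :* v :- :0) :+ b :* (v :- :0)) refl
                 (R h∞ 1# 0#) (R h∞ 0# 1#) (proj₁ separator ∙ D₂) (proj₁ separator ∙ D₁)))

        w : Fin 6 → K
        w = proj₁ d∈Σ

        -- The join of `D₁` with the spread element of `d`, whose first basis vector is `d` itself;
        -- hence it contains `D₂` too.
        U : Fin 4 → V7
        U = D₁ ∷ spreadBasis w

        abstract
          d≡embed : ∀ i → d i ≡ spreadBasis w zero i
          d≡embed = proj₂ d∈Σ

          w≢0 : ValidIdx w
          w≢0 z = separator-d≢0 (trans (∙-congʳ (proj₁ separator) d≡embed)
            (sumF-zero (λ i → trans (cong (proj₁ separator i *_) (sumF-zero (λ j → trans (cong (_* b j i) (z j)) (zeroˡ (b j i)))))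
                                    (zeroʳ (proj₁ separator i)))))

          w≁α : ¬ SamePlane wα w
          w≁α same = separator-d≢0 (trans (∙-congʳ (proj₁ separator) d≡embed)
            (kills-span {u = spreadBasis wα} {spreadBasis w zero} (proj₁ separator)
              (Q≡0⇒kills-α (proj₁ separator) (proj₁ (proj₂ separator)))
              (proj₂ (proj₂ (same (spreadBasis w zero)) (spreadBasis-point w w≢0 zero)))))

          D₂∈U : InSpan U D₂
          D₂∈U = InSpanOf-resp {u = U} {a⁻¹ ⊛ (spreadBasis w zero ⊕ R h∞ 0# 1# ⊛ D₁)} {D₂}
              (λ i → lincomb₂ (- a⁻¹) (- D₂ i) (sym (d≡embed i)) (*-recip (R∞≢0 10-paramOK))
                (solve 6 (λ a i x y b s → x := i :* (s :+ b :* y) :+ (:- i) :* (s :- (a :* x :+ (:- b) :* y)) :+ (:- x) :* (a :* i :- :1)) refl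
                   (R h∞ 1# 0#) a⁻¹ (D₂ i) (D₁ i) (R h∞ 0# 1#) (spreadBasis w zero i)))
              (InSpanOf-⊛ {u = U} {spreadBasis w zero ⊕ R h∞ 0# 1# ⊛ D₁} a⁻¹
                (InSpanOf-⊕ {u = U} {spreadBasis w zero} {R h∞ 0# 1# ⊛ D₁} (InSpanOf-member U (suc zero))
                  (InSpanOf-⊛ {u = U} {D₁} (R h∞ 0# 1#) (InSpanOf-member U zero))))
            where
            a⁻¹ : K
            a⁻¹ = recip (R∞≢0 10-paramOK)

        valid : ValidLine (inj₁ U)
        valid = join-valid {D₁} {w} (h∞·D≢0 10-paramOK) w≢0

        U∩Σ : (λ v → SubspacePts U v × InSigma v) ≐ SpreadPlane w
        U∩Σ = join-at-infinity {D₁} {w} (h∞·D≢0 10-paramOK)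

        abstract
          two : TwoOn (Bset wα) (inj₁ U)
          two = inj₁ D₁ , inj₁ D₂ , affine-BP {D₁} (D∈V 10-paramOK) (h∞·D≢0 10-paramOK) ,
            affine-BP {D₂} (D∈V 01-paramOK) (h∞·D≢0 01-paramOK) , distinct , InSpanOf-member U zero , D₂∈U
            where
            distinct : ¬ (D₁ ∼ D₂)
            distinct (κ , _ , D₂≡) = proj₂ (proj₂ (proj₂ separator)) (trans (∙-congʳ (proj₁ separator) D₂≡)
              (trans (∙-⊛ʳ (proj₁ separator) κ D₁) (trans (cong (κ *_) (proj₁ (proj₂ (proj₂ separator)))) (zeroʳ κ))))

          α∉U : ¬ Inc (inj₂ wα) (inj₁ U)
          α∉U α∈U = w≁α (line-at-infinity {U} {w} U∩Σ {wα} wα≢0 α∈U)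

          -- `D₁` and `D₂` lie in `U`. A functional that kills `U` has R = l Q at their parameters,
          -- besides R = l′ Q, and its Q can be chosen nonzero there. Two points determine a linear
          -- form.
          l-determined : ∀ l′ → Form 1 l′ → (∀ h → (∀ j → h ∙ U j ≡ 0#) → R h ≗₂ l′ ⊗ Q h) → l′ ≗₂ l
          l-determined l′ fl′ divides = linear-form-ext fl′ fl
              (agree 10-paramOK (InSpanOf-member U zero)) (agree 01-paramOK D₂∈U)
            where
            agree : ∀ {s t} → ParamOK s t → InSpan U (D s t) → l′ s t ≡ l s t
            agree {s} {t} ok D∈U = from-nonvanishing (nonvanishing-form 2 ok)
              where
              from-nonvanishing : (∃ λ A → Form 2 A × A s t ≢ 0#) → l′ s t ≡ l s t
              from-nonvanishing (A , fA , A≢0) = from-functional (SubplaneLine.killing-functional U valid two α∉U fA)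
                where
                from-functional : (∃ λ h → (∀ j → h ∙ U j ≡ 0#) × Q h ≗₂ A) → l′ s t ≡ l s t
                from-functional (h , kills , Q≡A) = *-cancelˡ-≢0 A≢0 (lincomb₃ (- 1#) (- 1#) (l s t + - l′ s t)
                  (trans (sym (∙-D h s t)) (kills-span {u = U} {D s t} h kills D∈U)) (divides h kills s t) (Q≡A s t)
                  (solve 5 (λ a l l′ q r → a :* l′ := a :* l :+ (:- :1) :* (l :* q :+ (:- :1) :* r :- :0)
                     :+ (:- :1) :* (r :- l′ :* q) :+ (l :- l′) :* (q :- a)) refl (A s t) (l s t) (l′ s t) (Q h s t) (R h s t)))

          -- Some `h` through `U` has the same Q as the member of the pencil. By `l-determined` it
          -- also has the same R, so the two functionals are equal.
          section-kills-U : ∀ j → family x ∙ U j ≡ 0#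
          section-kills-U j = from-factor (SubplaneLine.common-linear-factor U valid two α∉U)
              (SubplaneLine.killing-functional U valid two α∉U (Form-Q (family x)))
            where
            from-factor : (∃ λ l′ → Form 1 l′ × (∀ h → (∀ j → h ∙ U j ≡ 0#) → R h ≗₂ l′ ⊗ Q h)) →
                          (∃ λ h → (∀ j → h ∙ U j ≡ 0#) × Q h ≗₂ Q (family x)) → family x ∙ U j ≡ 0#
            from-factor (l′ , fl′ , divides) (h , kills , Qh≡) = trans (∙-congˡ (U j) (λ i → trans (family≡h i) (*-identityˡ (h i)))) (kills j)
              where
              family≡h : ∀ i → family x i ≡ 1# * h i
              family≡h = functional-determined (family x) h 1#
                (λ s t → trans (sym (Qh≡ s t)) (sym (*-identityˡ (Q h s t))))
                (λ s t → begin
                  R (family x) s t          ≡⟨ R≡ s t ⟩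
                  l s t * Q (family x) s t  ≡⟨ cong₂ _*_ (sym (l-determined l′ fl′ divides s t)) (sym (Qh≡ s t)) ⟩
                  l′ s t * Q h s t          ≡⟨ sym (divides h kills s t) ⟩
                  R h s t                   ≡⟨ sym (*-identityˡ (R h s t)) ⟩
                  1# * R h s t              ∎)

          same-plane⇒splash : SamePlane wπ w → InSplash (Bset wα) wπ
          same-plane⇒splash same = inj₁ U , valid , spreadPlane⊆line {U} {w} U∩Σ {wπ} same , proj₁ subplane (inj₁ U) valid two

          -- If the spread element of `U` were different from π, the member would contain both,
          -- hence Σ∞. Equality of spread elements is not decided here, so the conclusion is doubly
          -- negated; this suffices for π outside the splash.
          not-not-splash : ¬ ¬ InSplash (Bset wα) wπ
          not-not-splash ¬splash = family-not-at-infinity x (distinct-planes-span {wπ} {w} wπ≢0 w≢0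
            (λ same → ¬splash (same-plane⇒splash same)) (family x) (family-kills-π x) (λ k → section-kills-U (suc k)))

      abstract
        non-splash⇒non-divisible : ¬ InSplash (Bset wα) wπ → ∀ x → ¬ Divisible x
        non-splash⇒non-divisible ¬splash x (l , fl , R≡) = Divisor.not-not-splash x l fl R≡ ¬splash

theorem5p1 :
  (F : FiniteField) → let open Geometry F in
  6 ≤ q →
  -- Σ∞ = ⟨b₀,…,b₅⟩ and the regular 2-spread S of Σ∞ (field reduction via c)
  (b : Fin 6 → V7) → Independent b →
  (c : Fin 3 → K) → IrreducibleCubic c →
  -- the ruled quintic surface V (conic on p, twisted cubic on r, projectivity φ)
  (p : Fin 3 → V7) (r : Fin 4 → V7) (φ : Projectivity) → Independent (p ++ r) →
  let open Spread c b
      open Quintic p r φ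
      open Positioned c b p r φ
  in
  -- α ∈ S
  (wα : Fin 6 → K) → ValidIdx wα →
  -- V ∩ Σ∞ = C
  ((λ v → IsPoint v × InV v × InSigma v) ≐ InConic) →
  -- C ⊆ α
  (∀ v → InConic v → SpreadPlane wα v) →
  -- the affine points of V together with α form an F_q-subplane B meeting ℓ∞ only in α
  IsSubplaneOfOrder (Bset wα) q →
  (∀ x → BP (Bset wα) x → Inc x ℓ∞ → x ≈P inj₂ wα) →
  -- ℓ a line of α with |ℓ ∩ C| = i
  (ℓ : Fin 2 → V7) → Independent ℓ → (∀ v → SubspacePts ℓ v → SpreadPlane wα v) →
  (i : ℕ) → HasExactly _∼_ (λ v → SubspacePts ℓ v × InConic v) i →
  -- π ∈ S, π ≠ α
  (wπ : Fin 6 → K) → ValidIdx wπ → ¬ SamePlane wπ wα →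
  (InSplash (Bset wα) wπ →
     HasExactly _∼_ (Admissible wπ ℓ) q ×
     HasExactly _∼_ (λ h → Admissible wπ ℓ h × MeetsInNRC 5 h) (q ∸ 1) ×
     HasExactly _∼_ (λ h → Admissible wπ ℓ h × MeetsInNRCAndGens 3 i h) 1)
  ×
  (¬ InSplash (Bset wα) wπ →
     HasExactly _∼_ (Admissible wπ ℓ) q ×
     HasExactly _∼_ (λ h → Admissible wπ ℓ h × MeetsInNRC 5 h) (q ∸ i) ×
     HasExactly _∼_ (λ h → Admissible wπ ℓ h × MeetsInNRCAndGens 4 1 h) i)
theorem5p1 F 6≤q b b-indep c irreducible p r φ indep wα wα≢0 conic-at-infinity conic⊆α subplane _
           ℓ ℓ-indep ℓ⊂α i points wπ wπ≢0 π≁α =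
    (λ splash → hyperplane-count , splash-count (proj₁ (splash⇒divisible splash)) (proj₂ (splash⇒divisible splash))) ,
    (λ ¬splash → hyperplane-count , non-splash-count (non-splash⇒non-divisible ¬splash))
  where
  open Placement F 6≤q b b-indep c irreducible p r φ indep
  open Subplane wα wα≢0 conic-at-infinity conic⊆α subplane
  open Pencil ℓ ℓ-indep ℓ⊂α wπ wπ≢0 π≁α
  open ConicPoints i points
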